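{- For every $\varepsilon\in(0,1)$ there is $C_0$ such that for every $C\ge C_0$ the following holds. Let $\mathcal{F}_i\subseteq\binom{[n]}{k_i}$ with $C\le k_i\le n/(Cs)$ for all $i\in[s]$. If $\mathcal{F}_1,\dots,\mathcal{F}_s$ do not cross contain a matching and $|\mathcal{F}_i|\ge|\mathcal{S}_{n,k_i,s-1}|-(1-\varepsilon)\binom{n-1}{k_i-1}$ for each $i$, then there is $J\in\binom{[n]}{s-1}$ such that $|\mathcal{F}_i\setminus\mathcal{S}_{n,k_i,J}|\le\varepsilon\binom{n-1}{k_i-1}$ for all $i\in[s]$.
   Context: $\mathcal{S}_{n,k,J}=\{A\in\binom{[n]}{k}:A\cap J\ne\emptyset\}$ and $\mathcal{S}_{n,k,t}=\mathcal{S}_{n,k,[t]}$. Families $\mathcal{F}_1,\dots,\mathcal{F}_s$ cross contain a matching if there are pairwise disjoint $A_1,\dots,A_s$ with $A_i\in\mathcal{F}_i$. (The paper writes the dependence as $0<C^{ -1}\ll\varepsilon$.) -}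

module Defs where

open import Data.Nat using (ℕ; zero; suc; _≡ᵇ_; _<ᵇ_)
open import Data.Bool using (Bool; true; false; _∧_; not)
open import Data.List using (List; []; _∷_; length; filterᵇ; map; _++_)
open import Data.Vec using (Vec; []; _∷_; tabulate; foldr)
open import Data.Fin using (Fin; toℕ)
open import Data.Fin.Subset using (Subset; _∩_; ∣_∣; ⊥)
open import Relation.Binary.PropositionalEquality using (_≡_; _≢_)
open import Data.Product using (∃; _×_)

Family : ℕ → Set
Family n = Subset n → Bool

allSubsets : (n : ℕ) → List (Subset n)
allSubsets zero = [] ∷ []
allSubsets (suc n) = map (false ∷_) (allSubsets n) ++ map (true ∷_) (allSubsets n)

card : ∀ {n} → Family n → ℕ
card {n} F = length (filterᵇ F (allSubsets n))

Uniform : ∀ {n} → ℕ → Family n → Set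
Uniform k F = ∀ A → F A ≡ true → ∣ A ∣ ≡ k

isEmpty : ∀ {n} → Subset n → Bool
isEmpty = foldr _ (λ b r → not b ∧ r) true

S : (n k : ℕ) → Subset n → Family n
S n k J A = (∣ A ∣ ≡ᵇ k) ∧ not (isEmpty (A ∩ J))

initSeg : (n t : ℕ) → Subset n
initSeg n t = tabulate (λ i → toℕ i <ᵇ t)

_∖_ : ∀ {n} → Family n → Family n → Family n
(F ∖ G) A = F A ∧ not (G A)

CrossMatching : ∀ {n s} → (Fin s → Family n) → Set
CrossMatching {n} {s} F =
  ∃ λ (A : Fin s → Subset n) →
    (∀ i → F i (A i) ≡ true) × (∀ i j → i ≢ j → A i ∩ A j ≡ ⊥)

{-# OPTIONS --safe #-}
module Submission where

open import Defs
open import Data.Bool using (Bool; true; false; not; _∧_; _∨_)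
open import Data.Bool.ListAction using (any)
open import Data.Bool.Properties using (T-≡; ¬-not) renaming (_≟_ to _≟ᵇ_)
open import Data.Empty using (⊥-elim)
open import Data.Fin using (Fin; zero; suc)
import Data.Fin as Fin
open import Data.Fin.Properties using (any?)
open import Data.Fin.Subset using (Subset; ∣_∣; ⊥; _⊆_; _∈_; _∉_; _∩_)
open import Data.Fin.Subset.Properties using (∣p∣≤n; ∣⊥∣≡0; Empty-unique; ∉⊥; x∈p∩q⁻; x∈p∩q⁺; anySubset?; ∣p∣≤∣x∷p∣; _⊆?_; _∈?_)
open import Data.List using (List; []; _∷_; _++_; length; map; concat; concatMap; filterᵇ; allFin)
import Data.List.Membership.Propositional as List
open import Data.List.Membership.Propositional.Properties using (∈-++⁻; ∈-++⁺ˡ; ∈-++⁺ʳ; ∈-allFin; ∈-map⁺)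
open import Data.List.Properties using (++-assoc; ++-identityʳ; map-tabulate; length-tabulate)
open import Data.List.Relation.Binary.Subset.Propositional using () renaming (_⊆_ to _⊑_)
open import Data.List.Relation.Binary.Subset.Propositional.Properties using (xs⊆xs++ys; xs⊆ys++xs; ++⁺ʳ; ++⁺ˡ)
import Data.List.Relation.Unary.Any as Any
open import Data.Maybe using (Maybe; just; nothing; is-nothing)
open import Data.Maybe.Properties using (just-injective)
open import Data.Nat
open import Data.Nat.Combinatorics using (_C_; nCk+nC[k+1]≡[n+1]C[k+1]; k>n⇒nCk≡0; nCn≡1)
open import Data.Nat.DivMod using (m≡m%n+[m/n]*n; m%n<n; m/n*n≤m; m≥n⇒m/n>0)
open import Data.Nat.Properties
open import Data.Nat.Tactic.RingSolver using (solve-∀)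
open import Data.Product using (∃; _×_; _,_; proj₁; proj₂)
open import Data.Sum using (inj₁; inj₂; _⊎_; map₂; [_,_]′)
open import Data.Vec using ([]; _∷_; lookup; _[_]≔_; here; there)
open import Data.Vec.Functional using (updateAt)
open import Data.Vec.Functional.Properties using (updateAt-updates; updateAt-minimal)
open import Data.Vec.Properties using (lookup∘update; lookup∘update′; []=⇒lookup; lookup⇒[]=; []≔-lookup; []≔-idempotent)
open import Function using (_∘_; id; Equivalence; const)
open import Relation.Binary.PropositionalEquality hiding (J)
open import Relation.Nullary using (contradiction; ¬_; Dec; yes; no; does)
open import Relation.Nullary.Decidable using (_×-dec_; dec-true; ¬?)

-- Densities are measured on words: w ∈ [n]^ℓ is good for a family if its letters contain a member.
-- A family of density comparable to r ℓ / n either is completed with high probability by a single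
-- fixed letter j ("heavy"), or its density at a constant multiple Λ of the length exceeds 6 r Λ / n:
-- split a good word into halves.  If usually one half alone has a fair chance of being completed to a
-- good word, pass to such halves, at half the length and almost without loss of relative density;
-- after log ℓ steps only a letter is left.  Otherwise good words are composed of two halves neither of
-- which is special, and then combining K halves with K other halves multiplies the density by about
-- K², not just by 2K.
--
-- Now match families greedily with distinct heavy letters, and let J be the set of letters used and r
-- the number of unmatched families.  The matched families are dense and the unmatched ones, restricted
-- to the sets avoiding J, are boosted, so a weighted form of the Huang-Loh-Sudakov matching lemma
-- yields a cross matching.  For r ≥ 2 the size hypothesis makes the restricted families large enough
-- for this.  Hence r = 1, the unmatched family is almost contained in the stars of J, and all of J is
-- heavy for it; so the unmatched family can take over the letter of any other one, and the same
-- conclusion with the same J holds for every family.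

-- Finite sums

-- At set size k, `cross-matching` asks for a density above u k / n, with u of the order of the
-- number of competing families; so what counts is density per unit of length. The size hypothesis
-- supplies r k / n only up to a factor depending on ε, and concatenating independent blocks
-- multiplies density and length alike, so this factor would never go away. Enlarging the two halves
-- separately beats it, K² against K, unless heavy halves make the K² combinations overlap.
--
-- Words replace sets because their blocks are exactly independent. Being good depends only on the
-- set of letters, so the two models agree up to constants, words of length 2k standing in for
-- k-sets.
--
-- If J has s - r elements, the families exceed the stars over J by about r - 1 stars less the
-- deficit 1 - ε. For r ≥ 2 this is a positive multiple of r stars; for r = 1 it gives nothing, and
-- smallness outside J has to come from the absence of a matching.

≤-from : ∀ {m n} o → m + o ≡ n → m ≤ n
≤-from {m} o eq = subst (m ≤_) eq (m≤m+n m o)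

ind : Bool → ℕ
ind true = 1
ind false = 0

ind≤1 : ∀ b → ind b ≤ 1
ind≤1 true = ≤-refl
ind≤1 false = z≤n

ind-mono : ∀ {a b} → (a ≡ true → b ≡ true) → ind a ≤ ind b
ind-mono {false} h = z≤n
ind-mono {true} h rewrite h refl = ≤-refl

ind-true : ∀ {a} → 0 < ind a → a ≡ true
ind-true {true} _ = refl

ind-not : ∀ b → ind b + ind (not b) ≡ 1
ind-not true = refl
ind-not false = refl

∑ : ∀ {X : Set} → List X → (X → ℕ) → ℕ
∑ [] f = 0
∑ (x ∷ xs) f = f x + ∑ xs f

infixr 5 ∑
syntax ∑ xs (λ x → e) = ∑[ x ← xs ] e

module _ {X : Set} where

  ∑-cong : ∀ xs {f g : X → ℕ} → (∀ x → f x ≡ g x) → ∑ xs f ≡ ∑ xs g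
  ∑-cong [] h = refl
  ∑-cong (x ∷ xs) h = cong₂ _+_ (h x) (∑-cong xs h)

  ∑-mono : ∀ xs {f g : X → ℕ} → (∀ x → f x ≤ g x) → ∑ xs f ≤ ∑ xs g
  ∑-mono [] h = z≤n
  ∑-mono (x ∷ xs) h = +-mono-≤ (h x) (∑-mono xs h)

  ∑-+ : ∀ xs (f g : X → ℕ) → ∑[ x ← xs ] (f x + g x) ≡ ∑ xs f + ∑ xs g
  ∑-+ [] f g = refl
  ∑-+ (x ∷ xs) f g rewrite ∑-+ xs f g = lem (f x) (g x) (∑ xs f) (∑ xs g)
    where
    lem : ∀ a b c d → a + b + (c + d) ≡ a + c + (b + d)
    lem = solve-∀

  ∑-*ˡ : ∀ xs c (f : X → ℕ) → ∑[ x ← xs ] (c * f x) ≡ c * ∑ xs f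
  ∑-*ˡ [] c f = sym (*-zeroʳ c)
  ∑-*ˡ (x ∷ xs) c f rewrite ∑-*ˡ xs c f = sym (*-distribˡ-+ c (f x) (∑ xs f))

  ∑-*ʳ : ∀ xs c (f : X → ℕ) → ∑[ x ← xs ] (f x * c) ≡ ∑ xs f * c
  ∑-*ʳ xs c f = begin
    ∑[ x ← xs ] (f x * c) ≡⟨ ∑-cong xs (λ x → *-comm (f x) c) ⟩
    ∑[ x ← xs ] (c * f x) ≡⟨ ∑-*ˡ xs c f ⟩
    c * ∑ xs f            ≡⟨ *-comm c (∑ xs f) ⟩
    ∑ xs f * c            ∎
    where open ≡-Reasoning

  ∑-const : ∀ (xs : List X) c → ∑[ _ ← xs ] c ≡ length xs * c
  ∑-const [] c = refl
  ∑-const (x ∷ xs) c = cong (c +_) (∑-const xs c)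

  ∑-++ : ∀ xs ys (f : X → ℕ) → ∑ (xs ++ ys) f ≡ ∑ xs f + ∑ ys f
  ∑-++ [] ys f = refl
  ∑-++ (x ∷ xs) ys f rewrite ∑-++ xs ys f = sym (+-assoc (f x) _ _)

  ∑-positive : ∀ xs (f : X → ℕ) → 0 < ∑ xs f → ∃ λ x → 0 < f x
  ∑-positive (x ∷ xs) f h with f x in eq
  ... | suc k = x , subst (0 <_) (sym eq) z<s
  ... | zero = ∑-positive xs f h

  ∑-filterᵇ : ∀ (b : X → Bool) xs → length (filterᵇ b xs) ≡ ∑ xs (ind ∘ b)
  ∑-filterᵇ b [] = refl
  ∑-filterᵇ b (x ∷ xs) with b x
  ... | true = cong suc (∑-filterᵇ b xs)
  ... | false = ∑-filterᵇ b xs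

  ∑-complement : ∀ xs (b : X → Bool) → ∑ xs (ind ∘ b) + ∑ xs (ind ∘ not ∘ b) ≡ length xs
  ∑-complement xs b = begin
    ∑ xs (ind ∘ b) + ∑ xs (ind ∘ not ∘ b)     ≡⟨ ∑-+ xs _ _ ⟨
    ∑[ x ← xs ] (ind (b x) + ind (not (b x))) ≡⟨ ∑-cong xs (λ x → ind-not (b x)) ⟩
    ∑[ x ← xs ] 1                             ≡⟨ ∑-const xs 1 ⟩
    length xs * 1                             ≡⟨ *-identityʳ _ ⟩
    length xs                                 ∎
    where open ≡-Reasoning

  ∑-ind≤length : ∀ xs (b : X → Bool) → ∑ xs (ind ∘ b) ≤ length xs
  ∑-ind≤length xs b = ≤-from _ (∑-complement xs b)

module _ {X Y : Set} where

  ∑-map : ∀ (g : X → Y) xs f → ∑ (map g xs) f ≡ ∑ xs (f ∘ g)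
  ∑-map g [] f = refl
  ∑-map g (x ∷ xs) f = cong (f (g x) +_) (∑-map g xs f)

  ∑-concatMap : ∀ (g : X → List Y) xs f → ∑ (concatMap g xs) f ≡ ∑[ x ← xs ] ∑ (g x) f
  ∑-concatMap g [] f = refl
  ∑-concatMap g (x ∷ xs) f =
    trans (∑-++ (g x) (concatMap g xs) f) (cong (∑ (g x) f +_) (∑-concatMap g xs f))

  ∑-swap : ∀ xs ys (f : X → Y → ℕ) →
    ∑[ x ← xs ] ∑[ y ← ys ] f x y ≡ ∑[ y ← ys ] ∑[ x ← xs ] f x y
  ∑-swap [] ys f = sym (trans (∑-const ys 0) (*-zeroʳ (length ys)))
  ∑-swap (x ∷ xs) ys f = trans (cong (∑ ys (f x) +_) (∑-swap xs ys f)) (sym (∑-+ ys _ _))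

-- Sequences and independent trials

seqs : ∀ {X : Set} → List X → ℕ → List (List X)
seqs xs zero = [] ∷ []
seqs xs (suc N) = concatMap (λ x → map (x ∷_) (seqs xs N)) xs

module _ {X : Set} (xs : List X) where

  ∑-seqs-suc : ∀ N f → ∑ (seqs xs (suc N)) f ≡ ∑[ x ← xs ] ∑[ ws ← seqs xs N ] f (x ∷ ws)
  ∑-seqs-suc N f = trans (∑-concatMap _ xs f) (∑-cong xs λ x → ∑-map (x ∷_) (seqs xs N) f)

  ∑-seqs-1 : ∀ f → ∑ (seqs xs 1) f ≡ ∑[ x ← xs ] f (x ∷ [])
  ∑-seqs-1 f = trans (∑-seqs-suc 0 f) (∑-cong xs λ x → +-identityʳ _)

  ∑-seqs-+ : ∀ M N f →
    ∑ (seqs xs (M + N)) f ≡ ∑[ u ← seqs xs M ] ∑[ v ← seqs xs N ] f (u ++ v)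
  ∑-seqs-+ zero N f = sym (+-identityʳ _)
  ∑-seqs-+ (suc M) N f = begin
    ∑ (seqs xs (suc M + N)) f
      ≡⟨ ∑-seqs-suc (M + N) f ⟩
    ∑[ x ← xs ] ∑[ w ← seqs xs (M + N) ] f (x ∷ w)
      ≡⟨ ∑-cong xs (λ x → ∑-seqs-+ M N (f ∘ (x ∷_))) ⟩
    ∑[ x ← xs ] ∑[ u ← seqs xs M ] ∑[ v ← seqs xs N ] f (x ∷ u ++ v)
      ≡⟨ ∑-seqs-suc M _ ⟨
    ∑[ u ← seqs xs (suc M) ] ∑[ v ← seqs xs N ] f (u ++ v) ∎
    where open ≡-Reasoning

  length-seqs : ∀ N → length (seqs xs N) ≡ length xs ^ N
  length-seqs N = begin
    length (seqs xs N)       ≡⟨ *-identityʳ _ ⟨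
    length (seqs xs N) * 1   ≡⟨ ∑-const (seqs xs N) 1 ⟨
    ∑[ _ ← seqs xs N ] 1     ≡⟨ go N ⟩
    length xs ^ N            ∎
    where
    open ≡-Reasoning
    go : ∀ N → ∑[ _ ← seqs xs N ] 1 ≡ length xs ^ N
    go zero = refl
    go (suc N) = trans (∑-seqs-suc N _) (trans (∑-cong xs λ _ → go N) (∑-const xs _))

  ∑-seqs-mono : ∀ N {f g : List X → ℕ} → (∀ ws → length ws ≡ N → f ws ≤ g ws) →
    ∑ (seqs xs N) f ≤ ∑ (seqs xs N) g
  ∑-seqs-mono zero h = +-monoˡ-≤ 0 (h [] refl)
  ∑-seqs-mono (suc N) {f} {g} h = begin
    ∑ (seqs xs (suc N)) f                       ≡⟨ ∑-seqs-suc N f ⟩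
    ∑[ x ← xs ] ∑[ ws ← seqs xs N ] f (x ∷ ws)
      ≤⟨ ∑-mono xs (λ x → ∑-seqs-mono N λ ws eq → h (x ∷ ws) (cong suc eq)) ⟩
    ∑[ x ← xs ] ∑[ ws ← seqs xs N ] g (x ∷ ws)  ≡⟨ ∑-seqs-suc N g ⟨
    ∑ (seqs xs (suc N)) g                       ∎
    where open ≤-Reasoning

module _ {X : Set} (xs : List X) where

  ∑-seqs-* : ∀ N ℓ f → ∑ (seqs xs (N * ℓ)) f ≡ ∑ (seqs (seqs xs ℓ) N) (f ∘ concat)
  ∑-seqs-* zero ℓ f = refl
  ∑-seqs-* (suc N) ℓ f = begin
    ∑ (seqs xs (ℓ + N * ℓ)) f
      ≡⟨ ∑-seqs-+ xs ℓ (N * ℓ) f ⟩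
    ∑[ u ← seqs xs ℓ ] ∑[ v ← seqs xs (N * ℓ) ] f (u ++ v)
      ≡⟨ ∑-cong (seqs xs ℓ) (λ u → ∑-seqs-* N ℓ (f ∘ (u ++_))) ⟩
    ∑[ u ← seqs xs ℓ ] ∑[ vs ← seqs (seqs xs ℓ) N ] f (u ++ concat vs)
      ≡⟨ ∑-seqs-suc (seqs xs ℓ) N (f ∘ concat) ⟨
    ∑ (seqs (seqs xs ℓ) (suc N)) (f ∘ concat) ∎
    where open ≡-Reasoning

module _ {X : Set} (xs : List X) (b : X → Bool) where

  private
    T = length xs
    a = ∑ xs (ind ∘ b)
    c = ∑ xs (ind ∘ not ∘ b)

  some-hit : ∀ N → T ^ N ≤ ∑ (seqs xs N) (ind ∘ any b) + c ^ N
  some-hit zero = s≤s z≤n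
  some-hit (suc N) = begin
    T * T ^ N                                        ≡⟨ ∑-const xs _ ⟨
    ∑[ _ ← xs ] T ^ N                                ≤⟨ ∑-mono xs pointwise ⟩
    ∑[ x ← xs ] ((∑[ ws ← seqs xs N ] ind (any b (x ∷ ws))) + ind (not (b x)) * c ^ N)
      ≡⟨ ∑-+ xs _ _ ⟩
    (∑[ x ← xs ] ∑[ ws ← seqs xs N ] ind (any b (x ∷ ws))) + (∑[ x ← xs ] (ind (not (b x)) * c ^ N))
      ≡⟨ cong₂ _+_ (sym (∑-seqs-suc xs N _)) (∑-*ʳ xs (c ^ N) _) ⟩
    ∑ (seqs xs (suc N)) (ind ∘ any b) + c * c ^ N ∎
    where
    open ≤-Reasoning
    pointwise : ∀ x → T ^ N ≤ (∑[ ws ← seqs xs N ] ind (any b (x ∷ ws))) + ind (not (b x)) * c ^ N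
    pointwise x with b x
    ... | true = ≤-trans (≤-reflexive (trans (sym (length-seqs xs N))
                   (trans (sym (*-identityʳ _)) (sym (∑-const (seqs xs N) 1))))) (m≤m+n _ _)
    ... | false = subst (λ z → T ^ N ≤ ∑ (seqs xs N) (ind ∘ any b) + z) (sym (+-identityʳ (c ^ N)))
                    (some-hit N)

  -- (1 - p)^N ≤ 1 / (1 + N p), since (1 + p)^N ≥ 1 + N p.
  miss-bound : ∀ N → c ^ N * (T + N * a) ≤ T * T ^ N
  miss-bound zero = ≤-reflexive (lem T)
    where
    lem : ∀ t → 1 * (t + 0) ≡ t * 1
    lem = solve-∀
  miss-bound (suc N) = begin
    c * c ^ N * (T + (a + N * a))   ≡⟨ cong (λ t → c * c ^ N * (t + (a + N * a))) (sym (∑-complement xs b)) ⟩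
    c * c ^ N * (a + c + (a + N * a)) ≤⟨ ≤-from _ (lem c (c ^ N) a (N * a)) ⟩
    (a + c) * (c ^ N * (a + c + N * a)) ≡⟨ cong (λ t → t * (c ^ N * (t + N * a))) (∑-complement xs b) ⟩
    T * (c ^ N * (T + N * a))       ≤⟨ *-monoʳ-≤ T (miss-bound N) ⟩
    T * (T * T ^ N)                 ∎
    where
    open ≤-Reasoning
    lem : ∀ c p a e → c * p * (a + c + (a + e)) + p * a * (a + e) ≡ (a + c) * (p * (a + c + e))
    lem = solve-∀

  -- With p = a / T, the hit probability is at least N p / (1 + N p). One bound serves both regimes:
  -- it is at least N p / 2 while N p ≤ 1, and at least K / (K + 1) once N p ≥ K.
  amplify : ∀ N → N * a * T ^ N ≤ ∑ (seqs xs N) (ind ∘ any b) * (T + N * a)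
  amplify N = +-cancelˡ-≤ (T * T ^ N) _ _ (begin
    T * T ^ N + N * a * T ^ N       ≡⟨ *-distribʳ-+ (T ^ N) T (N * a) ⟨
    (T + N * a) * T ^ N             ≡⟨ *-comm (T + N * a) _ ⟩
    T ^ N * (T + N * a)             ≤⟨ *-monoˡ-≤ (T + N * a) (some-hit N) ⟩
    (H + c ^ N) * (T + N * a)       ≡⟨ *-distribʳ-+ (T + N * a) H (c ^ N) ⟩
    H * (T + N * a) + c ^ N * (T + N * a) ≤⟨ +-monoʳ-≤ _ (miss-bound N) ⟩
    H * (T + N * a) + T * T ^ N     ≡⟨ +-comm _ (T * T ^ N) ⟩
    T * T ^ N + H * (T + N * a)     ∎)
    where
    open ≤-Reasoning
    H = ∑ (seqs xs N) (ind ∘ any b)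

  amplify-sparse : ∀ N → N * a ≤ T → N * a * T ^ N ≤ ∑ (seqs xs N) (ind ∘ any b) * (2 * T)
  amplify-sparse N h = ≤-trans (amplify N) (*-monoʳ-≤ (∑ (seqs xs N) (ind ∘ any b))
    (≤-trans (+-monoʳ-≤ T h) (≤-reflexive (cong (T +_) (sym (+-identityʳ T))))))

-- Monotone properties of words

≤ᵇ-true : ∀ {m n} → m ≤ n → (m ≤ᵇ n) ≡ true
≤ᵇ-true {m} {n} h with m ≤ᵇ n | ≤⇒≤ᵇ h
... | true | _ = refl

≤ᵇ-true⁻ : ∀ {m n} → (m ≤ᵇ n) ≡ true → m ≤ n
≤ᵇ-true⁻ {m} {n} h = ≤ᵇ⇒≤ m n (subst T (sym h) _)
  where open import Data.Bool using (T)

≤ᵇ-false⁻ : ∀ {m n} → (m ≤ᵇ n) ≡ false → n ≤ m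
≤ᵇ-false⁻ {m} {n} h with ≤-total n m
... | inj₁ p = p
... | inj₂ p with () ← trans (sym h) (≤ᵇ-true p)

∧-true : ∀ {a b} → a ∧ b ≡ true → a ≡ true × b ≡ true
∧-true {true} {true} _ = refl , refl

++-comm-⊑ : ∀ {X : Set} (u v : List X) → u ++ v ⊑ v ++ u
++-comm-⊑ u v m with ∈-++⁻ u m
... | inj₁ p = ∈-++⁺ʳ v p
... | inj₂ p = ∈-++⁺ˡ p

ind-any≤∑ : ∀ {X : Set} (b : X → Bool) xs → ind (any b xs) ≤ ∑ xs (ind ∘ b)
ind-any≤∑ b [] = z≤n
ind-any≤∑ b (x ∷ xs) with b x
... | true = s≤s z≤n
... | false = ind-any≤∑ b xs

Mono : ∀ {X : Set} → (List X → Bool) → Set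
Mono P = ∀ {u v} → u ⊑ v → P u ≡ true → P v ≡ true

module _ {X : Set} where

  Mono-++ : ∀ {P : List X → Bool} u → Mono P → Mono (P ∘ (u ++_))
  Mono-++ u mP v⊑w = mP (++⁺ʳ u v⊑w)

  any⇒concat : ∀ {P : List X → Bool} → Mono P → ∀ ws → any P ws ≡ true → P (concat ws) ≡ true
  any⇒concat {P} mP (w ∷ ws) h with P w in eq
  ... | true = mP (xs⊆xs++ys w (concat ws)) eq
  ... | false = mP (xs⊆ys++xs (concat ws) w) (any⇒concat mP ws h)

module Words {X : Set} (xs : List X) (n : ℕ) (∣xs∣≡n : length xs ≡ n) where

  length-words : ∀ ℓ → length (seqs xs ℓ) ≡ n ^ ℓ
  length-words ℓ = trans (length-seqs xs ℓ) (cong (_^ ℓ) ∣xs∣≡n)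

  cnt : ℕ → (List X → Bool) → ℕ
  cnt ℓ P = ∑ (seqs xs ℓ) (ind ∘ P)

  cnt-mono : ∀ ℓ {P Q} → (∀ w → P w ≡ true → Q w ≡ true) → cnt ℓ P ≤ cnt ℓ Q
  cnt-mono ℓ h = ∑-mono (seqs xs ℓ) λ w → ind-mono (h w)

  cnt-pad : ∀ {P} → Mono P → ∀ ℓ m → cnt ℓ P * n ^ m ≤ cnt (ℓ + m) P
  cnt-pad {P} mP ℓ m = begin
    cnt ℓ P * n ^ m
      ≡⟨ ∑-*ʳ (seqs xs ℓ) (n ^ m) (ind ∘ P) ⟨
    ∑[ u ← seqs xs ℓ ] (ind (P u) * n ^ m)
      ≡⟨ ∑-cong (seqs xs ℓ) (λ u → trans (*-comm (ind (P u)) (n ^ m))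
           (trans (cong (_* ind (P u)) (sym (length-words m))) (sym (∑-const (seqs xs m) _)))) ⟩
    ∑[ u ← seqs xs ℓ ] ∑[ _ ← seqs xs m ] ind (P u)
      ≤⟨ ∑-mono (seqs xs ℓ) (λ u → ∑-mono (seqs xs m) λ v → ind-mono (mP (xs⊆xs++ys u v))) ⟩
    ∑[ u ← seqs xs ℓ ] ∑[ v ← seqs xs m ] ind (P (u ++ v))
      ≡⟨ ∑-seqs-+ xs ℓ m _ ⟨
    cnt (ℓ + m) P ∎
    where open ≤-Reasoning

  -- The N blocks of a word of length N ℓ are independent, and by monotonicity a single good block
  -- makes the whole word good.
  cnt-amplify : ∀ {P} → Mono P → ∀ N ℓ →
    N * cnt ℓ P * n ^ (N * ℓ) ≤ cnt (N * ℓ) P * (n ^ ℓ + N * cnt ℓ P)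
  cnt-amplify {P} mP N ℓ = begin
    N * cnt ℓ P * n ^ (N * ℓ)
      ≡⟨ cong (N * cnt ℓ P *_) (trans (cong (n ^_) (*-comm N ℓ)) (trans (sym (^-*-assoc n ℓ N))
           (cong (_^ N) (sym (length-words ℓ))))) ⟩
    N * cnt ℓ P * length (seqs xs ℓ) ^ N
      ≤⟨ amplify (seqs xs ℓ) P N ⟩
    ∑ (seqs (seqs xs ℓ) N) (ind ∘ any P) * (length (seqs xs ℓ) + N * cnt ℓ P)
      ≡⟨ cong (λ t → ∑ (seqs (seqs xs ℓ) N) (ind ∘ any P) * (t + N * cnt ℓ P)) (length-words ℓ) ⟩
    ∑ (seqs (seqs xs ℓ) N) (ind ∘ any P) * (n ^ ℓ + N * cnt ℓ P)
      ≤⟨ *-monoˡ-≤ _ (∑-mono (seqs (seqs xs ℓ) N) λ ws → ind-mono (any⇒concat mP ws)) ⟩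
    ∑ (seqs (seqs xs ℓ) N) (ind ∘ P ∘ concat) * (n ^ ℓ + N * cnt ℓ P)
      ≡⟨ cong (_* (n ^ ℓ + N * cnt ℓ P)) (∑-seqs-* xs N ℓ (ind ∘ P)) ⟨
    cnt (N * ℓ) P * (n ^ ℓ + N * cnt ℓ P) ∎
    where open ≤-Reasoning

  cnt-compose : ∀ {G P} a b ℓ B →
    (∀ w → G w ≡ true → a * n ^ B ≤ b * cnt B (P ∘ (w ++_))) →
    a * cnt ℓ G * n ^ B ≤ b * cnt (ℓ + B) P
  cnt-compose {G} {P} a b ℓ B h = begin
    a * cnt ℓ G * n ^ B
      ≡⟨ cong (_* n ^ B) (∑-*ˡ (seqs xs ℓ) a _) ⟨
    (∑[ u ← seqs xs ℓ ] (a * ind (G u))) * n ^ B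
      ≡⟨ ∑-*ʳ (seqs xs ℓ) (n ^ B) _ ⟨
    ∑[ u ← seqs xs ℓ ] (a * ind (G u) * n ^ B)
      ≤⟨ ∑-mono (seqs xs ℓ) pointwise ⟩
    ∑[ u ← seqs xs ℓ ] (b * cnt B (P ∘ (u ++_)))
      ≡⟨ ∑-*ˡ (seqs xs ℓ) b _ ⟩
    b * (∑[ u ← seqs xs ℓ ] ∑[ v ← seqs xs B ] ind (P (u ++ v)))
      ≡⟨ cong (b *_) (∑-seqs-+ xs ℓ B _) ⟨
    b * cnt (ℓ + B) P ∎
    where
    open ≤-Reasoning
    pointwise : ∀ u → a * ind (G u) * n ^ B ≤ b * cnt B (P ∘ (u ++_))
    pointwise u with G u in eq
    ... | true = ≤-trans (≤-reflexive (cong (_* n ^ B) (*-identityʳ a))) (h u eq)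
    ... | false = ≤-trans (≤-reflexive (cong (_* n ^ B) (*-zeroʳ a))) z≤n

  module Halving (G : List X → Bool) (mG : Mono G) (h K : ℕ) .{{_ : NonZero K}} where

    W : List (List X)
    W = seqs xs h

    T : ℕ
    T = length W

    -- A word is heavy if a random word of length h completes it to a member of G with probability at least
    -- K⁻², and Q consists of the members of G with no heavy half.
    Heavy : List X → Bool
    Heavy w = T ≤ᵇ K * K * (∑[ v ← W ] ind (G (w ++ v)))

    Heavy-mono : Mono Heavy
    Heavy-mono {u} {v} u⊑v hu = ≤ᵇ-true {T} (≤-trans (≤ᵇ-true⁻ {T} hu)
      (*-monoʳ-≤ (K * K) (∑-mono W λ w → ind-mono (mG (++⁺ˡ w u⊑v)))))

    Q : List X → List X → Bool
    Q u v = G (u ++ v) ∧ not (Heavy u) ∧ not (Heavy v)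

    β : ℕ
    β = ∑[ u ← W ] ∑[ v ← W ] ind (Q u v)

    -- A member of G outside `Q` has a heavy half, on the left or on the right; the other half is
    -- then counted as arbitrary.
    split : cnt (h + h) G ≤ β + 2 * (cnt h Heavy * T)
    split = begin
      cnt (h + h) G
        ≡⟨ ∑-seqs-+ xs h h _ ⟩
      ∑[ u ← W ] ∑[ v ← W ] ind (G (u ++ v))
        ≤⟨ ∑-mono W (λ u → ∑-mono W λ v → cover (G (u ++ v)) (Heavy u) (Heavy v)) ⟩
      ∑[ u ← W ] ∑[ v ← W ] (ind (Q u v) + (ind (Heavy u) + ind (Heavy v)))
        ≡⟨ ∑-cong W (λ u → trans (∑-+ W _ _) (cong (∑ W (ind ∘ Q u) +_) (trans (∑-+ W _ _)
             (cong (_+ H) (∑-const W _))))) ⟩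
      ∑[ u ← W ] (∑ W (ind ∘ Q u) + (T * ind (Heavy u) + H))
        ≡⟨ trans (∑-+ W _ _) (cong (β +_) (trans (∑-+ W _ _) (cong₂ _+_ (∑-*ˡ W T _) (∑-const W H)))) ⟩
      β + (T * H + T * H)
        ≡⟨ cong (β +_) (lem T H) ⟩
      β + 2 * (H * T) ∎
      where
      open ≤-Reasoning
      H = cnt h Heavy
      lem : ∀ t h → t * h + t * h ≡ 2 * (h * t)
      lem = solve-∀
      cover : ∀ a b c → ind a ≤ ind (a ∧ not b ∧ not c) + (ind b + ind c)
      cover false b c = z≤n
      cover true true c = s≤s z≤n
      cover true false true = s≤s z≤n
      cover true false false = s≤s z≤n

    private
      light : ∀ {u} → Heavy u ≡ false → K * K * (∑[ v ← W ] ind (G (u ++ v))) ≤ T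
      light = ≤ᵇ-false⁻

    degˡ : ∀ u → K * K * (∑[ v ← W ] ind (Q u v)) ≤ T
    degˡ u with Heavy u in eq
    ... | true = ≤-trans (*-monoʳ-≤ (K * K) (≤-trans (∑-mono W λ v → zero≤ (G (u ++ v)))
                   (≤-reflexive (trans (∑-const W 0) (*-zeroʳ T))))) (≤-trans (≤-reflexive (*-zeroʳ (K * K))) z≤n)
      where
      zero≤ : ∀ a → ind (a ∧ false) ≤ 0
      zero≤ true = z≤n
      zero≤ false = z≤n
    ... | false = ≤-trans (*-monoʳ-≤ (K * K) (∑-mono W λ v → drop (G (u ++ v)))) (light eq)
      where
      drop : ∀ a {b} → ind (a ∧ b) ≤ ind a
      drop true {b} = ind≤1 b
      drop false = z≤n

    -- `Heavy` looks at completions on the right only, but a monotone G depends only on the set of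
    -- letters, so `Q` is symmetric.
    degʳ : ∀ v → K * K * (∑[ u ← W ] ind (Q u v)) ≤ T
    degʳ v = ≤-trans (*-monoʳ-≤ (K * K) (∑-mono W λ u → ind-mono (flip u))) (degˡ v)
      where
      swap-∧ : ∀ a b c d → (a ≡ true → d ≡ true) → a ∧ not b ∧ not c ≡ true → d ∧ not c ∧ not b ≡ true
      swap-∧ true false false d f _ rewrite f refl = refl
      flip : ∀ u → Q u v ≡ true → Q v u ≡ true
      flip u = swap-∧ (G (u ++ v)) (Heavy u) (Heavy v) (G (v ++ u)) (mG (++-comm-⊑ u v))

    K≤K² : ∀ d → K * K * d ≤ T → K * d ≤ T
    K≤K² d le = ≤-trans (*-monoˡ-≤ d (m≤m*n K K)) le

    private
      N = seqs W K

      D : List (List X) → ℕ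
      D ws = ∑[ v ← W ] ind (any (λ u → Q u v) ws)

    -- Here the threshold K⁻² is spent: K words have together at most K · T / K² partners, just few
    -- enough for a second sparse amplification with K trials.
    D-small : ∀ ws → length ws ≡ K → K * D ws ≤ T
    D-small ws eq = *-cancelˡ-≤ K (begin
      K * (K * D ws)
        ≡⟨ *-assoc K K (D ws) ⟨
      K * K * D ws
        ≤⟨ *-monoʳ-≤ (K * K) (∑-mono W λ v → ind-any≤∑ _ ws) ⟩
      K * K * (∑[ v ← W ] ∑[ u ← ws ] ind (Q u v))
        ≡⟨ cong (K * K *_) (∑-swap W ws _) ⟩
      K * K * (∑[ u ← ws ] ∑[ v ← W ] ind (Q u v))
        ≡⟨ ∑-*ˡ ws (K * K) _ ⟨
      ∑[ u ← ws ] (K * K * (∑[ v ← W ] ind (Q u v)))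
        ≤⟨ ∑-mono ws degˡ ⟩
      ∑[ u ← ws ] T
        ≡⟨ ∑-const ws T ⟩
      length ws * T
        ≡⟨ cong (_* T) eq ⟩
      K * T ∎)
      where open ≤-Reasoning

    left : K * β * T ^ K ≤ ∑ N D * (2 * T)
    left = begin
      K * β * T ^ K
        ≡⟨ cong (λ z → K * z * T ^ K) (∑-swap W W _) ⟩
      K * (∑[ v ← W ] ∑[ u ← W ] ind (Q u v)) * T ^ K
        ≡⟨ cong (_* T ^ K) (∑-*ˡ W K _) ⟨
      (∑[ v ← W ] (K * (∑[ u ← W ] ind (Q u v)))) * T ^ K
        ≡⟨ ∑-*ʳ W (T ^ K) _ ⟨
      ∑[ v ← W ] (K * (∑[ u ← W ] ind (Q u v)) * T ^ K)
        ≤⟨ ∑-mono W (λ v → amplify-sparse W (λ u → Q u v) K (K≤K² _ (degʳ v))) ⟩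
      ∑[ v ← W ] ((∑[ ws ← N ] ind (any (λ u → Q u v) ws)) * (2 * T))
        ≡⟨ ∑-*ʳ W (2 * T) _ ⟩
      (∑[ v ← W ] ∑[ ws ← N ] ind (any (λ u → Q u v) ws)) * (2 * T)
        ≡⟨ cong (_* (2 * T)) (∑-swap W N _) ⟩
      ∑ N D * (2 * T) ∎
      where open ≤-Reasoning

    right : K * ∑ N D * T ^ K ≤ cnt (K * h + K * h) G * (2 * T)
    right = begin
      K * ∑ N D * T ^ K
        ≡⟨ cong (_* T ^ K) (∑-*ˡ N K D) ⟨
      (∑[ us ← N ] (K * D us)) * T ^ K
        ≡⟨ ∑-*ʳ N (T ^ K) _ ⟨
      ∑[ us ← N ] (K * D us * T ^ K)
        ≤⟨ ∑-seqs-mono W K (λ us eq →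
             amplify-sparse W (λ v → any (λ u → Q u v) us) K (D-small us eq)) ⟩
      ∑[ us ← N ] ((∑[ vs ← N ] ind (any (λ v → any (λ u → Q u v) us) vs)) * (2 * T))
        ≡⟨ ∑-*ʳ N (2 * T) _ ⟩
      (∑[ us ← N ] ∑[ vs ← N ] ind (any (λ v → any (λ u → Q u v) us) vs)) * (2 * T)
        ≤⟨ *-monoˡ-≤ (2 * T) (∑-mono N λ us → ∑-mono N λ vs → ind-mono (found us vs)) ⟩
      (∑[ us ← N ] ∑[ vs ← N ] ind (G (concat us ++ concat vs))) * (2 * T)
        ≡⟨ cong (_* (2 * T)) (∑-cong N λ us → ∑-seqs-* xs K h _) ⟨
      (∑[ us ← N ] ∑[ v ← seqs xs (K * h) ] ind (G (concat us ++ v))) * (2 * T)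
        ≡⟨ cong (_* (2 * T)) (∑-seqs-* xs K h _) ⟨
      (∑[ u ← seqs xs (K * h) ] ∑[ v ← seqs xs (K * h) ] ind (G (u ++ v))) * (2 * T)
        ≡⟨ cong (_* (2 * T)) (∑-seqs-+ xs (K * h) (K * h) _) ⟨
      cnt (K * h + K * h) G * (2 * T) ∎
      where
      open ≤-Reasoning
      foundˡ : ∀ us v → any (λ u → Q u v) us ≡ true → G (concat us ++ v) ≡ true
      foundˡ (u ∷ us) v e with Q u v in eq
      ... | true with p , _ ← ∧-true eq = mG (++⁺ˡ v (xs⊆xs++ys u (concat us))) p
      ... | false = mG (++⁺ˡ v (xs⊆ys++xs (concat us) u)) (foundˡ us v e)
      found : ∀ us vs → any (λ v → any (λ u → Q u v) us) vs ≡ true → G (concat us ++ concat vs) ≡ true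
      found us (v ∷ vs) e with any (λ u → Q u v) us in eq
      ... | true = mG (++⁺ʳ (concat us) (xs⊆xs++ys v (concat vs))) (foundˡ us v eq)
      ... | false = mG (++⁺ʳ (concat us) (xs⊆ys++xs (concat vs) v)) (found us vs e)

    -- Two sparse amplifications, each gaining a factor K / 2: K candidates for the left half
    -- against a fixed right half, then K candidates for the right half against the fixed left ones.
    -- The length grows only by the factor K.
    boost : K * K * β * (T ^ K * T ^ K) ≤ 4 * (T * T) * cnt (K * h + K * h) G
    boost = begin
      K * K * β * (T ^ K * T ^ K)       ≡⟨ e₁ K β (T ^ K) ⟩
      K * T ^ K * (K * β * T ^ K)       ≤⟨ *-monoʳ-≤ (K * T ^ K) left ⟩
      K * T ^ K * (∑ N D * (2 * T))     ≡⟨ e₂ K (T ^ K) (∑ N D) T ⟩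
      2 * T * (K * ∑ N D * T ^ K)       ≤⟨ *-monoʳ-≤ (2 * T) right ⟩
      2 * T * (cnt (K * h + K * h) G * (2 * T)) ≡⟨ e₃ T (cnt (K * h + K * h) G) ⟩
      4 * (T * T) * cnt (K * h + K * h) G ∎
      where
      open ≤-Reasoning
      e₁ : ∀ k b t → k * k * b * (t * t) ≡ k * t * (k * b * t)
      e₁ = solve-∀
      e₂ : ∀ k t s r → k * t * (s * (2 * r)) ≡ 2 * r * (k * s * t)
      e₂ = solve-∀
      e₃ : ∀ t c → 2 * t * (c * (2 * t)) ≡ 4 * (t * t) * c
      e₃ = solve-∀

-- Heavy letters or a boost

-- Powers of two by addition, so that the length `dbl (suc e)` of a `State` unfolds to the `h + h`
-- on which `step` works.
dbl : ℕ → ℕ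
dbl zero = 1
dbl (suc e) = dbl e + dbl e

dbl>0 : ∀ e → 0 < dbl e
dbl>0 zero = z<s
dbl>0 (suc e) = ≤-trans (dbl>0 e) (m≤m+n _ _)

-- An integral substitute for multiplication by 8/7.
grow : ℕ → ℕ
grow K = K + suc (K / 7)

grow-≥ : ∀ K → 8 * K + 1 ≤ 7 * grow K
grow-≥ K = begin
  8 * K + 1                                    ≡⟨ e₁ K ⟩
  7 * K + K + 1                                ≡⟨ cong (λ z → 7 * K + z + 1) (m≡m%n+[m/n]*n K 7) ⟩
  7 * K + (K % 7 + K / 7 * 7) + 1              ≤⟨ +-monoˡ-≤ 1 (+-monoʳ-≤ (7 * K) (+-monoˡ-≤ (K / 7 * 7)
                                                    (s≤s⁻¹ (m%n<n K 7)))) ⟩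
  7 * K + (6 + K / 7 * 7) + 1                  ≡⟨ e₂ K (K / 7) ⟩
  7 * grow K                                   ∎
  where
  open ≤-Reasoning
  e₁ : ∀ k → 8 * k + 1 ≡ 7 * k + k + 1
  e₁ = solve-∀
  e₂ : ∀ k q → 7 * k + (6 + q * 7) + 1 ≡ 7 * (k + (1 + q))
  e₂ = solve-∀

grow-≤ : ∀ K → 42 ≤ K → 6 * grow K ≤ 7 * K
grow-≤ K h = *-cancelˡ-≤ 7 (begin
  7 * (6 * grow K)                ≡⟨ e₁ K (K / 7) ⟩
  42 * K + 42 + 6 * (K / 7 * 7)   ≤⟨ +-mono-≤ (+-monoʳ-≤ (42 * K) h) (*-monoʳ-≤ 6 (m/n*n≤m K 7)) ⟩
  42 * K + K + 6 * K              ≡⟨ e₂ K ⟩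
  7 * (7 * K)                     ∎)
  where
  open ≤-Reasoning
  e₁ : ∀ k q → 7 * (6 * (k + (1 + q))) ≡ 42 * k + 42 + 6 * (q * 7)
  e₁ = solve-∀
  e₂ : ∀ k → 42 * k + k + 6 * k ≡ 7 * (7 * k)
  e₂ = solve-∀

-- For the length budget: halving turns 3 K³ · 2h into K³ h, spent on one completion, and 5 K³ h,
-- which has to cover 3 (`grow K`)³ h. From K = 42 on, rounding costs no more than replacing 8/7 by
-- 7/6, and (7/6)³ < 5/3.
grow-cube : ∀ K → 42 ≤ K → 3 * (grow K * grow K * grow K) ≤ 5 * (K * K * K)
grow-cube K h = *-cancelˡ-≤ 216 (begin
  216 * (3 * (g * g * g))             ≡⟨ e₁ g ⟩
  3 * ((6 * g) * (6 * g) * (6 * g))   ≤⟨ *-monoʳ-≤ 3 (*-mono-≤ (*-mono-≤ g≤ g≤) g≤) ⟩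
  3 * ((7 * K) * (7 * K) * (7 * K))   ≤⟨ ≤-from (51 * (K * K * K)) (e₂ K) ⟩
  216 * (5 * (K * K * K))             ∎)
  where
  open ≤-Reasoning
  g = grow K
  g≤ = grow-≤ K h
  e₁ : ∀ g → 216 * (3 * (g * g * g)) ≡ 3 * ((6 * g) * (6 * g) * (6 * g))
  e₁ = solve-∀
  e₂ : ∀ k → 3 * ((7 * k) * (7 * k) * (7 * k)) + 51 * (k * k * k) ≡ 216 * (5 * (k * k * k))
  e₂ = solve-∀

fit : ∀ ℓ B → 0 < ℓ → ℓ ≤ B → ∃ λ N → N * ℓ ≤ B × B ≤ 2 * (N * ℓ)
fit ℓ@(suc _) B _ ℓ≤B = B / ℓ , m/n*n≤m B ℓ , (begin
  B                        ≡⟨ m≡m%n+[m/n]*n B ℓ ⟩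
  B % ℓ + B / ℓ * ℓ        ≤⟨ +-monoˡ-≤ (B / ℓ * ℓ) (<⇒≤ (m%n<n B ℓ)) ⟩
  ℓ + B / ℓ * ℓ            ≤⟨ +-monoˡ-≤ (B / ℓ * ℓ) (m≤n*m ℓ (B / ℓ) {{>-nonZero (m≥n⇒m/n>0 ℓ≤B)}}) ⟩
  B / ℓ * ℓ + B / ℓ * ℓ    ≡⟨ cong (B / ℓ * ℓ +_) (+-identityʳ _) ⟨
  2 * (B / ℓ * ℓ)          ∎)
  where open ≤-Reasoning

-- `Y` is a slope: P starts with density Y ℓ / (K n) at length ℓ, and `Dense` asks for density of
-- the order Y Bm / n at length `Λ`, without the K. `Y-small` bounds this target by a constant, so
-- that saturation of probabilities does no harm.
module Dichotomy {X : Set} (xs : List X) (n : ℕ) (∣xs∣≡n : length xs ≡ n) .{{_ : NonZero n}}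
  (P : List X → Bool) (mP : Mono P) (Y Bm : ℕ) (Y>0 : 0 < Y) (Y-small : Y * Bm ≤ 64 * n) where

  open Words xs n ∣xs∣≡n

  Λ : ℕ
  Λ = Bm + Bm

  HeavyLetter : Set
  HeavyLetter = ∃ λ j → 3 * n ^ Λ ≤ 4 * cnt Λ (P ∘ (j ∷_))

  Dense : Set
  Dense = 3 * (Y * Bm) * n ^ Λ ≤ 512 * n * cnt Λ P

  -- Concatenated blocks fill about `Bm` letters and the completion takes at most `Bm` more, hence Λ
  -- = 2 Bm. The constant 512 is 32 · 2 · 2 · 4: the assumed density, the rounding in `fit`, the
  -- saturation in `cnt-amplify`, and the denominator of 3/4.
  finish : ∀ {G} → Mono G → ∀ B ℓ →
    (∀ w → G w ≡ true → 3 * n ^ B ≤ 4 * cnt B (P ∘ (w ++_))) → B ≤ Bm →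
    0 < ℓ → ℓ ≤ Bm → Y * ℓ * n ^ ℓ ≤ 32 * n * cnt ℓ G → Dense
  finish {G} mG B ℓ hc B≤ ℓ>0 ℓ≤ dense with fit ℓ Bm ℓ>0 ℓ≤
  ... | N , Nℓ≤Bm , Bm≤2Nℓ = result
    where
    open ≤-Reasoning
    c = cnt ℓ G
    T₁ = n ^ ℓ
    T₂ = n ^ (N * ℓ)
    Z = cnt (N * ℓ) G
    a = N * c
    instance
      _ : NonZero T₁
      _ = m^n≢0 n ℓ
    many : Y * Bm * T₁ ≤ 64 * n * a
    many = begin
      Y * Bm * T₁                ≤⟨ *-monoˡ-≤ T₁ (*-monoʳ-≤ Y Bm≤2Nℓ) ⟩
      Y * (2 * (N * ℓ)) * T₁     ≡⟨ e₁ Y N ℓ T₁ ⟩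
      2 * N * (Y * ℓ * T₁)       ≤⟨ *-monoʳ-≤ (2 * N) dense ⟩
      2 * N * (32 * n * c)       ≡⟨ e₂ N n c ⟩
      64 * n * a                 ∎
      where
      e₁ : ∀ y m l t → y * (2 * (m * l)) * t ≡ 2 * m * (y * l * t)
      e₁ = solve-∀
      e₂ : ∀ m v d → 2 * m * (32 * v * d) ≡ 64 * v * (m * d)
      e₂ = solve-∀
    Z-large : Y * Bm * T₂ ≤ 128 * n * Z
    -- If at least one hit is expected, the hit probability is at least 1/2, and `Y-small` shows
    -- that this suffices; otherwise amplification is linear up to a factor 2.
    Z-large with ≤-total T₁ a
    ... | inj₁ T₁≤a = begin
      Y * Bm * T₂         ≤⟨ *-monoˡ-≤ T₂ Y-small ⟩
      64 * n * T₂         ≤⟨ *-monoʳ-≤ (64 * n) (*-cancelˡ-≤ a {{>-nonZero (≤-trans (>-nonZero⁻¹ T₁) T₁≤a)}} (begin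
        a * T₂              ≤⟨ cnt-amplify mG N ℓ ⟩
        Z * (T₁ + a)        ≤⟨ *-monoʳ-≤ Z (+-monoˡ-≤ a T₁≤a) ⟩
        Z * (a + a)         ≡⟨ e₂ Z a ⟩
        a * (2 * Z)         ∎)) ⟩
      64 * n * (2 * Z)    ≡⟨ e₁ n Z ⟩
      128 * n * Z         ∎
      where
      e₁ : ∀ v z → 64 * v * (2 * z) ≡ 128 * v * z
      e₁ = solve-∀
      e₂ : ∀ z b → z * (b + b) ≡ b * (2 * z)
      e₂ = solve-∀
    ... | inj₂ a≤T₁ = *-cancelʳ-≤ _ _ T₁ (begin
      Y * Bm * T₂ * T₁         ≡⟨ e₁ (Y * Bm) T₂ T₁ ⟩
      Y * Bm * T₁ * T₂         ≤⟨ *-monoˡ-≤ T₂ many ⟩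
      64 * n * a * T₂          ≡⟨ *-assoc (64 * n) a T₂ ⟩
      64 * n * (a * T₂)        ≤⟨ *-monoʳ-≤ (64 * n) (cnt-amplify mG N ℓ) ⟩
      64 * n * (Z * (T₁ + a))  ≤⟨ *-monoʳ-≤ (64 * n) (*-monoʳ-≤ Z (+-monoʳ-≤ T₁ a≤T₁)) ⟩
      64 * n * (Z * (T₁ + T₁)) ≡⟨ e₂ n Z T₁ ⟩
      128 * n * Z * T₁         ∎)
      where
      e₁ : ∀ y s t → y * s * t ≡ y * t * s
      e₁ = solve-∀
      e₂ : ∀ v z t → 64 * v * (z * (t + t)) ≡ 128 * v * z * t
      e₂ = solve-∀
    m = N * ℓ + B
    p = Λ ∸ m
    m+p : m + p ≡ Λ
    m+p = m+[n∸m]≡n (+-mono-≤ Nℓ≤Bm B≤)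
    result : Dense
    result = begin
      3 * (Y * Bm) * n ^ Λ
        ≡⟨ cong (λ z → 3 * (Y * Bm) * n ^ z) m+p ⟨
      3 * (Y * Bm) * n ^ (m + p)
        ≡⟨ cong (3 * (Y * Bm) *_) (trans (^-distribˡ-+-* n m p) (cong (_* n ^ p) (^-distribˡ-+-* n (N * ℓ) B))) ⟩
      3 * (Y * Bm) * (T₂ * n ^ B * n ^ p)
        ≡⟨ e₁ (Y * Bm) T₂ (n ^ B) (n ^ p) ⟩
      3 * (n ^ B * n ^ p) * (Y * Bm * T₂)
        ≤⟨ *-monoʳ-≤ (3 * (n ^ B * n ^ p)) Z-large ⟩
      3 * (n ^ B * n ^ p) * (128 * n * Z)
        ≡⟨ e₂ (n ^ B) (n ^ p) n Z ⟩
      128 * n * (n ^ p) * (3 * Z * n ^ B)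
        ≤⟨ *-monoʳ-≤ (128 * n * n ^ p) (cnt-compose {G} {P} 3 4 (N * ℓ) B hc) ⟩
      128 * n * (n ^ p) * (4 * cnt m P)
        ≡⟨ e₃ n (n ^ p) (cnt m P) ⟩
      512 * n * (cnt m P * n ^ p)
        ≤⟨ *-monoʳ-≤ (512 * n) (cnt-pad mP m p) ⟩
      512 * n * cnt (m + p) P
        ≡⟨ cong (λ z → 512 * n * cnt z P) m+p ⟩
      512 * n * cnt Λ P ∎
      where
      e₁ : ∀ y s b q → 3 * y * (s * b * q) ≡ 3 * (b * q) * (y * s)
      e₁ = solve-∀
      e₂ : ∀ b q v z → 3 * (b * q) * (128 * v * z) ≡ 128 * v * q * (3 * z * b)
      e₂ = solve-∀
      e₃ : ∀ v q d → 128 * v * q * (4 * d) ≡ 512 * v * (d * q)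
      e₃ = solve-∀

  -- After i halvings of the word length ℓ₀, with K ≈ K₀ (8/7)^i: the words in G have lost at most a factor
  -- K / K₀ of relative density, and B random further letters complete each of them to a word in P with
  -- probability at least 3/4 + 8 / K.  The failure probabilities 1 / K of the single steps sum up to
  -- the decrease of 8 / K, and their lengths K³ ℓ to that of 3 K³ ℓ.
  record State (G : List X → Bool) (ℓ K B : ℕ) : Set where
    field
      mono : Mono G
      K≥42 : 42 ≤ K
      mass : Y * ℓ * n ^ ℓ ≤ K * n * cnt ℓ G
      completion : ∀ w → G w ≡ true → (3 * K + 32) * n ^ B ≤ 4 * K * cnt B (P ∘ (w ++_))
      budget : B + 3 * (K * K * K) * ℓ ≤ Bm

  three-quarters : ∀ {G ℓ K B} → State G ℓ K B →
    ∀ w → G w ≡ true → 3 * n ^ B ≤ 4 * cnt B (P ∘ (w ++_))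
  three-quarters {K = K} {B} st w Gw = *-cancelˡ-≤ K {{>-nonZero (≤-trans z<s (State.K≥42 st))}} (begin
    K * (3 * n ^ B)               ≤⟨ ≤-from (32 * n ^ B) (e₁ K (n ^ B)) ⟩
    (3 * K + 32) * n ^ B          ≤⟨ State.completion st w Gw ⟩
    4 * K * cnt B (P ∘ (w ++_))   ≡⟨ e₂ K (cnt B (P ∘ (w ++_))) ⟩
    K * (4 * cnt B (P ∘ (w ++_))) ∎)
    where
    open ≤-Reasoning
    e₁ : ∀ k t → k * (3 * t) + 32 * t ≡ (3 * k + 32) * t
    e₁ = solve-∀
    e₂ : ∀ k c → 4 * k * c ≡ k * (4 * c)
    e₂ = solve-∀

  mass⇒cnt>0 : ∀ {G K B} → State G 1 K B → 0 < cnt 1 G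
  mass⇒cnt>0 {G} {K} st with cnt 1 G | State.mass st
  ... | suc _ | _ = z<s
  ... | zero | le = contradiction (≤-trans positive le) (≤⇒≯ (≤-reflexive (*-zeroʳ (K * n))))
    where
    positive : 1 ≤ Y * 1 * n ^ 1
    positive = *-mono-≤ (*-mono-≤ Y>0 (≤-refl {1})) (m^n>0 n 1)

  heavy-letter : ∀ {G K B} → State G 1 K B → HeavyLetter
  heavy-letter {G} {K} {B} st
    with j , Gj ← ∑-positive xs (λ j → ind (G (j ∷ []))) (subst (0 <_) (∑-seqs-1 xs (ind ∘ G)) (mass⇒cnt>0 st))
    = j , (begin
      3 * n ^ Λ                              ≡⟨ cong (λ z → 3 * n ^ z) B+p ⟨
      3 * n ^ (B + p)                        ≡⟨ cong (3 *_) (^-distribˡ-+-* n B p) ⟩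
      3 * (n ^ B * n ^ p)                    ≡⟨ *-assoc 3 (n ^ B) (n ^ p) ⟨
      3 * n ^ B * n ^ p                      ≤⟨ *-monoˡ-≤ (n ^ p) (three-quarters st (j ∷ []) (ind-true Gj)) ⟩
      4 * cnt B (P ∘ (j ∷_)) * n ^ p         ≡⟨ *-assoc 4 (cnt B (P ∘ (j ∷_))) (n ^ p) ⟩
      4 * (cnt B (P ∘ (j ∷_)) * n ^ p)       ≤⟨ *-monoʳ-≤ 4 (cnt-pad (Mono-++ (j ∷ []) mP) B p) ⟩
      4 * cnt (B + p) (P ∘ (j ∷_))           ≡⟨ cong (λ z → 4 * cnt z (P ∘ (j ∷_))) B+p ⟩
      4 * cnt Λ (P ∘ (j ∷_))                 ∎)
    where
    open ≤-Reasoning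
    open State st
    p = Λ ∸ B
    B+p : B + p ≡ Λ
    B+p = m+[n∸m]≡n (≤-trans (m+n≤o⇒m≤o B budget) (m≤m+n Bm Bm))

  step : ∀ {G h K B} → 0 < h → State G (h + h) K B →
    Dense ⊎ ∃ λ G′ → State G′ h (grow K) (K * K * K * h + B)
  step {G} {h} {K} {B} h>0 st = result
    where
    open ≤-Reasoning
    open State st
    instance
      K≢0 : NonZero K
      K≢0 = >-nonZero (≤-trans z<s K≥42)
    open Halving G mono h K
    γ = cnt (h + h) G
    g′ = cnt h Heavy
    T≡ : T ≡ n ^ h
    T≡ = length-words h
    instance
      T≢0 : NonZero T
      T≢0 = subst NonZero (sym T≡) (m^n≢0 n h)
    T² : n ^ (h + h) ≡ T * T
    T² = trans (^-distribˡ-+-* n h h) (cong₂ _*_ (sym T≡) (sym T≡))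

    -- The gain K² / 4 of `boost`, the 1/8 lost on the way to `β` and the 1 / K in `mass` leave K /
    -- 32. Since the length has grown by K, the density per length is that of `mass` with 32 in
    -- place of K.
    boosted : γ ≤ 8 * β → Dense
    boosted γ≤8β = finish mono B (K * h + K * h) (three-quarters st) (m+n≤o⇒m≤o B budget)
      (≤-trans (*-mono-≤ (>-nonZero⁻¹ K) h>0) (m≤m+n _ _))
      (≤-trans (≤-reflexive (sym (*-distribˡ-+ K h h)))
        (≤-trans (*-monoˡ-≤ (h + h) (≤-trans (m≤m*n K (K * K) {{m*n≢0 K K}}) (≤-trans (≤-reflexive (sym (*-assoc K K K))) (m≤n*m _ 3))))
          (m+n≤o⇒n≤o B budget)))
      (*-cancelˡ-≤ (K * (T * T)) (begin
        K * (T * T) * (Y * (K * h + K * h) * n ^ (K * h + K * h))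
          ≡⟨ cong (λ z → K * (T * T) * (Y * (K * h + K * h) * z)) T^ ⟩
        K * (T * T) * (Y * (K * h + K * h) * (T ^ K * T ^ K))
          ≡⟨ e₁ K (T * T) Y h (T ^ K * T ^ K) ⟩
        K * K * (T ^ K * T ^ K) * (Y * (h + h) * (T * T))
          ≤⟨ *-monoʳ-≤ (K * K * (T ^ K * T ^ K)) (subst (λ z → Y * (h + h) * z ≤ K * n * γ) T² mass) ⟩
        K * K * (T ^ K * T ^ K) * (K * n * γ)
          ≤⟨ *-monoʳ-≤ (K * K * (T ^ K * T ^ K)) (*-monoʳ-≤ (K * n) γ≤8β) ⟩
        K * K * (T ^ K * T ^ K) * (K * n * (8 * β))
          ≡⟨ e₂ K (T ^ K * T ^ K) n β ⟩
        8 * (K * n) * (K * K * β * (T ^ K * T ^ K))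
          ≤⟨ *-monoʳ-≤ (8 * (K * n)) boost ⟩
        8 * (K * n) * (4 * (T * T) * cnt (K * h + K * h) G)
          ≡⟨ e₃ K n (T * T) (cnt (K * h + K * h) G) ⟩
        K * (T * T) * (32 * n * cnt (K * h + K * h) G) ∎))
      where
      instance
        _ : NonZero (K * (T * T))
        _ = m*n≢0 K (T * T) {{K≢0}} {{m*n≢0 T T}}
      T^ : n ^ (K * h + K * h) ≡ T ^ K * T ^ K
      T^ = trans (^-distribˡ-+-* n (K * h) (K * h)) (cong₂ _*_ half half)
        where
        half : n ^ (K * h) ≡ T ^ K
        half = trans (cong (n ^_) (*-comm K h)) (trans (sym (^-*-assoc n h K)) (cong (_^ K) (sym T≡)))
      e₁ : ∀ k t y h s → k * t * (y * (k * h + k * h) * s) ≡ k * k * s * (y * (h + h) * t)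
      e₁ = solve-∀
      e₂ : ∀ k s v b → k * k * s * (k * v * (8 * b)) ≡ 8 * (k * v) * (k * k * b * s)
      e₂ = solve-∀
      e₃ : ∀ k v t c → 8 * (k * v) * (4 * t * c) ≡ k * t * (32 * v * c)
      e₃ = solve-∀

    -- Keeping 7/16 of the density at half the length costs a factor 7/8 of density per length,
    -- which `grow` pays for.
    continued : 7 * γ ≤ 16 * (g′ * T) → State Heavy h (grow K) (K * K * K * h + B)
    continued le = record
      { mono = Heavy-mono
      ; K≥42 = ≤-trans K≥42 (m≤m+n K _)
      ; mass = mass′
      ; completion = completion′
      ; budget = begin
          K * K * K * h + B + 3 * (grow K * grow K * grow K) * h
            ≤⟨ +-monoʳ-≤ (K * K * K * h + B) (*-monoˡ-≤ h (grow-cube K K≥42)) ⟩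
          K * K * K * h + B + 5 * (K * K * K) * h
            ≡⟨ e₀ (K * K * K) h B ⟩
          B + 3 * (K * K * K) * (h + h)
            ≤⟨ budget ⟩
          Bm ∎
      }
      where
      e₀ : ∀ c h b → c * h + b + 5 * c * h ≡ b + 3 * c * (h + h)
      e₀ = solve-∀
      mass′ : Y * h * n ^ h ≤ grow K * n * g′
      mass′ = *-cancelˡ-≤ (14 * T) {{m*n≢0 14 T}} (begin
        14 * T * (Y * h * n ^ h)         ≡⟨ cong (λ z → 14 * T * (Y * h * z)) (sym T≡) ⟩
        14 * T * (Y * h * T)             ≡⟨ e₁ T Y h ⟩
        7 * (Y * (h + h) * (T * T))      ≤⟨ *-monoʳ-≤ 7 (subst (λ z → Y * (h + h) * z ≤ K * n * γ) T² mass) ⟩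
        7 * (K * n * γ)                  ≡⟨ e₂ K n γ ⟩
        K * n * (7 * γ)                  ≤⟨ *-monoʳ-≤ (K * n) le ⟩
        K * n * (16 * (g′ * T))          ≡⟨ e₃ K n g′ T ⟩
        2 * n * (g′ * T) * (8 * K)       ≤⟨ *-monoʳ-≤ (2 * n * (g′ * T)) (m+n≤o⇒m≤o (8 * K) (grow-≥ K)) ⟩
        2 * n * (g′ * T) * (7 * grow K)  ≡⟨ e₄ n g′ T (grow K) ⟩
        14 * T * (grow K * n * g′)       ∎)
        where
        e₁ : ∀ t y h → 14 * t * (y * h * t) ≡ 7 * (y * (h + h) * (t * t))
        e₁ = solve-∀
        e₂ : ∀ k v c → 7 * (k * v * c) ≡ k * v * (7 * c)
        e₂ = solve-∀
        e₃ : ∀ k v g t → k * v * (16 * (g * t)) ≡ 2 * v * (g * t) * (8 * k)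
        e₃ = solve-∀
        e₄ : ∀ v g t r → 2 * v * (g * t) * (7 * r) ≡ 14 * t * (r * v * g)
        e₄ = solve-∀
      -- Among K³ blocks of length h at least K are expected to complete a heavy word to G, so all
      -- fail with probability at most 1 / (K + 1); one success is then followed by the old
      -- completion.
      completion′ : ∀ w → Heavy w ≡ true →
        (3 * grow K + 32) * n ^ (K * K * K * h + B) ≤ 4 * grow K * cnt (K * K * K * h + B) (P ∘ (w ++_))
      completion′ w Hw = *-cancelˡ-≤ (suc K) (begin
        suc K * ((3 * grow K + 32) * n ^ (N * h + B))
          ≡⟨ cong (λ z → suc K * ((3 * grow K + 32) * z)) (^-distribˡ-+-* n (N * h) B) ⟩
        suc K * ((3 * grow K + 32) * (n ^ (N * h) * n ^ B))
          ≡⟨ f₁ K (grow K) (n ^ (N * h)) (n ^ B) ⟩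
        (suc K * (3 * grow K + 32)) * (n ^ (N * h) * n ^ B)
          ≤⟨ *-monoˡ-≤ (n ^ (N * h) * n ^ B) constants ⟩
        grow K * (3 * K + 32) * (n ^ (N * h) * n ^ B)
          ≤⟨ *-cancelˡ-≤ K (begin
            K * (grow K * (3 * K + 32) * (n ^ (N * h) * n ^ B))
              ≡⟨ f₂ K (grow K) (3 * K + 32) (n ^ (N * h)) (n ^ B) ⟩
            grow K * (3 * K + 32) * n ^ B * (K * n ^ (N * h))
              ≤⟨ *-monoʳ-≤ (grow K * (3 * K + 32) * n ^ B) hits ⟩
            grow K * (3 * K + 32) * n ^ B * (suc K * Z)
              ≡⟨ f₃ (grow K) (3 * K + 32) (n ^ B) K Z ⟩
            grow K * suc K * ((3 * K + 32) * Z * n ^ B)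
              ≤⟨ *-monoʳ-≤ (grow K * suc K) composed ⟩
            grow K * suc K * (4 * K * cnt (N * h + B) (P ∘ (w ++_)))
              ≡⟨ f₄ (grow K) K (cnt (N * h + B) (P ∘ (w ++_))) ⟩
            K * (suc K * (4 * grow K * cnt (N * h + B) (P ∘ (w ++_)))) ∎) ⟩
        suc K * (4 * grow K * cnt (N * h + B) (P ∘ (w ++_))) ∎)
        where
        N = K * K * K
        Gw = G ∘ (w ++_)
        Z = cnt (N * h) Gw
        a = cnt h Gw
        f₁ : ∀ k r s t → (1 + k) * ((3 * r + 32) * (s * t)) ≡ ((1 + k) * (3 * r + 32)) * (s * t)
        f₁ = solve-∀
        f₂ : ∀ k r c s t → k * (r * c * (s * t)) ≡ r * c * t * (k * s)
        f₂ = solve-∀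
        f₃ : ∀ r c t k z → r * c * t * ((1 + k) * z) ≡ r * (1 + k) * (c * z * t)
        f₃ = solve-∀
        f₄ : ∀ r k c → r * (1 + k) * (4 * k * c) ≡ k * ((1 + k) * (4 * r * c))
        f₄ = solve-∀
        -- That is, (3/4 + 8 / K) · K / (K + 1) ≥ 3/4 + 8 / `grow K`. The 8 is the sum of the
        -- geometric series with ratio 7/8.
        constants : suc K * (3 * grow K + 32) ≤ grow K * (3 * K + 32)
        constants = begin
          suc K * (3 * r + 32)               ≡⟨ g₁ K r ⟩
          3 * K * r + 3 * r + 4 * (8 * K + 1) + 28 ≤⟨ +-mono-≤ (+-monoʳ-≤ (3 * K * r + 3 * r)
                (*-monoʳ-≤ 4 (grow-≥ K))) (≤-trans (m≤n+m 28 14) (≤-trans K≥42 (m≤m+n K _))) ⟩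
          3 * K * r + 3 * r + 4 * (7 * r) + r ≡⟨ g₂ K r ⟩
          r * (3 * K + 32)                   ∎
          where
          r = grow K
          g₁ : ∀ k r → (1 + k) * (3 * r + 32) ≡ 3 * k * r + 3 * r + 4 * (8 * k + 1) + 28
          g₁ = solve-∀
          g₂ : ∀ k r → 3 * k * r + 3 * r + 4 * (7 * r) + r ≡ r * (3 * k + 32)
          g₂ = solve-∀
        Na-large : K * T ≤ N * a
        Na-large = begin
          K * T               ≤⟨ *-monoʳ-≤ K (≤ᵇ-true⁻ {T} Hw) ⟩
          K * (K * K * a)     ≡⟨ g K a ⟩
          N * a               ∎
          where
          g : ∀ k a → k * (k * k * a) ≡ k * k * k * a
          g = solve-∀
        hits : K * n ^ (N * h) ≤ suc K * Z
        hits = *-cancelˡ-≤ (T + N * a) {{>-nonZero (≤-trans (>-nonZero⁻¹ T) (m≤m+n T _))}} (begin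
          (T + N * a) * (K * M)                ≡⟨ g₁ T (N * a) K M ⟩
          (K * T + K * (N * a)) * M            ≤⟨ *-monoˡ-≤ M (+-monoˡ-≤ (K * (N * a)) Na-large) ⟩
          (N * a + K * (N * a)) * M            ≡⟨ *-assoc (suc K) (N * a) M ⟩
          suc K * (N * a * M)                  ≤⟨ *-monoʳ-≤ (suc K) (cnt-amplify (Mono-++ w mono) N h) ⟩
          suc K * (Z * (n ^ h + N * a))        ≡⟨ cong (λ t → suc K * (Z * (t + N * a))) (sym T≡) ⟩
          suc K * (Z * (T + N * a))            ≡⟨ g₂ K Z (T + N * a) ⟩
          (T + N * a) * (suc K * Z)            ∎)
          where
          M = n ^ (N * h)
          g₁ : ∀ t a k m → (t + a) * (k * m) ≡ (k * t + k * a) * m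
          g₁ = solve-∀
          g₂ : ∀ k z s → (1 + k) * (z * s) ≡ s * ((1 + k) * z)
          g₂ = solve-∀
        composed : (3 * K + 32) * Z * n ^ B ≤ 4 * K * cnt (N * h + B) (P ∘ (w ++_))
        composed = cnt-compose {Gw} {P ∘ (w ++_)} (3 * K + 32) (4 * K) (N * h) B pointwise
          where
          pointwise : ∀ v → Gw v ≡ true → (3 * K + 32) * n ^ B ≤ 4 * K * cnt B (λ x → P (w ++ (v ++ x)))
          pointwise v Gv = ≤-trans (completion (w ++ v) Gv) (≤-reflexive (cong (4 * K *_)
            (∑-cong (seqs xs B) λ x → cong (ind ∘ P) (++-assoc w v x))))

    result : Dense ⊎ ∃ λ G′ → State G′ h (grow K) (K * K * K * h + B)
    result with ≤-total (7 * γ) (16 * (g′ * T))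
    ... | inj₁ le = inj₂ (Heavy , continued le)
    ... | inj₂ le = inj₁ (boosted (+-cancelˡ-≤ (7 * γ) _ _ (begin
      7 * γ + γ                    ≡⟨ e₁ γ ⟩
      8 * γ                        ≤⟨ *-monoʳ-≤ 8 split ⟩
      8 * (β + 2 * (g′ * T))       ≡⟨ e₂ β (g′ * T) ⟩
      16 * (g′ * T) + 8 * β        ≤⟨ +-monoˡ-≤ (8 * β) le ⟩
      7 * γ + 8 * β                ∎)))
      where
      e₁ : ∀ c → 7 * c + c ≡ 8 * c
      e₁ = solve-∀
      e₂ : ∀ b g → 8 * (b + 2 * g) ≡ 16 * g + 8 * b
      e₂ = solve-∀

  iterate : ∀ e {G K B} → State G (dbl e) K B → HeavyLetter ⊎ Dense
  iterate zero st = inj₁ (heavy-letter st)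
  iterate (suc e) st with step (dbl>0 e) st
  ... | inj₁ dense = inj₂ dense
  ... | inj₂ (_ , st′) = iterate e st′

  dichotomy : ∀ e K → 42 ≤ K → 3 * (K * K * K) * dbl e ≤ Bm →
    Y * dbl e * n ^ dbl e ≤ K * n * cnt (dbl e) P → HeavyLetter ⊎ Dense
  dichotomy e K K≥42 hB hm = iterate e {P} {K} {0} record
    { mono = mP
    ; K≥42 = K≥42
    ; mass = hm
    ; completion = complete
    ; budget = hB
    }
    where
    complete : ∀ w → P w ≡ true → (3 * K + 32) * 1 ≤ 4 * K * cnt 0 (P ∘ (w ++_))
    complete w Pw rewrite ++-identityʳ w | Pw = begin
      (3 * K + 32) * 1  ≤⟨ *-monoˡ-≤ 1 (+-monoʳ-≤ (3 * K) (≤-trans (m≤n+m 32 10) K≥42)) ⟩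
      (3 * K + K) * 1   ≡⟨ lem K ⟩
      4 * K * (1 + 0)   ∎
      where
      open ≤-Reasoning
      lem : ∀ k → (3 * k + k) * 1 ≡ 4 * k * (1 + 0)
      lem = solve-∀

-- From words to uniform families and back

≡ᵇ-refl : ∀ m → (m ≡ᵇ m) ≡ true
≡ᵇ-refl zero = refl
≡ᵇ-refl (suc m) = ≡ᵇ-refl m

≡ᵇ-true⁻ : ∀ m k → (m ≡ᵇ k) ≡ true → m ≡ k
≡ᵇ-true⁻ m k h = ≡ᵇ⇒≡ m k (Equivalence.from T-≡ h)

ind-≡ᵇ-* : ∀ m k → ind (m ≡ᵇ k) * m ≡ k * ind (m ≡ᵇ k)
ind-≡ᵇ-* m k with m ≡ᵇ k in eq
... | true = trans (+-identityʳ m) (trans (≡ᵇ-true⁻ m k eq) (sym (*-identityʳ k)))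
... | false = sym (*-zeroʳ k)

∑-allFin-suc : ∀ n f → ∑ (allFin (suc n)) f ≡ f zero + ∑ (allFin n) (f ∘ suc)
∑-allFin-suc n f = cong (f zero +_) (trans (cong (λ xs → ∑ xs f) (sym (map-tabulate id suc))) (∑-map suc (allFin n) f))

length-allFin : ∀ n → length (allFin n) ≡ n
length-allFin n = length-tabulate id

∑-allFin-const : ∀ n c → ∑[ _ ← allFin n ] c ≡ n * c
∑-allFin-const n c = trans (∑-const (allFin n) c) (cong (_* c) (length-allFin n))

∑-subsets-suc : ∀ n f →
  ∑ (allSubsets (suc n)) f ≡ ∑ (allSubsets n) (f ∘ (false ∷_)) + ∑ (allSubsets n) (f ∘ (true ∷_))
∑-subsets-suc n f = trans (∑-++ (map (false ∷_) (allSubsets n)) _ f)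
  (cong₂ _+_ (∑-map (false ∷_) (allSubsets n) f) (∑-map (true ∷_) (allSubsets n) f))

card≡∑ : ∀ {n} (F : Family n) → card F ≡ ∑ (allSubsets n) (ind ∘ F)
card≡∑ {n} F = ∑-filterᵇ F (allSubsets n)

add : ∀ {n} → Fin n → Subset n → Subset n
add x A = A [ x ]≔ true

add-∈ : ∀ {n} (x : Fin n) A → lookup A x ≡ true → add x A ≡ A
add-∈ zero (true ∷ A) _ = refl
add-∈ (suc x) (b ∷ A) h = cong (b ∷_) (add-∈ x A h)

∣add∣ : ∀ {n} (x : Fin n) A → lookup A x ≡ false → ∣ add x A ∣ ≡ suc ∣ A ∣
∣add∣ zero (false ∷ A) _ = refl
∣add∣ (suc x) (true ∷ A) h = cong suc (∣add∣ x A h)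
∣add∣ (suc x) (false ∷ A) h = ∣add∣ x A h

∣∣≡∑ : ∀ {n} (A : Subset n) → ∣ A ∣ ≡ ∑[ x ← allFin n ] ind (lookup A x)
∣∣≡∑ [] = refl
∣∣≡∑ {suc n} (true ∷ A) = trans (cong suc (∣∣≡∑ A)) (sym (∑-allFin-suc n (ind ∘ lookup (true ∷ A))))
∣∣≡∑ {suc n} (false ∷ A) = trans (∣∣≡∑ A) (sym (∑-allFin-suc n (ind ∘ lookup (false ∷ A))))

-- `add x` is a bijection from the sets without x to the sets with x.
∑-add : ∀ {n} (x : Fin n) (h : Subset n → ℕ) →
  ∑[ A ← allSubsets n ] (ind (not (lookup A x)) * h (add x A)) ≡ ∑[ A ← allSubsets n ] (ind (lookup A x) * h A)
∑-add {suc n} zero h = begin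
  ∑[ A ← allSubsets (suc n) ] (ind (not (lookup A zero)) * h (add zero A))
    ≡⟨ ∑-subsets-suc n _ ⟩
  (∑[ A ← allSubsets n ] (1 * h (true ∷ A))) + (∑[ A ← allSubsets n ] 0)
    ≡⟨ +-comm _ (∑[ A ← allSubsets n ] 0) ⟩
  (∑[ A ← allSubsets n ] 0) + (∑[ A ← allSubsets n ] (1 * h (true ∷ A)))
    ≡⟨ ∑-subsets-suc n _ ⟨
  ∑[ A ← allSubsets (suc n) ] (ind (lookup A zero) * h A) ∎
  where open ≡-Reasoning
∑-add {suc n} (suc x) h = trans (∑-subsets-suc n _)
  (trans (cong₂ _+_ (∑-add x (h ∘ (false ∷_))) (∑-add x (h ∘ (true ∷_)))) (sym (∑-subsets-suc n _)))

module _ {n : ℕ} where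

  U : ℕ → (Subset n → ℕ) → ℕ
  U j g = ∑[ A ← allSubsets n ] (ind (∣ A ∣ ≡ᵇ j) * g A)

  L : (Subset n → ℕ) → Subset n → ℕ
  L g A = ∑[ x ← allFin n ] g (add x A)

  Increasing : (Subset n → ℕ) → Set
  Increasing g = ∀ x A → g A ≤ g (add x A)

  U-cong : ∀ j {f g} → (∀ A → f A ≡ g A) → U j f ≡ U j g
  U-cong j h = ∑-cong (allSubsets n) λ A → cong (ind (∣ A ∣ ≡ᵇ j) *_) (h A)

  U-mono : ∀ j {f g} → (∀ A → f A ≤ g A) → U j f ≤ U j g
  U-mono j h = ∑-mono (allSubsets n) λ A → *-monoʳ-≤ (ind (∣ A ∣ ≡ᵇ j)) (h A)

  U-*ˡ : ∀ j c g → U j (λ A → c * g A) ≡ c * U j g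
  U-*ˡ j c g = trans (∑-cong (allSubsets n) λ A → lem (ind (∣ A ∣ ≡ᵇ j)) c (g A)) (∑-*ˡ (allSubsets n) c _)
    where
    lem : ∀ i c x → i * (c * x) ≡ c * (i * x)
    lem = solve-∀

  -- Adding a letter to a j-set A either leaves it fixed, for j letters, or gives a set of size j +
  -- 1, and each such set arises once from each of its j + 1 elements.
  U-L : ∀ j g → U j (L g) ≡ j * U j g + suc j * U (suc j) g
  U-L j g = begin
    U j (L g)
      ≡⟨ ∑-cong 𝒫 (λ A → trans (cong (i A *_) (trans (∑-cong X (λ x → split x A)) (∑-+ X _ _)))
           (*-distribˡ-+ (i A) _ _)) ⟩
    ∑[ A ← 𝒫 ] (i A * (∑[ x ← X ] (ind (lookup A x) * g A))
              + i A * (∑[ x ← X ] (ind (not (lookup A x)) * g (add x A))))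
      ≡⟨ ∑-+ 𝒫 _ _ ⟩
    (∑[ A ← 𝒫 ] (i A * (∑[ x ← X ] (ind (lookup A x) * g A))))
      + (∑[ A ← 𝒫 ] (i A * (∑[ x ← X ] (ind (not (lookup A x)) * g (add x A)))))
      ≡⟨ cong₂ _+_ stay move ⟩
    j * U j g + suc j * U (suc j) g ∎
    where
    open ≡-Reasoning
    𝒫 = allSubsets n
    X = allFin n
    i : Subset n → ℕ
    i A = ind (∣ A ∣ ≡ᵇ j)
    i′ : Subset n → ℕ
    i′ A = ind (∣ A ∣ ≡ᵇ suc j)
    split : ∀ x A → g (add x A) ≡ ind (lookup A x) * g A + ind (not (lookup A x)) * g (add x A)
    split x A with lookup A x in eq
    ... | true = trans (cong g (add-∈ x A eq)) (sym (trans (+-identityʳ _) (+-identityʳ _)))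
    ... | false = sym (+-identityʳ _)
    weight : ∀ k A → ind (∣ A ∣ ≡ᵇ k) * (∣ A ∣ * g A) ≡ k * (ind (∣ A ∣ ≡ᵇ k) * g A)
    weight k A = begin
      ind (∣ A ∣ ≡ᵇ k) * (∣ A ∣ * g A)  ≡⟨ *-assoc (ind (∣ A ∣ ≡ᵇ k)) ∣ A ∣ (g A) ⟨
      ind (∣ A ∣ ≡ᵇ k) * ∣ A ∣ * g A    ≡⟨ cong (_* g A) (ind-≡ᵇ-* ∣ A ∣ k) ⟩
      k * ind (∣ A ∣ ≡ᵇ k) * g A        ≡⟨ *-assoc k _ _ ⟩
      k * (ind (∣ A ∣ ≡ᵇ k) * g A)      ∎
    stay : ∑[ A ← 𝒫 ] (i A * (∑[ x ← X ] (ind (lookup A x) * g A))) ≡ j * U j g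
    stay = trans (∑-cong 𝒫 λ A → trans (cong (i A *_) (trans (∑-*ʳ X (g A) _) (cong (_* g A) (sym (∣∣≡∑ A)))))
      (weight j A)) (∑-*ˡ 𝒫 j _)
    shift : ∀ A x → i A * (ind (not (lookup A x)) * g (add x A))
                    ≡ ind (not (lookup A x)) * (i′ (add x A) * g (add x A))
    shift A x with lookup A x in eq
    ... | true = *-zeroʳ (i A)
    ... | false rewrite ∣add∣ x A eq = trans (cong (i A *_) (+-identityʳ _)) (sym (+-identityʳ _))
    move : ∑[ A ← 𝒫 ] (i A * (∑[ x ← X ] (ind (not (lookup A x)) * g (add x A)))) ≡ suc j * U (suc j) g
    move = begin
      ∑[ A ← 𝒫 ] (i A * (∑[ x ← X ] (ind (not (lookup A x)) * g (add x A))))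
        ≡⟨ ∑-cong 𝒫 (λ A → trans (sym (∑-*ˡ X (i A) _)) (∑-cong X (shift A))) ⟩
      ∑[ A ← 𝒫 ] ∑[ x ← X ] (ind (not (lookup A x)) * (i′ (add x A) * g (add x A)))
        ≡⟨ ∑-swap 𝒫 X _ ⟩
      ∑[ x ← X ] ∑[ A ← 𝒫 ] (ind (not (lookup A x)) * (i′ (add x A) * g (add x A)))
        ≡⟨ ∑-cong X (λ x → ∑-add x (λ A → i′ A * g A)) ⟩
      ∑[ x ← X ] ∑[ A ← 𝒫 ] (ind (lookup A x) * (i′ A * g A))
        ≡⟨ ∑-swap X 𝒫 _ ⟩
      ∑[ A ← 𝒫 ] ∑[ x ← X ] (ind (lookup A x) * (i′ A * g A))
        ≡⟨ ∑-cong 𝒫 (λ A → trans (∑-*ʳ X (i′ A * g A) _) (trans (cong (_* (i′ A * g A)) (sym (∣∣≡∑ A)))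
             (trans (lem ∣ A ∣ (i′ A) (g A)) (weight (suc j) A)))) ⟩
      ∑[ A ← 𝒫 ] (suc j * (i′ A * g A))
        ≡⟨ ∑-*ˡ 𝒫 (suc j) _ ⟩
      suc j * U (suc j) g ∎
      where
      lem : ∀ a b c → a * (b * c) ≡ b * (a * c)
      lem = solve-∀

  L-const : ∀ c A → L (λ _ → c) A ≡ n * c
  L-const c A = ∑-allFin-const n c

  n*≤L : ∀ {g} → Increasing g → ∀ A → n * g A ≤ L g A
  n*≤L {g} inc A = ≤-trans (≤-reflexive (sym (∑-allFin-const n (g A)))) (∑-mono (allFin n) λ x → inc x A)

  -- The local LYM inequality: `L g` is at least n g, and the letters already present account for
  -- the term `j * U j g` of `U-L`.
  U-step : ∀ {g} → Increasing g → ∀ j → (n ∸ j) * U j g ≤ suc j * U (suc j) g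
  U-step {g} inc j with ≤-total j n
  ... | inj₂ n≤j rewrite m≤n⇒m∸n≡0 n≤j = z≤n
  ... | inj₁ j≤n = +-cancelˡ-≤ (j * U j g) _ _ (begin
    j * U j g + (n ∸ j) * U j g     ≡⟨ *-distribʳ-+ (U j g) j (n ∸ j) ⟨
    (j + (n ∸ j)) * U j g           ≡⟨ cong (_* U j g) (m+[n∸m]≡n j≤n) ⟩
    n * U j g                       ≡⟨ U-*ˡ j n g ⟨
    U j (λ A → n * g A)             ≤⟨ U-mono j (n*≤L inc) ⟩
    U j (L g)                       ≡⟨ U-L j g ⟩
    j * U j g + suc j * U (suc j) g ∎)
    where open ≤-Reasoning

U-1 : ∀ n j → U {n} j (λ _ → 1) ≡ n C j
U-1 zero zero = refl
U-1 zero (suc j) = sym (k>n⇒nCk≡0 {0} {suc j} z<s)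
U-1 (suc n) zero = begin
  U {suc n} 0 (λ _ → 1)                 ≡⟨ ∑-subsets-suc n _ ⟩
  U {n} 0 (λ _ → 1) + (∑[ _ ← allSubsets n ] 0)  ≡⟨ cong₂ _+_ (U-1 n 0) (trans (∑-const (allSubsets n) 0) (*-zeroʳ (length (allSubsets n)))) ⟩
  n C 0 + 0                             ≡⟨ +-identityʳ _ ⟩
  n C 0                                 ≡⟨⟩
  suc n C 0                             ∎
  where open ≡-Reasoning
U-1 (suc n) (suc j) = begin
  U {suc n} (suc j) (λ _ → 1)           ≡⟨ ∑-subsets-suc n _ ⟩
  U {n} (suc j) (λ _ → 1) + U {n} j (λ _ → 1) ≡⟨ cong₂ _+_ (U-1 n (suc j)) (U-1 n j) ⟩
  n C suc j + n C j                     ≡⟨ +-comm (n C suc j) _ ⟩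
  n C j + n C suc j                     ≡⟨ nCk+nC[k+1]≡[n+1]C[k+1] n j ⟩
  suc n C suc j                         ∎
  where open ≡-Reasoning

-- This is `U-L` for the constant function 1.
absorb : ∀ n j → (n ∸ j) * (n C j) ≡ suc j * (n C suc j)
absorb n j with ≤-total j n
... | inj₂ n≤j rewrite m≤n⇒m∸n≡0 n≤j = sym (trans (cong (suc j *_) (k>n⇒nCk≡0 (s≤s n≤j))) (*-zeroʳ (suc j)))
... | inj₁ j≤n = +-cancelˡ-≡ (j * (n C j)) _ _ (begin
  j * (n C j) + (n ∸ j) * (n C j)             ≡⟨ *-distribʳ-+ (n C j) j (n ∸ j) ⟨
  (j + (n ∸ j)) * (n C j)                     ≡⟨ cong₂ _*_ (m+[n∸m]≡n j≤n) (sym (U-1 n j)) ⟩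
  n * U {n} j (λ _ → 1)                       ≡⟨ U-*ˡ {n} j n (λ _ → 1) ⟨
  U {n} j (λ _ → n * 1)                       ≡⟨ U-cong {n} j (λ A → sym (L-const {n} 1 A)) ⟩
  U {n} j (L (λ _ → 1))                       ≡⟨ U-L {n} j (λ _ → 1) ⟩
  j * U {n} j (λ _ → 1) + suc j * U {n} (suc j) (λ _ → 1) ≡⟨ cong₂ (λ a b → j * a + suc j * b) (U-1 n j) (U-1 n (suc j)) ⟩
  j * (n C j) + suc j * (n C suc j)           ∎)
  where open ≡-Reasoning

∈-add⁺ : ∀ {n} {z : Fin n} {A} x → z ∈ A → z ∈ add x A
∈-add⁺ zero here = here
∈-add⁺ zero (there p) = there p
∈-add⁺ (suc x) here = here
∈-add⁺ (suc x) (there p) = there (∈-add⁺ x p)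

∈-add-self : ∀ {n} (x : Fin n) A → x ∈ add x A
∈-add-self zero (_ ∷ A) = here
∈-add-self (suc x) (_ ∷ A) = there (∈-add-self x A)

∈-add⁻ : ∀ {n} {z : Fin n} {A} x → z ∈ add x A → z ≡ x ⊎ z ∈ A
∈-add⁻ {A = _ ∷ _} zero here = inj₁ refl
∈-add⁻ {A = _ ∷ _} zero (there p) = inj₂ (there p)
∈-add⁻ {A = _ ∷ _} (suc x) here = inj₂ here
∈-add⁻ {A = _ ∷ _} (suc x) (there p) with ∈-add⁻ x p
... | inj₁ refl = inj₁ refl
... | inj₂ q = inj₂ (there q)

add-⊆ : ∀ {n} (x : Fin n) {A B} → A ⊆ B → add x A ⊆ add x B
add-⊆ x A⊆B p with ∈-add⁻ x p
... | inj₁ refl = ∈-add-self x _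
... | inj₂ q = ∈-add⁺ x (A⊆B q)

addAll : ∀ {n} → List (Fin n) → Subset n → Subset n
addAll [] A = A
addAll (x ∷ w) A = addAll w (add x A)

addAll-⊆ : ∀ {n} (w : List (Fin n)) {A B} → A ⊆ B → addAll w A ⊆ addAll w B
addAll-⊆ [] A⊆B = A⊆B
addAll-⊆ (x ∷ w) A⊆B = addAll-⊆ w (add-⊆ x A⊆B)

U-0 : ∀ {n} (g : Subset n → ℕ) → U 0 g ≡ g ⊥
U-0 {zero} g = trans (+-identityʳ _) (+-identityʳ _)
U-0 {suc n} g = begin
  U 0 g                                   ≡⟨ ∑-subsets-suc n _ ⟩
  U 0 (g ∘ (false ∷_)) + (∑[ _ ← allSubsets n ] 0)
    ≡⟨ cong₂ _+_ (U-0 (g ∘ (false ∷_))) (trans (∑-const (allSubsets n) 0) (*-zeroʳ (length (allSubsets n)))) ⟩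
  g ⊥ + 0                                 ≡⟨ +-identityʳ _ ⟩
  g ⊥                                     ∎
  where open ≡-Reasoning

module Levels {n : ℕ} (g : Subset n → ℕ) (g-mono : ∀ {A B} → A ⊆ B → g A ≤ g B) where

  E : ℕ → Subset n → ℕ
  E i A = ∑[ w ← seqs (allFin n) i ] g (addAll w A)

  E-suc : ∀ i A → E (suc i) A ≡ L (E i) A
  E-suc i A = ∑-seqs-suc (allFin n) i _

  E-inc : ∀ i → Increasing (E i)
  E-inc i x A = ∑-mono (seqs (allFin n) i) λ w → g-mono (addAll-⊆ w (∈-add⁺ x))

  g-inc : Increasing g
  g-inc x A = g-mono (∈-add⁺ x)

  U-E-0 : ∀ j → U j (E 0) ≡ U j g
  U-E-0 j = U-cong j λ A → +-identityʳ (g A)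

  U-E-suc : ∀ i j → U j (E (suc i)) ≡ j * U j (E i) + suc j * U (suc j) (E i)
  U-E-suc i j = trans (U-cong j (E-suc i)) (U-L j (E i))

  U-E-step : ∀ i j → j ≤ n → (n ∸ j) * U j (E (suc i)) ≤ n * (suc j * U (suc j) (E i))
  U-E-step i j j≤n = begin
    m * U j (E (suc i))           ≡⟨ cong (m *_) (U-E-suc i j) ⟩
    m * (j * a + suc j * b)       ≡⟨ e₁ m j a b ⟩
    j * (m * a) + m * (suc j * b) ≤⟨ +-monoˡ-≤ _ (*-monoʳ-≤ j (U-step (E-inc i) j)) ⟩
    j * (suc j * b) + m * (suc j * b) ≡⟨ *-distribʳ-+ (suc j * b) j m ⟨
    (j + m) * (suc j * b)         ≡⟨ cong (_* (suc j * b)) (m+[n∸m]≡n j≤n) ⟩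
    n * (suc j * b)               ∎
    where
    open ≤-Reasoning
    m = n ∸ j
    a = U j (E i)
    b = U (suc j) (E i)
    e₁ : ∀ m j a b → m * (j * a + (1 + j) * b) ≡ j * (m * a) + m * ((1 + j) * b)
    e₁ = solve-∀

  -- In averages: i random letters added to a random j-set do no better than a random set of size j
  -- + i, since repeated letters only make the set smaller. `U-E-step` shows it for one letter.
  U-E-upper : ∀ i j → j + i ≤ n → (n C (j + i)) * U j (E i) ≤ n ^ i * (n C j) * U (j + i) g
  U-E-upper zero j _ rewrite +-identityʳ j | U-E-0 j = *-monoˡ-≤ (U j g) (m≤n*m (n C j) 1)
  U-E-upper (suc i) j h rewrite +-suc j i = *-cancelˡ-≤ m {{>-nonZero (m<n⇒0<n∸m j<n)}} (begin
    m * (c′ * U j (E (suc i)))             ≡⟨ e₁ m c′ (U j (E (suc i))) ⟩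
    c′ * (m * U j (E (suc i)))             ≤⟨ *-monoʳ-≤ c′ (U-E-step i j (<⇒≤ j<n)) ⟩
    c′ * (n * (suc j * b))                 ≡⟨ e₂ c′ n (suc j) b ⟩
    n * suc j * (c′ * b)                   ≤⟨ *-monoʳ-≤ (n * suc j) (U-E-upper i (suc j) h) ⟩
    n * suc j * (n ^ i * (n C suc j) * u)  ≡⟨ e₃ n (suc j) (n ^ i) (n C suc j) u ⟩
    n * n ^ i * (suc j * (n C suc j)) * u  ≡⟨ cong (λ z → n * n ^ i * z * u) (sym (absorb n j)) ⟩
    n * n ^ i * (m * (n C j)) * u          ≡⟨ e₄ (n * n ^ i) m (n C j) u ⟩
    m * (n * n ^ i * (n C j) * u)          ∎)
    where
    open ≤-Reasoning
    m = n ∸ j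
    c′ = n C (suc j + i)
    b = U (suc j) (E i)
    u = U (suc j + i) g
    j<n : j < n
    j<n = m+n≤o⇒m≤o (suc j) h
    e₁ : ∀ m c x → m * (c * x) ≡ c * (m * x)
    e₁ = solve-∀
    e₂ : ∀ c n s b → c * (n * (s * b)) ≡ n * s * (c * b)
    e₂ = solve-∀
    e₃ : ∀ n s t c u → n * s * (t * c * u) ≡ n * t * (s * c) * u
    e₃ = solve-∀
    e₄ : ∀ t m c u → t * (m * c) * u ≡ m * (t * c * u)
    e₄ = solve-∀

  words≤level : ∀ i → i ≤ n → (n C i) * E i ⊥ ≤ n ^ i * U i g
  words≤level i i≤n = begin
    (n C i) * E i ⊥           ≡⟨ cong ((n C i) *_) (U-0 (E i)) ⟨
    (n C i) * U 0 (E i)       ≤⟨ U-E-upper i 0 i≤n ⟩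
    n ^ i * 1 * U i g         ≡⟨ cong (_* U i g) (*-identityʳ (n ^ i)) ⟩
    n ^ i * U i g             ∎
    where open ≤-Reasoning

  lym : ∀ k a → (n C (k + a)) * U k g ≤ (n C k) * U (k + a) g
  lym k zero rewrite +-identityʳ k = ≤-refl
  lym k (suc a) rewrite +-suc k a = *-cancelˡ-≤ (suc j) (begin
    suc j * ((n C suc j) * U k g)     ≡⟨ *-assoc (suc j) (n C suc j) _ ⟨
    suc j * (n C suc j) * U k g       ≡⟨ cong (_* U k g) (absorb n j) ⟨
    (n ∸ j) * (n C j) * U k g         ≡⟨ *-assoc (n ∸ j) (n C j) _ ⟩
    (n ∸ j) * ((n C j) * U k g)       ≤⟨ *-monoʳ-≤ (n ∸ j) (lym k a) ⟩
    (n ∸ j) * ((n C k) * U j g)       ≡⟨ e (n ∸ j) (n C k) (U j g) ⟩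
    (n C k) * ((n ∸ j) * U j g)       ≤⟨ *-monoʳ-≤ (n C k) (U-step g-inc j) ⟩
    (n C k) * (suc j * U (suc j) g)   ≡⟨ e (n C k) (suc j) (U (suc j) g) ⟩
    suc j * ((n C k) * U (suc j) g)   ∎)
    where
    open ≤-Reasoning
    j = k + a
    e : ∀ a b c → a * (b * c) ≡ b * (a * c)
    e = solve-∀

  -- Markov's inequality for the number of repeated letters in a word of length 2k: from a set of
  -- size j with i letters left and σ = 2k - j - i repetitions so far, at most σ + 2k i / n are
  -- expected, and level k is missed only if at least k occur.
  U-E-lower : ∀ k → k + k ≤ n → ∀ i j σ → j + i + σ ≡ k + k →
    k * n * (U k g * (n C j) * n ^ i) ≤
      k * n * (n C k) * U j (E i) + U k g * (n C j) * n ^ i * (σ * n + (k + k) * i)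
  U-E-lower k ℓ≤n zero j σ eq rewrite U-E-0 j with ≤-total k j
  ... | inj₁ k≤j = ≤-trans (begin
    k * n * (u * (n C j) * 1)        ≡⟨ e (k * n) u (n C j) ⟩
    k * n * ((n C j) * u)            ≡⟨ cong (λ z → k * n * ((n C z) * u)) k+a ⟨
    k * n * ((n C (k + a)) * u)      ≤⟨ *-monoʳ-≤ (k * n) (lym k a) ⟩
    k * n * ((n C k) * U (k + a) g)  ≡⟨ cong (λ z → k * n * ((n C k) * U z g)) k+a ⟩
    k * n * ((n C k) * U j g)        ≡⟨ *-assoc (k * n) (n C k) (U j g) ⟨
    k * n * (n C k) * U j g          ∎) (m≤m+n _ _)
    where
    open ≤-Reasoning
    u = U k g
    a = j ∸ k
    k+a : k + a ≡ j
    k+a = m+[n∸m]≡n k≤j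
    e : ∀ m u c → m * (u * c * 1) ≡ m * (c * u)
    e = solve-∀
  ... | inj₂ j≤k = ≤-trans (begin
    k * n * (u * (n C j) * 1)        ≡⟨ *-comm (k * n) (u * (n C j) * 1) ⟩
    u * (n C j) * 1 * (k * n)        ≤⟨ *-monoʳ-≤ (u * (n C j) * 1) (≤-trans (*-monoˡ-≤ n k≤σ) (m≤m+n (σ * n) _)) ⟩
    u * (n C j) * 1 * (σ * n + (k + k) * 0) ∎) (m≤n+m _ (k * n * (n C k) * U j g))
    where
    open ≤-Reasoning
    u = U k g
    k≤σ : k ≤ σ
    k≤σ = +-cancelˡ-≤ k k σ (begin
      k + k       ≡⟨ eq ⟨
      j + 0 + σ   ≡⟨ cong (_+ σ) (+-identityʳ j) ⟩
      j + σ       ≤⟨ +-monoˡ-≤ σ j≤k ⟩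
      k + σ       ∎)
  U-E-lower k ℓ≤n (suc i) j σ eq = begin
    k * n * (u * c * (n * t))
      ≡⟨ cong (λ z → k * n * (u * c * (z * t))) j+m ⟨
    k * n * (u * c * ((j + m) * t))
      ≡⟨ e₁ (k * n) u c j m t ⟩
    j * (k * n * (u * c * t)) + k * n * (u * (m * c) * t)
      ≡⟨ cong (λ z → j * (k * n * (u * c * t)) + k * n * (u * z * t)) (absorb n j) ⟩
    j * (k * n * (u * c * t)) + k * n * (u * (suc j * c′) * t)
      ≡⟨ e₂ j (k * n) u c t c′ ⟩
    j * (k * n * (u * c * t)) + suc j * (k * n * (u * c′ * t))
      ≤⟨ +-mono-≤ (*-monoʳ-≤ j (U-E-lower k ℓ≤n i j (suc σ) eq₁))
                  (*-monoʳ-≤ (suc j) (U-E-lower k ℓ≤n i (suc j) σ eq₂)) ⟩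
    j * (k * n * (n C k) * U j (E i) + u * c * t * (suc σ * n + (k + k) * i))
      + suc j * (k * n * (n C k) * U (suc j) (E i) + u * c′ * t * (σ * n + (k + k) * i))
      ≡⟨ e₃ j (k * n * (n C k)) (U j (E i)) c ((1 + σ) * n + (k + k) * i) (U (suc j) (E i)) c′ (σ * n + (k + k) * i) u t ⟩
    k * n * (n C k) * (j * U j (E i) + suc j * U (suc j) (E i))
      + u * t * (c * (j * (suc σ * n + (k + k) * i)) + suc j * c′ * (σ * n + (k + k) * i))
      ≡⟨ cong₂ (λ a b → k * n * (n C k) * a + u * t * (c * (j * (suc σ * n + (k + k) * i)) + b * (σ * n + (k + k) * i)))
           (sym (U-E-suc i j)) (sym (absorb n j)) ⟩
    k * n * (n C k) * U j (E (suc i))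
      + u * t * (c * (j * (suc σ * n + (k + k) * i)) + m * c * (σ * n + (k + k) * i))
      ≡⟨ cong (λ z → k * n * (n C k) * U j (E (suc i)) + u * t * z) (e₄ c j σ n ((k + k) * i) m) ⟩
    k * n * (n C k) * U j (E (suc i))
      + u * t * (c * ((j + m) * (σ * n + (k + k) * i) + j * n))
      ≡⟨ cong (λ z → k * n * (n C k) * U j (E (suc i)) + u * t * (c * (z * (σ * n + (k + k) * i) + j * n))) j+m ⟩
    k * n * (n C k) * U j (E (suc i))
      + u * t * (c * (n * (σ * n + (k + k) * i) + j * n))
      ≤⟨ +-monoʳ-≤ (k * n * (n C k) * U j (E (suc i))) (*-monoʳ-≤ (u * t) (*-monoʳ-≤ c
           (+-monoʳ-≤ (n * (σ * n + (k + k) * i)) (*-monoˡ-≤ n j≤ℓ)))) ⟩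
    k * n * (n C k) * U j (E (suc i))
      + u * t * (c * (n * (σ * n + (k + k) * i) + (k + k) * n))
      ≡⟨ cong (k * n * (n C k) * U j (E (suc i)) +_) (e₅ u t c n σ (k + k) i) ⟩
    k * n * (n C k) * U j (E (suc i)) + u * c * (n * t) * (σ * n + (k + k) * suc i) ∎
    where
    open ≤-Reasoning
    u = U k g
    c = n C j
    c′ = n C suc j
    t = n ^ i
    m = n ∸ j
    j≤ℓ : j ≤ k + k
    j≤ℓ = m+n≤o⇒m≤o j (m+n≤o⇒m≤o (j + suc i) (≤-reflexive eq))
    j+m : j + m ≡ n
    j+m = m+[n∸m]≡n (≤-trans j≤ℓ ℓ≤n)
    eq₁ : j + i + suc σ ≡ k + k
    eq₁ = trans (s₁ j i σ) eq
      where
      s₁ : ∀ j i s → j + i + (1 + s) ≡ j + (1 + i) + s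
      s₁ = solve-∀
    eq₂ : suc j + i + σ ≡ k + k
    eq₂ = trans (cong (_+ σ) (sym (+-suc j i))) eq
    e₁ : ∀ p u c j m t → p * (u * c * ((j + m) * t)) ≡ j * (p * (u * c * t)) + p * (u * (m * c) * t)
    e₁ = solve-∀
    e₂ : ∀ j p u c t d → j * (p * (u * c * t)) + p * (u * ((1 + j) * d) * t)
                         ≡ j * (p * (u * c * t)) + (1 + j) * (p * (u * d * t))
    e₂ = solve-∀
    e₃ : ∀ j p a c x b d y u t →
      j * (p * a + u * c * t * x) + (1 + j) * (p * b + u * d * t * y)
        ≡ p * (j * a + (1 + j) * b) + u * t * (c * (j * x) + (1 + j) * d * y)
    e₃ = solve-∀
    e₄ : ∀ c j s n x m → c * (j * ((1 + s) * n + x)) + m * c * (s * n + x) ≡ c * ((j + m) * (s * n + x) + j * n)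
    e₄ = solve-∀
    e₅ : ∀ u t c n s l i → u * t * (c * (n * (s * n + l * i) + l * n)) ≡ u * c * (n * t) * (s * n + l * (1 + i))
    e₅ = solve-∀

  -- From the empty set with 2k letters to go, at most (2k)² / n repetitions are expected. So k or
  -- more of them occur with probability at most 4k / n ≤ 1/2, and otherwise at least k distinct
  -- letters are present.
  level≤words : ∀ k → 0 < k → 8 * k ≤ n → U k g * n ^ (k + k) ≤ 2 * (n C k) * E (k + k) ⊥
  level≤words k k>0 8k≤n = *-cancelˡ-≤ (k * n) {{m*n≢0 k n {{>-nonZero k>0}} {{>-nonZero n>0}}}} (+-cancelʳ-≤ (k * n * (u * t)) _ _ (begin
    k * n * (u * t) + k * n * (u * t)
      ≡⟨ e₁ (k * n) u t ⟩
    2 * (k * n * (u * 1 * t))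
      ≤⟨ *-monoʳ-≤ 2 (U-E-lower k (≤-trans 2k≤8k 8k≤n) (k + k) 0 0 (+-identityʳ (k + k))) ⟩
    2 * (k * n * (n C k) * U 0 (E (k + k)) + u * 1 * t * ((k + k) * (k + k)))
      ≡⟨ cong (λ z → 2 * (k * n * (n C k) * z + u * 1 * t * ((k + k) * (k + k)))) (U-0 (E (k + k))) ⟩
    2 * (k * n * (n C k) * y + u * 1 * t * ((k + k) * (k + k)))
      ≡⟨ e₂ k n (n C k) y u t ⟩
    k * n * (2 * (n C k) * y) + u * t * k * (8 * k)
      ≤⟨ +-monoʳ-≤ (k * n * (2 * (n C k) * y)) (*-monoʳ-≤ (u * t * k) 8k≤n) ⟩
    k * n * (2 * (n C k) * y) + u * t * k * n
      ≡⟨ cong (k * n * (2 * (n C k) * y) +_) (e₃ u t k n) ⟩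
    k * n * (2 * (n C k) * y) + k * n * (u * t) ∎))
    where
    open ≤-Reasoning
    u = U k g
    t = n ^ (k + k)
    y = E (k + k) ⊥
    2k≤8k : k + k ≤ 8 * k
    2k≤8k = ≤-from (6 * k) (e k)
      where
      e : ∀ k → k + k + 6 * k ≡ 8 * k
      e = solve-∀
    n>0 : 0 < n
    n>0 = ≤-trans k>0 (≤-trans (m≤n*m k 8) 8k≤n)
    e₁ : ∀ p u t → p * (u * t) + p * (u * t) ≡ 2 * (p * (u * 1 * t))
    e₁ = solve-∀
    e₂ : ∀ k n c y u t → 2 * (k * n * c * y + u * 1 * t * ((k + k) * (k + k))) ≡ k * n * (2 * c * y) + u * t * k * (8 * k)
    e₂ = solve-∀
    e₃ : ∀ u t k n → u * t * k * n ≡ k * n * (u * t)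
    e₃ = solve-∀

-- Shifting and the weighted matching lemma

module _ {X : Set} where

  ∑-member : ∀ {xs} {x : X} f → x List.∈ xs → f x ≤ ∑ xs f
  ∑-member f (Any.here refl) = m≤m+n _ _
  ∑-member f (Any.there p) = ≤-trans (∑-member f p) (m≤n+m _ _)

  ∑-strict : ∀ {xs} {x : X} {f g} → x List.∈ xs → (∀ y → f y ≤ g y) → f x < g x → ∑ xs f < ∑ xs g
  ∑-strict {_ ∷ xs} (Any.here refl) h lt = +-mono-<-≤ lt (∑-mono xs h)
  ∑-strict {y ∷ _} (Any.there p) h lt = +-mono-≤-< (h y) (∑-strict p h lt)

  ∑<length⇒zero : ∀ xs (f : X → ℕ) → ∑ xs f < length xs → ∃ λ x → f x ≡ 0
  ∑<length⇒zero (x ∷ xs) f lt with f x in eq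
  ... | zero = x , eq
  ... | suc k = ∑<length⇒zero xs f (≤-trans (s≤s (m≤n+m (∑ xs f) k)) (s≤s⁻¹ lt))

∈-allSubsets : ∀ {n} (A : Subset n) → A List.∈ allSubsets n
∈-allSubsets [] = Any.here refl
∈-allSubsets (false ∷ A) = ∈-++⁺ˡ (∈-map⁺ (false ∷_) (∈-allSubsets A))
∈-allSubsets {suc n} (true ∷ A) = ∈-++⁺ʳ (map (false ∷_) (allSubsets n)) (∈-map⁺ (true ∷_) (∈-allSubsets A))

Disjoint : ∀ {n} → Subset n → Subset n → Set
Disjoint A B = ∀ {z} → z ∈ A → z ∉ B

Disjoint⇒∩≡⊥ : ∀ {n} {A B : Subset n} → Disjoint A B → A ∩ B ≡ ⊥
Disjoint⇒∩≡⊥ {A = A} {B} d = Empty-unique λ (z , z∈) → let z∈A , z∈B = x∈p∩q⁻ A B z∈ in d z∈A z∈B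

∩≡⊥⇒Disjoint : ∀ {n} {A B : Subset n} → A ∩ B ≡ ⊥ → Disjoint A B
∩≡⊥⇒Disjoint eq z∈A z∈B = ∉⊥ (subst (_ ∈_) eq (x∈p∩q⁺ (z∈A , z∈B)))

del : ∀ {n} → Fin n → Subset n → Subset n
del x A = A [ x ]≔ false

∣del∣ : ∀ {n} (x : Fin n) A → lookup A x ≡ true → ∣ A ∣ ≡ suc ∣ del x A ∣
∣del∣ zero (true ∷ A) _ = refl
∣del∣ (suc x) (true ∷ A) h = cong suc (∣del∣ x A h)
∣del∣ (suc x) (false ∷ A) h = ∣del∣ x A h

del-add : ∀ {n} (x : Fin n) A → lookup A x ≡ false → del x (add x A) ≡ A
del-add x A h = trans ([]≔-idempotent A x) (trans (cong (A [ x ]≔_) (sym h)) ([]≔-lookup A x))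

∈⇒lookup : ∀ {n} {x : Fin n} {A} → x ∈ A → lookup A x ≡ true
∈⇒lookup = []=⇒lookup

lookup⇒∈ : ∀ {n} {x : Fin n} {A} → lookup A x ≡ true → x ∈ A
lookup⇒∈ {x = x} {A} = lookup⇒[]= x A

∉⇒lookup : ∀ {n} {x : Fin n} {A} → x ∉ A → lookup A x ≡ false
∉⇒lookup {x = x} {A} h with lookup A x in eq
... | true = contradiction (lookup⇒∈ eq) h
... | false = refl

lookup-false⇒∉ : ∀ {n} {x : Fin n} {A} → lookup A x ≡ false → x ∉ A
lookup-false⇒∉ h x∈A with () ← trans (sym h) (∈⇒lookup x∈A)

module _ {m : ℕ} (x : Fin m) where

  -- The usual compression: the top element, which is the head of the vector, is replaced by x
  -- wherever the result is not yet a member.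
  shift : Family (suc m) → Family (suc m)
  shift F (true ∷ B) = F (true ∷ B) ∧ (lookup B x ∨ F (false ∷ add x B))
  shift F (false ∷ B) = F (false ∷ B) ∨ (lookup B x ∧ F (true ∷ del x B))

  exchange : Subset (suc m) → Subset (suc m)
  exchange (b ∷ B) = lookup B x ∷ (B [ x ]≔ b)

  shift-uniform : ∀ {k} F → Uniform k F → Uniform k (shift F)
  shift-uniform F u (true ∷ B) h = u (true ∷ B) (proj₁ (∧-true h))
  shift-uniform F u (false ∷ B) h with F (false ∷ B) in eq | lookup B x in lk
  ... | true | _ = u (false ∷ B) eq
  ... | false | true = trans (∣del∣ x B lk) (u (true ∷ del x B) h)

  -- Sets with exactly one of the top element and x come in pairs, and on each pair `shift` replaces
  -- the two membership values by their conjunction and disjunction.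
  shift-size : ∀ F → ∑ (allSubsets (suc m)) (ind ∘ shift F) ≡ ∑ (allSubsets (suc m)) (ind ∘ F)
  shift-size F = begin
    ∑ (allSubsets (suc m)) (ind ∘ shift F)
      ≡⟨ ∑-subsets-suc m _ ⟩
    (∑[ B ← 𝒫 ] ind (shift F (false ∷ B))) + (∑[ B ← 𝒫 ] ind (shift F (true ∷ B)))
      ≡⟨ cong₂ _+_ (trans (∑-cong 𝒫 low) (trans (∑-+ 𝒫 _ _) (cong (α +_) (sym (∑-add x _)))))
                   (trans (∑-cong 𝒫 high) (∑-+ 𝒫 _ _)) ⟩
    (α + (∑[ B ← 𝒫 ] (n̸ B * ind (F (false ∷ add x B) ∨ F (true ∷ del x (add x B))))))
      + (δ + (∑[ B ← 𝒫 ] (n̸ B * ind (F (true ∷ B) ∧ F (false ∷ add x B)))))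
      ≡⟨ e α _ δ _ ⟩
    α + ((∑[ B ← 𝒫 ] (n̸ B * ind (F (false ∷ add x B) ∨ F (true ∷ del x (add x B)))))
        + (∑[ B ← 𝒫 ] (n̸ B * ind (F (true ∷ B) ∧ F (false ∷ add x B))))) + δ
      ≡⟨ cong (λ z → α + z + δ) (trans (sym (∑-+ 𝒫 _ _)) (trans (∑-cong 𝒫 mid) (∑-+ 𝒫 _ _))) ⟩
    α + ((∑[ B ← 𝒫 ] (n̸ B * ind (F (false ∷ add x B)))) + (∑[ B ← 𝒫 ] (n̸ B * ind (F (true ∷ B))))) + δ
      ≡⟨ e′ α _ _ δ ⟩
    (α + (∑[ B ← 𝒫 ] (n̸ B * ind (F (false ∷ add x B))))) + ((∑[ B ← 𝒫 ] (n̸ B * ind (F (true ∷ B)))) + δ)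
      ≡⟨ cong₂ _+_ (trans (cong (α +_) (∑-add x _)) (trans (sym (∑-+ 𝒫 _ _)) (∑-cong 𝒫 λ B → part (lookup B x) _)))
                   (trans (sym (∑-+ 𝒫 _ _)) (∑-cong 𝒫 λ B → part (lookup B x) _)) ⟩
    (∑[ B ← 𝒫 ] ind (F (false ∷ B))) + (∑[ B ← 𝒫 ] ind (F (true ∷ B)))
      ≡⟨ ∑-subsets-suc m _ ⟨
    ∑ (allSubsets (suc m)) (ind ∘ F) ∎
    where
    open ≡-Reasoning
    𝒫 = allSubsets m
    y n̸ : Subset m → ℕ
    y B = ind (lookup B x)
    n̸ B = ind (not (lookup B x))
    α = ∑[ B ← 𝒫 ] (n̸ B * ind (F (false ∷ B)))
    δ = ∑[ B ← 𝒫 ] (y B * ind (F (true ∷ B)))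
    low : ∀ B → ind (shift F (false ∷ B)) ≡ n̸ B * ind (F (false ∷ B)) + y B * ind (F (false ∷ B) ∨ F (true ∷ del x B))
    low B with lookup B x | F (false ∷ B)
    ... | true | a = sym (+-identityʳ _)
    ... | false | true = refl
    ... | false | false = refl
    high : ∀ B → ind (shift F (true ∷ B)) ≡ y B * ind (F (true ∷ B)) + n̸ B * ind (F (true ∷ B) ∧ F (false ∷ add x B))
    high B with lookup B x | F (true ∷ B)
    ... | true | true = refl
    ... | true | false = refl
    ... | false | a = sym (+-identityʳ _)
    mid : ∀ B → n̸ B * ind (F (false ∷ add x B) ∨ F (true ∷ del x (add x B))) + n̸ B * ind (F (true ∷ B) ∧ F (false ∷ add x B))
              ≡ n̸ B * ind (F (false ∷ add x B)) + n̸ B * ind (F (true ∷ B))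
    mid B with lookup B x in lk
    ... | true = refl
    ... | false rewrite del-add x B lk = lem (F (false ∷ add x B)) (F (true ∷ B))
      where
      lem : ∀ a b → ind (a ∨ b) + 0 + (ind (b ∧ a) + 0) ≡ ind a + 0 + (ind b + 0)
      lem true true = refl
      lem true false = refl
      lem false true = refl
      lem false false = refl
    part : ∀ b c → ind (not b) * c + ind b * c ≡ c
    part true c = +-identityʳ c
    part false c = trans (+-identityʳ _) (+-identityʳ c)
    e : ∀ a b c d → (a + b) + (c + d) ≡ a + (b + d) + c
    e = solve-∀
    e′ : ∀ a b c d → a + (b + c) + d ≡ (a + b) + (c + d)
    e′ = solve-∀

  shift-top≤ : ∀ F B → ind (shift F (true ∷ B)) ≤ ind (F (true ∷ B))
  shift-top≤ F B = ind-mono λ h → proj₁ (∧-true h)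

  exchange-disjoint : ∀ {A A′} → Disjoint A A′ → Disjoint (exchange A) (exchange A′)
  exchange-disjoint {b ∷ B} {b′ ∷ B′} d {zero} p q =
    d (there (lookup⇒∈ (∈⇒lookup p))) (there (lookup⇒∈ (∈⇒lookup q)))
  exchange-disjoint {b ∷ B} {b′ ∷ B′} d {suc z} (there p) (there q) with z Fin.≟ x
  ... | yes refl = d (lookup⇒∈ {x = zero} (trans (sym (lookup∘update x B b)) (∈⇒lookup p)))
                     (lookup⇒∈ {x = zero} (trans (sym (lookup∘update x B′ b′)) (∈⇒lookup q)))
  ... | no z≢x = d (there (lookup⇒∈ (trans (sym (lookup∘update′ z≢x B b)) (∈⇒lookup p))))
                   (there (lookup⇒∈ (trans (sym (lookup∘update′ z≢x B′ b′)) (∈⇒lookup q))))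

  -- A member of the shifted family that is new comes from exchanging; as it contains x and not the
  -- top element, exchanging the other members of the matching keeps them in their families.
  unshift-matching : ∀ {s} (F : Fin s → Family (suc m)) → CrossMatching (shift ∘ F) → CrossMatching F
  unshift-matching F (A , A∈ , dis) with any? (λ i → F i (A i) ≟ᵇ false)
  ... | no all-old = A , (λ i → ¬-not (λ e → all-old (i , e))) , dis
  ... | yes (i₀ , new) = exchange ∘ A , moved , λ i j i≢j →
    Disjoint⇒∩≡⊥ (exchange-disjoint {A i} {A j} (∩≡⊥⇒Disjoint (dis i j i≢j)))
    where
    new-member : ∀ G C → shift G C ≡ true → G C ≡ false →
      suc x ∈ C × G (exchange C) ≡ true
    new-member G (true ∷ B) h e with () ← trans (sym (proj₁ (∧-true h))) e
    new-member G (false ∷ B) h e rewrite e with lookup B x in lk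
    ... | true = there (lookup⇒∈ lk) , h
    other-member : ∀ G C → shift G C ≡ true → suc x ∉ C → G (exchange C) ≡ true
    other-member G (true ∷ B) h x∉ with lookup B x in lk
    ... | true = contradiction (there (lookup⇒∈ lk)) x∉
    ... | false = proj₂ (∧-true h)
    other-member G (false ∷ B) h x∉ with lookup B x in lk
    ... | true = contradiction (there (lookup⇒∈ lk)) x∉
    ... | false rewrite trans (cong (B [ x ]≔_) (sym lk)) ([]≔-lookup B x) with G (false ∷ B)
    ...   | true = refl
    moved : ∀ i → F i (exchange (A i)) ≡ true
    moved i with i Fin.≟ i₀
    ... | yes refl = proj₂ (new-member (F i) (A i) (A∈ i) new)
    ... | no i≢i₀ = other-member (F i) (A i) (A∈ i)
      (∩≡⊥⇒Disjoint (dis i₀ i (i≢i₀ ∘ sym)) (proj₁ (new-member (F i₀) (A i₀) (A∈ i₀) new)))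

-- Compression away from the top element only: the induction in `cross-matching` splits at this
-- element, and `repair` has to remove just this one.
Stable : ∀ {m s} → (Fin s → Family (suc m)) → Set
Stable {m} F = ∀ i (x : Fin m) B → F i (true ∷ B) ≡ true → x ∉ B → F i (false ∷ add x B) ≡ true

stable-or-shift : ∀ {m s} (F : Fin s → Family (suc m)) →
  Stable F ⊎ ∃ λ x → ∃ λ i → ∃ λ B → shift x (F i) (true ∷ B) ≡ false × F i (true ∷ B) ≡ true
stable-or-shift F with any? (λ x → any? λ i → anySubset? λ B →
  (shift x (F i) (true ∷ B) ≟ᵇ false) ×-dec (F i (true ∷ B) ≟ᵇ true))
... | yes p = inj₂ p
... | no ¬p = inj₁ λ i x B h x∉B → ok i x B h x∉B
  where
  ok : Stable F
  ok i x B h x∉B with F i (false ∷ add x B) in eq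
  ... | true = refl
  ... | false = contradiction (x , i , B , bad , h) ¬p
    where
    bad : shift x (F i) (true ∷ B) ≡ false
    bad rewrite h | ∉⇒lookup x∉B | eq = refl

-- A shift that violates stability reveals lowers the number of members containing the top element,
-- and no shift raises it; this number bounds the fuel.
shift-to-stable : ∀ {m s} fuel (F : Fin s → Family (suc m)) (k : Fin s → ℕ) →
  (∀ i → Uniform (k i) (F i)) →
  ∑[ i ← allFin s ] ∑[ B ← allSubsets m ] ind (F i (true ∷ B)) ≤ fuel →
  ∃ λ G → (∀ i → Uniform (k i) (G i)) × (∀ i → ∑ (allSubsets (suc m)) (ind ∘ G i) ≡ ∑ (allSubsets (suc m)) (ind ∘ F i))
    × Stable G × (CrossMatching G → CrossMatching F)
shift-to-stable {m} {s} fuel F k u h with stable-or-shift F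
... | inj₁ st = F , u , (λ _ → refl) , st , λ cm → cm
... | inj₂ (x , i , B , no-longer , before) = next fuel h
  where
  drop : ∑[ i ← allFin s ] ∑[ B ← allSubsets m ] ind (shift x (F i) (true ∷ B))
         < ∑[ i ← allFin s ] ∑[ B ← allSubsets m ] ind (F i (true ∷ B))
  drop = ∑-strict (∈-allFin i) (λ j → ∑-mono (allSubsets m) (shift-top≤ x (F j)))
    (∑-strict (∈-allSubsets B) (shift-top≤ x (F i)) strict)
    where
    strict : ind (shift x (F i) (true ∷ B)) < ind (F i (true ∷ B))
    strict rewrite no-longer | before = z<s
  next : ∀ fuel → ∑[ i ← allFin s ] ∑[ B ← allSubsets m ] ind (F i (true ∷ B)) ≤ fuel →
    ∃ λ G → (∀ i → Uniform (k i) (G i)) × (∀ i → ∑ (allSubsets (suc m)) (ind ∘ G i) ≡ ∑ (allSubsets (suc m)) (ind ∘ F i))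
      × Stable G × (CrossMatching G → CrossMatching F)
  next zero le = contradiction (≤-trans drop le) (λ ())
  next (suc fuel) le with shift-to-stable fuel (shift x ∘ F) k (λ j → shift-uniform x (F j) (u j)) (s≤s⁻¹ (≤-trans drop le))
  ... | G , uG , sizes , st , cm = G , uG , (λ j → trans (sizes j) (shift-size x (F j))) , st , unshift-matching x F ∘ cm

-- m C (k - 1), with value 0 rather than m C 0 at k = 0.
_C⁻_ : ℕ → ℕ → ℕ
m C⁻ zero = 0
m C⁻ suc k = m C k

C⁻-pascal : ∀ m k → suc m C⁻ suc k ≡ m C⁻ k + m C⁻ suc k
C⁻-pascal m zero = refl
C⁻-pascal m (suc k) = sym (nCk+nC[k+1]≡[n+1]C[k+1] m k)

extract : ∀ n k → suc k * (suc n C suc k) ≡ suc n * (n C k)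
extract n k = begin
  suc k * (suc n C suc k)              ≡⟨ cong (suc k *_) (nCk+nC[k+1]≡[n+1]C[k+1] n k) ⟨
  suc k * (n C k + n C suc k)          ≡⟨ *-distribˡ-+ (suc k) (n C k) _ ⟩
  suc k * (n C k) + suc k * (n C suc k) ≡⟨ cong (suc k * (n C k) +_) (sym (absorb n k)) ⟩
  suc k * (n C k) + (n ∸ k) * (n C k)  ≡⟨ *-distribʳ-+ (n C k) (suc k) (n ∸ k) ⟨
  suc (k + (n ∸ k)) * (n C k)          ≡⟨ last ⟩
  suc n * (n C k)                      ∎
  where
  open ≡-Reasoning
  last : suc (k + (n ∸ k)) * (n C k) ≡ suc n * (n C k)
  last with ≤-<-connex k n
  ... | inj₁ k≤n = cong (λ z → suc z * (n C k)) (m+[n∸m]≡n k≤n)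
  ... | inj₂ n<k rewrite k>n⇒nCk≡0 n<k = trans (*-zeroʳ (suc (k + (n ∸ k)))) (sym (*-zeroʳ (suc n)))

size : ∀ {n} → Family n → ℕ
size {n} F = ∑ (allSubsets n) (ind ∘ F)

size≤C : ∀ {n k} (F : Family n) → Uniform k F → size F ≤ n C k
size≤C {n} {k} F u = ≤-trans (∑-mono (allSubsets n) pointwise) (≤-reflexive (U-1 n k))
  where
  pointwise : ∀ A → ind (F A) ≤ ind (∣ A ∣ ≡ᵇ k) * 1
  pointwise A = ≤-trans (ind-mono λ h → trans (cong (_≡ᵇ k) (u A h)) (≡ᵇ-refl k)) (≤-reflexive (sym (*-identityʳ _)))

-- For k > 0 a uniform family has at most (m + 1) / k times m C (k - 1) members. Summed over the
-- families, the bound shows that disjoint members fit into the ground set.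
weight-bound : ∀ {m} Q w k (F : Family (suc m)) → Uniform k F → Q * (m C⁻ k) < w * size F → Q * k < w * suc m
weight-bound {m} Q w zero F u lt rewrite *-zeroʳ Q = w>0 w lt
  where
  w>0 : ∀ w → 0 < w * size F → 0 < w * suc m
  w>0 (suc w) _ = z<s
weight-bound {m} Q w (suc k) F u lt = *-cancelʳ-< (m C k) _ _ (begin-strict
  Q * suc k * (m C k)          ≡⟨ e₁ Q (suc k) (m C k) ⟩
  suc k * (Q * (m C k))        <⟨ *-monoʳ-< (suc k) lt ⟩
  suc k * (w * size F)         ≤⟨ *-monoʳ-≤ (suc k) (*-monoʳ-≤ w (size≤C F u)) ⟩
  suc k * (w * (suc m C suc k)) ≡⟨ e₂ (suc k) w (suc m C suc k) ⟩
  w * (suc k * (suc m C suc k)) ≡⟨ cong (w *_) (extract m k) ⟩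
  w * (suc m * (m C k))        ≡⟨ *-assoc w (suc m) _ ⟨
  w * suc m * (m C k)          ∎)
  where
  open ≤-Reasoning
  e₁ : ∀ q k c → q * k * c ≡ k * (q * c)
  e₁ = solve-∀
  e₂ : ∀ k w c → k * (w * c) ≡ w * (k * c)
  e₂ = solve-∀

sizes<n : ∀ {m s} Q (w k : Fin (suc s) → ℕ) → (∀ i → Q * k i < w i * suc m) →
  ∑ (allFin (suc s)) w ≤ Q → ∑ (allFin (suc s)) k < suc m
sizes<n {m} {s} Q w k h hw = *-cancelˡ-< Q _ _ (begin-strict
  Q * ∑ I k                            ≡⟨ ∑-*ˡ I Q k ⟨
  ∑[ i ← I ] (Q * k i)                 <⟨ ∑-strict {x = zero} (∈-allFin zero) (<⇒≤ ∘ h) (h zero) ⟩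
  ∑[ i ← I ] (w i * suc m)             ≡⟨ ∑-*ʳ I (suc m) w ⟩
  ∑ I w * suc m                        ≤⟨ *-monoˡ-≤ (suc m) hw ⟩
  Q * suc m                            ∎)
  where
  open ≤-Reasoning
  I = allFin (suc s)

-- Members containing the top element give it up for an unused one; there is always one left since
-- the members have at most m elements in total.
repair : ∀ {m s} (F : Fin s → Family (suc m)) (k : Fin s → ℕ) → (∀ i → Uniform (k i) (F i)) → Stable F →
  ∑ (allFin s) k < suc m → (is : List (Fin s)) (b : Fin s → Bool) (B : Fin s → Subset m) →
  (∀ i → F i (b i ∷ B i) ≡ true) → (∀ i j → i ≢ j → Disjoint (B i) (B j)) →
  (∀ i → b i ≡ true → i List.∈ is) → CrossMatching F
repair F k u st hk [] b B mem dis tops = (λ i → b i ∷ B i) , mem , λ i j i≢j → Disjoint⇒∩≡⊥ (d i j i≢j)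
  where
  d : ∀ i j → i ≢ j → Disjoint (b i ∷ B i) (b j ∷ B j)
  d i j i≢j {zero} p q with () ← tops i (∈⇒lookup p)
  d i j i≢j {suc z} (there p) (there q) = dis i j i≢j p q
repair {m} {s} F k u st hk (i ∷ is) b B mem dis tops with b i in bi
... | false = repair F k u st hk is b B mem dis others
  where
  others : ∀ j → b j ≡ true → j List.∈ is
  others j bj with tops j bj
  ... | Any.there p = p
  ... | Any.here refl with () ← trans (sym bj) bi
... | true = repair F k u st hk is b′ B′ mem′ dis′ others
  where
  I = allFin s
  member-size : ∀ j → ∣ b j ∷ B j ∣ ≡ k j
  member-size j = u j _ (mem j)
  top-size : ∣ B i ∣ < ∣ b i ∷ B i ∣
  top-size rewrite bi = ≤-refl
  used : ∑[ j ← I ] ∣ B j ∣ < m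
  used = ≤-trans (∑-strict (∈-allFin i) (λ j → ∣p∣≤∣x∷p∣ (b j) (B j)) top-size)
    (≤-trans (≤-reflexive (∑-cong I member-size)) (s≤s⁻¹ hk))
  unused : ∃ λ x → ∑[ j ← I ] ind (lookup (B j) x) ≡ 0
  unused = ∑<length⇒zero (allFin m) _ (≤-trans (≤-reflexive (cong suc (trans (∑-swap (allFin m) I _)
    (∑-cong I λ j → sym (∣∣≡∑ (B j)))))) (≤-trans used (≤-reflexive (sym (length-allFin m)))))
  x = proj₁ unused
  x∉ : ∀ j → x ∉ B j
  x∉ j x∈ = contradiction
    (≤-trans (≤-reflexive (cong ind (sym (∈⇒lookup x∈)))) (≤-trans (∑-member _ (∈-allFin j)) (≤-reflexive (proj₂ unused))))
    (λ ())
  b′ : Fin s → Bool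
  b′ = updateAt b i (const false)
  B′ : Fin s → Subset m
  B′ = updateAt B i (add x)
  mem′ : ∀ j → F j (b′ j ∷ B′ j) ≡ true
  mem′ j with j Fin.≟ i
  ... | yes refl rewrite updateAt-updates i {const false} b | updateAt-updates i {add x} B =
    st i x (B i) (subst (λ z → F i (z ∷ B i) ≡ true) bi (mem i)) (x∉ i)
  ... | no j≢i rewrite updateAt-minimal j i {const false} b j≢i | updateAt-minimal j i {add x} B j≢i = mem j
  new-disjoint : ∀ j → j ≢ i → Disjoint (add x (B i)) (B j)
  new-disjoint j j≢i p q with ∈-add⁻ x p
  ... | inj₁ refl = x∉ j q
  ... | inj₂ r = dis i j (j≢i ∘ sym) r q
  dis′ : ∀ j l → j ≢ l → Disjoint (B′ j) (B′ l)
  dis′ j l j≢l with j Fin.≟ i | l Fin.≟ i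
  ... | yes refl | yes refl = contradiction refl j≢l
  ... | yes refl | no l≢i rewrite updateAt-updates i {add x} B | updateAt-minimal l i {add x} B l≢i = new-disjoint l l≢i
  ... | no j≢i | yes refl rewrite updateAt-updates i {add x} B | updateAt-minimal j i {add x} B j≢i = λ p q → new-disjoint j j≢i q p
  ... | no j≢i | no l≢i rewrite updateAt-minimal j i {add x} B j≢i | updateAt-minimal l i {add x} B l≢i = dis j l j≢l
  others : ∀ j → b′ j ≡ true → j List.∈ is
  others j bj with j Fin.≟ i
  ... | yes refl with () ← trans (sym bj) (updateAt-updates i {const false} b)
  others j bj | no j≢i with tops j (trans (sym (updateAt-minimal j i {const false} b j≢i)) bj)
  ... | Any.here j≡i = contradiction j≡i j≢i
  ... | Any.there p = p

-- The condition says that the ratios u i = Q / w i satisfy ∑ 1 / u i ≤ 1 and F i has more than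
-- u i * (m C (k i - 1)) members; by Pascal's rule it passes to one of the two restrictions of F i at the top element.
cross-matching : ∀ m {s} Q (w k : Fin s → ℕ) (F : Fin s → Family (suc m)) → (∀ i → Uniform (k i) (F i)) →
  ∑ (allFin s) w ≤ Q → (∀ i → Q * (m C⁻ k i) < w i * size (F i)) → CrossMatching F
cross-matching m {zero} Q w k F u hw h = (λ ()) , (λ ()) , (λ ())
-- On a one-point ground set the uniformities add up to less than 1, so every member is empty.
cross-matching zero {suc s} Q w k F u hw h = (λ i → proj₁ (member i)) , (λ i → proj₂ (member i)) ,
  λ i j _ → Disjoint⇒∩≡⊥ λ {z} z∈ → ⊥-elim (empty i z∈)
  where
  small : ∑ (allFin (suc s)) k < 1
  small = sizes<n Q w k (λ i → weight-bound Q (w i) (k i) (F i) (u i) (h i)) hw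
  k≡0 : ∀ i → k i ≡ 0
  k≡0 i = n<1⇒n≡0 (≤-<-trans (∑-member k (∈-allFin i)) small)
  member : ∀ i → ∃ λ A → F i A ≡ true
  member i with ∑-positive (allSubsets 1) (ind ∘ F i) positive
    where
    positive : 0 < size (F i)
    positive with size (F i) | h i
    ... | suc _ | _ = z<s
    ... | zero | lt = contradiction (≤-trans lt (≤-reflexive (*-zeroʳ (w i)))) (λ ())
  ... | A , p = A , ind-true p
  empty : ∀ i {z} → z ∉ proj₁ (member i)
  empty i {z} z∈ = contradiction (begin
    1                                 ≡⟨ cong ind (∈⇒lookup z∈) ⟨
    ind (lookup A z)                  ≤⟨ ∑-member (ind ∘ lookup A) (∈-allFin z) ⟩
    ∑[ x ← allFin 1 ] ind (lookup A x) ≡⟨ ∣∣≡∑ A ⟨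
    ∣ A ∣                             ≡⟨ trans (u i A (proj₂ (member i))) (k≡0 i) ⟩
    0                                 ∎) (λ ())
    where
    open ≤-Reasoning
    A = proj₁ (member i)
cross-matching (suc m) {suc s} Q w k F u hw h with shift-to-stable _ F k u ≤-refl
... | G , uG , sizes , st , back = back (repair G k uG st small (allFin (suc s)) b
        (proj₁ rest) (proj₁ (proj₂ rest)) (λ i j i≢j → ∩≡⊥⇒Disjoint (proj₂ (proj₂ rest) i j i≢j)) (λ i _ → ∈-allFin i))
  where
  small : ∑ (allFin (suc s)) k < suc (suc m)
  small = sizes<n Q w k (λ i → weight-bound Q (w i) (k i) (F i) (u i) (h i)) hw
  hG : ∀ i → Q * (suc m C⁻ k i) < w i * size (G i)
  hG i = ≤-trans (h i) (≤-reflexive (cong (w i *_) (sym (sizes i))))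
  Good : Fin (suc s) → Bool → ℕ → Set
  Good i b k′ = Uniform k′ (G i ∘ (b ∷_)) × Q * (m C⁻ k′) < w i * size (G i ∘ (b ∷_))
  choose : ∀ i → ∃ λ b → ∃ λ k′ → Good i b k′
  choose i with k i | uG i | hG i
  ... | zero | ui | hi = false , 0 , ui ∘ (false ∷_) ,
    ≤-trans hi (≤-reflexive (cong (w i *_) (trans (∑-subsets-suc (suc m) (ind ∘ G i)) (trans (cong (size (G i ∘ (false ∷_)) +_) none) (+-identityʳ _)))))
    where
    none : size (G i ∘ (true ∷_)) ≡ 0
    none = trans (∑-cong (allSubsets (suc m)) no-top) (trans (∑-const (allSubsets (suc m)) 0) (*-zeroʳ (length (allSubsets (suc m)))))
      where
      no-top : ∀ B → ind (G i (true ∷ B)) ≡ 0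
      no-top B with G i (true ∷ B) in eq
      ... | true with () ← ui (true ∷ B) eq
      no-top B | false = refl
  ... | suc k′ | ui | hi with Q * (m C⁻ k′) <? w i * size (G i ∘ (true ∷_))
  ...   | yes lt = true , k′ , (λ B e → suc-injective (ui (true ∷ B) e)) , lt
  ...   | no ¬lt = false , suc k′ , ui ∘ (false ∷_) , +-cancelˡ-< (Q * (m C⁻ k′)) _ _ (begin-strict
    Q * (m C⁻ k′) + Q * (m C⁻ suc k′)   ≡⟨ *-distribˡ-+ Q (m C⁻ k′) (m C⁻ suc k′) ⟨
    Q * (m C⁻ k′ + m C⁻ suc k′)         ≡⟨ cong (Q *_) (C⁻-pascal m k′) ⟨
    Q * (suc m C⁻ suc k′)               <⟨ hi ⟩
    w i * size (G i)                    ≡⟨ cong (w i *_) (∑-subsets-suc (suc m) (ind ∘ G i)) ⟩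
    w i * (lo + hi′)                    ≡⟨ *-distribˡ-+ (w i) lo hi′ ⟩
    w i * lo + w i * hi′                ≤⟨ +-monoʳ-≤ (w i * lo) (≮⇒≥ ¬lt) ⟩
    w i * lo + Q * (m C⁻ k′)            ≡⟨ +-comm (w i * lo) _ ⟩
    Q * (m C⁻ k′) + w i * lo            ∎)
    where
    open ≤-Reasoning
    lo = size (G i ∘ (false ∷_))
    hi′ = size (G i ∘ (true ∷_))
  b : Fin (suc s) → Bool
  b = proj₁ ∘ choose
  rest : CrossMatching (λ i → G i ∘ (b i ∷_))
  rest = cross-matching m Q w (proj₁ ∘ proj₂ ∘ choose) (λ i → G i ∘ (b i ∷_)) (λ i → proj₁ (proj₂ (proj₂ (choose i)))) hw
    (λ i → proj₂ (proj₂ (proj₂ (choose i))))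

-- Counting the sets that avoid J

avoiding : ∀ {n} k (J : Subset n) → U k (λ A → ind (isEmpty (A ∩ J))) ≡ (n ∸ ∣ J ∣) C k
avoiding zero [] = refl
avoiding (suc k) [] = refl
avoiding {suc n} k (true ∷ J) = trans (∑-subsets-suc n _) (trans (cong₂ _+_ (avoiding k J)
  (trans (∑-cong (allSubsets n) λ A → *-zeroʳ (ind (suc ∣ A ∣ ≡ᵇ k))) (trans (∑-const (allSubsets n) 0) (*-zeroʳ (length (allSubsets n))))))
  (+-identityʳ _))
avoiding {suc n} zero (false ∷ J) = trans (∑-subsets-suc n _) (trans (cong₂ _+_ (avoiding zero J)
  (trans (∑-const (allSubsets n) 0) (*-zeroʳ (length (allSubsets n))))) refl)
avoiding {suc n} (suc k) (false ∷ J) = begin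
  U (suc k) (λ A → ind (isEmpty (A ∩ (false ∷ J))))
    ≡⟨ ∑-subsets-suc n _ ⟩
  U (suc k) (λ A → ind (isEmpty (A ∩ J))) + U k (λ A → ind (isEmpty (A ∩ J)))
    ≡⟨ cong₂ _+_ (avoiding (suc k) J) (avoiding k J) ⟩
  m C suc k + m C k
    ≡⟨ +-comm (m C suc k) _ ⟩
  m C k + m C suc k
    ≡⟨ nCk+nC[k+1]≡[n+1]C[k+1] m k ⟩
  suc m C suc k
    ≡⟨ cong (_C suc k) (+-∸-assoc 1 (∣p∣≤n J)) ⟨
  (suc n ∸ ∣ J ∣) C suc k ∎
  where
  open ≡-Reasoning
  m = n ∸ ∣ J ∣

card-S : ∀ n k (J : Subset n) → card (S n k J) + (n ∸ ∣ J ∣) C k ≡ n C k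
card-S n k J = begin
  card (S n k J) + (n ∸ ∣ J ∣) C k
    ≡⟨ cong₂ _+_ (card≡∑ (S n k J)) (sym (avoiding k J)) ⟩
  ∑ (allSubsets n) (ind ∘ S n k J) + U k (λ A → ind (isEmpty (A ∩ J)))
    ≡⟨ ∑-+ (allSubsets n) _ _ ⟨
  ∑[ A ← allSubsets n ] (ind (S n k J A) + ind (∣ A ∣ ≡ᵇ k) * ind (isEmpty (A ∩ J)))
    ≡⟨ ∑-cong (allSubsets n) (λ A → lem (∣ A ∣ ≡ᵇ k) (isEmpty (A ∩ J))) ⟩
  U {n} k (λ _ → 1)
    ≡⟨ U-1 n k ⟩
  n C k ∎
  where
  open ≡-Reasoning
  lem : ∀ a b → ind (a ∧ not b) + ind a * ind b ≡ ind a * 1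
  lem true true = refl
  lem true false = refl
  lem false b = refl

∣initSeg∣ : ∀ n t → t ≤ n → ∣ initSeg n t ∣ ≡ t
∣initSeg∣ zero zero _ = refl
∣initSeg∣ (suc n) zero _ = ∣initSeg∣ n zero z≤n
∣initSeg∣ (suc n) (suc t) (s≤s h) = cong suc (∣initSeg∣ n t h)

card-split : ∀ {n} (F G : Family n) → card F ≤ card (F ∖ G) + card G
card-split {n} F G rewrite card≡∑ F | card≡∑ (F ∖ G) | card≡∑ G = begin
  ∑ (allSubsets n) (ind ∘ F)
    ≤⟨ ∑-mono (allSubsets n) (λ A → lem (F A) (G A)) ⟩
  ∑[ A ← allSubsets n ] (ind ((F ∖ G) A) + ind (G A))
    ≡⟨ ∑-+ (allSubsets n) _ _ ⟩
  ∑ (allSubsets n) (ind ∘ (F ∖ G)) + ∑ (allSubsets n) (ind ∘ G) ∎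
  where
  open ≤-Reasoning
  lem : ∀ a b → ind a ≤ ind (a ∧ not b) + ind b
  lem true true = s≤s z≤n
  lem true false = s≤s z≤n
  lem false b = z≤n

C-monoˡ : ∀ a M k → M C k ≤ (M + a) C k
C-monoˡ zero M k = ≤-reflexive (cong (_C k) (sym (+-identityʳ M)))
C-monoˡ (suc a) M zero = ≤-refl
C-monoˡ (suc a) M (suc k) = begin
  M C suc k                           ≤⟨ C-monoˡ a M (suc k) ⟩
  (M + a) C suc k                     ≤⟨ m≤n+m _ ((M + a) C k) ⟩
  (M + a) C k + (M + a) C suc k       ≡⟨ nCk+nC[k+1]≡[n+1]C[k+1] (M + a) k ⟩
  suc (M + a) C suc k                 ≡⟨ cong (_C suc k) (+-suc M a) ⟨
  (M + suc a) C suc k                 ∎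
  where open ≤-Reasoning

C-growth-≥ : ∀ a M k → M C suc k + a * (M C k) ≤ (M + a) C suc k
C-growth-≥ zero M k = ≤-reflexive (trans (+-identityʳ _) (cong (_C suc k) (sym (+-identityʳ M))))
C-growth-≥ (suc a) M k = begin
  M C suc k + (M C k + a * (M C k))   ≡⟨ e (M C suc k) (M C k) (a * (M C k)) ⟩
  M C k + (M C suc k + a * (M C k))   ≤⟨ +-mono-≤ (C-monoˡ a M k) (C-growth-≥ a M k) ⟩
  (M + a) C k + (M + a) C suc k       ≡⟨ nCk+nC[k+1]≡[n+1]C[k+1] (M + a) k ⟩
  suc (M + a) C suc k                 ≡⟨ cong (_C suc k) (+-suc M a) ⟨
  (M + suc a) C suc k                 ∎
  where
  open ≤-Reasoning
  e : ∀ x y z → x + (y + z) ≡ y + (x + z)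
  e = solve-∀

C-growth-≤ : ∀ a M k → (M + suc a) C suc k ≤ M C suc k + suc a * ((M + a) C k)
C-growth-≤ a M k = begin
  (M + suc a) C suc k                         ≡⟨ cong (_C suc k) (+-suc M a) ⟩
  suc (M + a) C suc k                         ≡⟨ nCk+nC[k+1]≡[n+1]C[k+1] (M + a) k ⟨
  (M + a) C k + (M + a) C suc k               ≤⟨ +-monoʳ-≤ ((M + a) C k) (rest a) ⟩
  (M + a) C k + (M C suc k + a * ((M + a) C k)) ≡⟨ e ((M + a) C k) (M C suc k) (a * ((M + a) C k)) ⟩
  M C suc k + suc a * ((M + a) C k)           ∎
  where
  open ≤-Reasoning
  e : ∀ x y z → x + (y + z) ≡ y + (x + z)
  e = solve-∀
  rest : ∀ a → (M + a) C suc k ≤ M C suc k + a * ((M + a) C k)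
  rest zero rewrite +-identityʳ M = m≤m+n _ _
  rest (suc a) = ≤-trans (C-growth-≤ a M k) (+-monoʳ-≤ (M C suc k) (*-monoʳ-≤ (suc a)
    (≤-trans (C-monoˡ 1 (M + a) k) (≤-reflexive (cong (_C k) (trans (+-comm (M + a) 1) (sym (+-suc M a))))))))

-- Each of the a removed points lies in a fraction (k + 1) / (M + a) of the sets, so together they
-- meet at most 1 / c of them.
C-loss : ∀ c a M k → c * (a * suc k) ≤ M + a → c * ((M + a) C suc k) ≤ c * (M C suc k) + (M + a) C suc k
C-loss c zero M k h = ≤-trans (≤-reflexive (cong (λ z → c * (z C suc k)) (+-identityʳ M))) (m≤m+n _ _)
C-loss c (suc a) M k h = *-cancelˡ-≤ (suc m) (begin
  suc m * (c * N)
    ≤⟨ *-monoʳ-≤ (suc m) (*-monoʳ-≤ c (C-growth-≤ a M k)) ⟩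
  suc m * (c * (M C suc k + suc a * (m C k)))
    ≡⟨ e₁ (suc m) c (M C suc k) (suc a) (m C k) ⟩
  suc m * (c * (M C suc k)) + c * suc a * (suc m * (m C k))
    ≡⟨ cong (λ z → suc m * (c * (M C suc k)) + c * suc a * z) (sym (extract m k)) ⟩
  suc m * (c * (M C suc k)) + c * suc a * (suc k * (suc m C suc k))
    ≡⟨ cong (λ z → suc m * (c * (M C suc k)) + c * suc a * (suc k * (z C suc k))) (sym (+-suc M a)) ⟩
  suc m * (c * (M C suc k)) + c * suc a * (suc k * N)
    ≡⟨ cong (suc m * (c * (M C suc k)) +_) (e₂ c (suc a) (suc k) N) ⟩
  suc m * (c * (M C suc k)) + c * (suc a * suc k) * N
    ≤⟨ +-monoʳ-≤ (suc m * (c * (M C suc k))) (*-monoˡ-≤ N (≤-trans h (≤-reflexive (+-suc M a)))) ⟩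
  suc m * (c * (M C suc k)) + suc m * N
    ≡⟨ *-distribˡ-+ (suc m) (c * (M C suc k)) N ⟨
  suc m * (c * (M C suc k) + N) ∎)
  where
  open ≤-Reasoning
  m = M + a
  N = (M + suc a) C suc k
  e₁ : ∀ m c x a y → m * (c * (x + a * y)) ≡ m * (c * x) + c * a * (m * y)
  e₁ = solve-∀
  e₂ : ∀ c a k n → c * a * (k * n) ≡ c * (a * k) * n
  e₂ = solve-∀

-- `N` is the size of a star, `x` counts the (k - 1)-sets avoiding s - 1 points, `M` and `M′` the
-- k-sets avoiding s - 1 points and J, and `suc ρ` is r - 1. With Q = q + 1, a surplus of r - 1
-- stars minus a deficit of at most q / Q leaves (Q (r - 2) + 1) / Q ≥ (r - 1) / Q stars. Replacing
-- `N` by `x` costs at most an eighth of this, and 7 (r - 1) / 2 ≥ r.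
residual-arithmetic : ∀ q D c S₀ Sⱼ f res N x M M′ total ρ → S₀ + M ≡ total → Sⱼ + M′ ≡ total →
  f ≤ res + Sⱼ → M + suc ρ * x ≤ M′ → suc q * S₀ ≤ suc q * f + D * N → D ≤ q →
  c * N ≤ c * x + N → 8 * suc q ≤ c → suc (suc ρ) * N ≤ 4 * suc q * res
residual-arithmetic q D c S₀ Sⱼ f res N x M M′ total ρ e₀ eⱼ hf hM hyp D≤q loss 8Q≤c =
  *-cancelˡ-≤ 2 (begin
    2 * (suc (suc ρ) * N)      ≤⟨ ≤-from ((3 + 5 * ρ) * N) (g₁ ρ N) ⟩
    7 * r * N                  ≤⟨ *-cancelˡ-≤ c {{>-nonZero (≤-trans z<s 8Q≤c)}} (+-cancelʳ-≤ (c * r * N) _ _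
      (+-cancelʳ-≤ (8 * (q * c) * N) _ _ (begin
        c * (7 * r * N) + c * r * N + 8 * (q * c) * N
          ≤⟨ ≤-from (8 * (q * c) * ρ * N) (g₂ c ρ N q) ⟩
        8 * (Q * r) * (c * N)
          ≤⟨ *-monoʳ-≤ (8 * (Q * r)) loss ⟩
        8 * (Q * r) * (c * x + N)
          ≡⟨ g₃ Q r c x N ⟩
        8 * c * (Q * (r * x)) + 8 * Q * (r * N)
          ≤⟨ +-mono-≤ (*-monoʳ-≤ (8 * c) main) (*-monoˡ-≤ (r * N) 8Q≤c) ⟩
        8 * c * (Q * res + q * N) + c * (r * N)
          ≡⟨ g₄ c Q res q N r ⟩
        c * (8 * Q * res) + c * r * N + 8 * (q * c) * N ∎))) ⟩
    8 * Q * res                ≡⟨ g₅ Q res ⟩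
    2 * (4 * Q * res)          ∎)
  where
  open ≤-Reasoning
  Q = suc q
  r = suc ρ
  main : Q * (r * x) ≤ Q * res + q * N
  main = +-cancelˡ-≤ (Q * Sⱼ + Q * M) _ _ (begin
    Q * Sⱼ + Q * M + Q * (r * x)         ≡⟨ h₁ Q Sⱼ M (r * x) ⟩
    Q * Sⱼ + Q * (M + r * x)             ≤⟨ +-monoʳ-≤ (Q * Sⱼ) (*-monoʳ-≤ Q hM) ⟩
    Q * Sⱼ + Q * M′                      ≡⟨ trans (sym (*-distribˡ-+ Q Sⱼ M′)) (cong (Q *_) (trans eⱼ (sym e₀))) ⟩
    Q * (S₀ + M)                         ≡⟨ *-distribˡ-+ Q S₀ M ⟩
    Q * S₀ + Q * M                       ≤⟨ +-monoˡ-≤ (Q * M) hyp ⟩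
    Q * f + D * N + Q * M                ≤⟨ +-monoˡ-≤ (Q * M) (+-mono-≤ (*-monoʳ-≤ Q hf) (*-monoˡ-≤ N D≤q)) ⟩
    Q * (res + Sⱼ) + q * N + Q * M       ≡⟨ h₂ Q res Sⱼ (q * N) M ⟩
    Q * Sⱼ + Q * M + (Q * res + q * N)   ∎)
    where
    h₁ : ∀ q s m y → q * s + q * m + q * y ≡ q * s + q * (m + y)
    h₁ = solve-∀
    h₂ : ∀ q r s n m → q * (r + s) + n + q * m ≡ q * s + q * m + (q * r + n)
    h₂ = solve-∀
  g₁ : ∀ r n → 2 * ((2 + r) * n) + (3 + 5 * r) * n ≡ 7 * (1 + r) * n
  g₁ = solve-∀
  g₂ : ∀ c r n q → c * (7 * (1 + r) * n) + c * (1 + r) * n + 8 * (q * c) * n + 8 * (q * c) * r * n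
                   ≡ 8 * ((1 + q) * (1 + r)) * (c * n)
  g₂ = solve-∀
  g₃ : ∀ q r c x n → 8 * (q * r) * (c * x + n) ≡ 8 * c * (q * (r * x)) + 8 * q * (r * n)
  g₃ = solve-∀
  g₄ : ∀ c q s d n r → 8 * c * (q * s + d * n) + c * (r * n) ≡ c * (8 * q * s) + c * r * n + 8 * (d * c) * n
  g₄ = solve-∀
  g₅ : ∀ q s → 8 * q * s ≡ 2 * (4 * q * s)
  g₅ = solve-∀

residual-large : ∀ {n} p q c s r k (F : Family n) (J : Subset n) → 0 < p → p < q → 8 * q ≤ c → 2 ≤ k → c * s * k ≤ n →
  ∣ J ∣ + r ≡ s → 2 ≤ r →
  q * card (S n k (initSeg n (s ∸ 1))) ≤ q * card F + (q ∸ p) * ((n ∸ 1) C (k ∸ 1)) →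
  r * ((n ∸ 1) C (k ∸ 1)) ≤ 4 * q * card (F ∖ S n k J)
residual-large {n} (suc p) (suc q) c .(∣ J ∣ + r) r@(suc (suc ρ)) k@(suc (suc κ)) F J _ _ 8q≤c (s≤s (s≤s _)) csk≤n refl (s≤s (s≤s _)) hyp =
  residual-arithmetic q (q ∸ p) c (card (S n k (initSeg n (∣ J ∣ + r ∸ 1)))) (card (S n k J)) (card F) (card (F ∖ S n k J))
    ((n ∸ 1) C suc κ) (M C suc κ) (M C k) ((M + suc ρ) C k) (n C k) ρ
    (trans (cong (λ z → card (S n k (initSeg n (∣ J ∣ + r ∸ 1))) + (n ∸ z) C k) (trans (sym s∸1) (sym (∣initSeg∣ n _ (≤-trans (≤-reflexive s∸1) a<n)))))
      (card-S n k (initSeg n (∣ J ∣ + r ∸ 1))))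
    (trans (cong (λ z → card (S n k J) + z C k) (sym n∸J)) (card-S n k J))
    (card-split F (S n k J))
    (C-growth-≥ (suc ρ) M (suc κ))
    hyp (m∸n≤m q p)
    (subst (λ z → c * (z C suc κ) ≤ c * (M C suc κ) + z C suc κ) (sym n∸1) (C-loss c a M κ small)) 8q≤c
  where
  open ≤-Reasoning
  -- This is s - 2, so `M` counts the points outside the initial segment of length s - 1, and n - 1
  -- is `M + a`.
  a = ∣ J ∣ + ρ
  M = n ∸ suc a
  s∸1 : ∣ J ∣ + r ∸ 1 ≡ suc a
  s∸1 = cong (_∸ 1) (trans (+-suc ∣ J ∣ (suc ρ)) (cong suc (+-suc ∣ J ∣ ρ)))
  small′ : suc (c * (a * suc κ)) ≤ n
  small′ = begin
    1 + c * (a * suc κ)                       ≤⟨ +-monoˡ-≤ (c * (a * suc κ)) (≤-trans (s≤s z≤n) 8q≤c) ⟩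
    c + c * (a * suc κ)                       ≤⟨ ≤-from _ (e c ∣ J ∣ ρ κ) ⟩
    c * (∣ J ∣ + r) * k                       ≤⟨ csk≤n ⟩
    n                                         ∎
    where
    e : ∀ c j r k → c + c * ((j + r) * (1 + k)) + (c * (j + r) + c * (3 + 2 * k)) ≡ c * (j + (2 + r)) * (2 + k)
    e = solve-∀
  a<n : suc a ≤ n
  a<n = ≤-trans (s≤s (≤-trans (m≤m*n a (suc κ)) (m≤n*m _ c {{>-nonZero (≤-trans (s≤s z≤n) 8q≤c)}}))) small′
  n≡ : M + suc a ≡ n
  n≡ = m∸n+n≡m a<n
  n∸1 : n ∸ 1 ≡ M + a
  n∸1 = cong (_∸ 1) (trans (sym n≡) (+-suc M a))
  small : c * (a * suc κ) ≤ M + a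
  small = s≤s⁻¹ (≤-trans small′ (≤-reflexive (trans (sym n≡) (+-suc M a))))
  n∸J : n ∸ ∣ J ∣ ≡ M + suc ρ
  n∸J = trans (cong (_∸ ∣ J ∣) (trans (sym n≡) (f M ∣ J ∣ ρ))) (m+n∸n≡m (M + suc ρ) ∣ J ∣)
    where
    f : ∀ m j r → m + (1 + (j + r)) ≡ m + (1 + r) + j
    f = solve-∀

-- Families at the scale of one uniformity k

does⁻ : ∀ {P : Set} (P? : Dec P) → does P? ≡ true → P
does⁻ (yes p) _ = p

above? : ∀ {n} (G : Family n) B → Dec (∃ λ A → G A ≡ true × A ⊆ B)
above? G B = anySubset? λ A → (G A ≟ᵇ true) ×-dec (A ⊆? B)

up : ∀ {n} → Family n → Family n
up G B = does (above? G B)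

up⁺ : ∀ {n} (G : Family n) {A B} → G A ≡ true → A ⊆ B → up G B ≡ true
up⁺ G {A} {B} GA A⊆B = dec-true (above? G B) (A , GA , A⊆B)

up⁻ : ∀ {n} (G : Family n) {B} → up G B ≡ true → ∃ λ A → G A ≡ true × A ⊆ B
up⁻ G {B} = does⁻ (above? G B)

up-mono : ∀ {n} (G : Family n) {B B′} → B ⊆ B′ → up G B ≡ true → up G B′ ≡ true
up-mono G B⊆B′ h with _ , GA , A⊆B ← up⁻ G h = up⁺ G GA (B⊆B′ ∘ A⊆B)

∈-addAll⁻ : ∀ {n} (w : List (Fin n)) {A z} → z ∈ addAll w A → z List.∈ w ⊎ z ∈ A
∈-addAll⁻ [] p = inj₂ p
∈-addAll⁻ (x ∷ w) p with ∈-addAll⁻ w p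
... | inj₁ q = inj₁ (Any.there q)
... | inj₂ q with ∈-add⁻ x q
...   | inj₁ refl = inj₁ (Any.here refl)
...   | inj₂ r = inj₂ r

⊆-addAll : ∀ {n} (w : List (Fin n)) {A} → A ⊆ addAll w A
⊆-addAll [] p = p
⊆-addAll (x ∷ w) p = ⊆-addAll w (∈-add⁺ x p)

∈-addAll⁺ : ∀ {n} (w : List (Fin n)) {A z} → z List.∈ w → z ∈ addAll w A
∈-addAll⁺ (x ∷ w) (Any.here refl) = ⊆-addAll w (∈-add-self x _)
∈-addAll⁺ (x ∷ w) (Any.there p) = ∈-addAll⁺ w p

spells : ∀ {n} → Family n → List (Fin n) → Bool
spells G w = up G (addAll w ⊥)

spells-mono : ∀ {n} (G : Family n) → Mono (spells G)
spells-mono G {u} {v} u⊑v = up-mono G λ p → letters (∈-addAll⁻ u p)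
  where
  letters : ∀ {z} → z List.∈ u ⊎ z ∈ ⊥ → z ∈ addAll v ⊥
  letters (inj₁ q) = ∈-addAll⁺ v (u⊑v q)
  letters (inj₂ q) = contradiction q ∉⊥

addAll-add-⊆ : ∀ {n} (w : List (Fin n)) j → addAll (j ∷ w) ⊥ ⊆ add j (addAll w ⊥)
addAll-add-⊆ w j p with ∈-addAll⁻ w p
... | inj₁ q = ∈-add⁺ j (∈-addAll⁺ w q)
... | inj₂ q with ∈-add⁻ j q
...   | inj₁ refl = ∈-add-self j _
...   | inj₂ r = contradiction r ∉⊥

add-addAll-⊆ : ∀ {n} (w : List (Fin n)) j → add j (addAll w ⊥) ⊆ addAll (j ∷ w) ⊥
add-addAll-⊆ w j p with ∈-add⁻ j p
... | inj₁ refl = ⊆-addAll w (∈-add-self j ⊥)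
... | inj₂ q with ∈-addAll⁻ w q
...   | inj₁ r = ∈-addAll⁺ w r
...   | inj₂ r = contradiction r ∉⊥

hit-bound : ∀ {X : Set} (xs : List X) (b : X → Bool) ℓ →
  length xs * ∑ (seqs xs ℓ) (ind ∘ any b) ≤ ℓ * ∑ xs (ind ∘ b) * length xs ^ ℓ
hit-bound xs b zero = ≤-reflexive (*-zeroʳ (length xs))
hit-bound xs b (suc ℓ) = begin
  n * ∑ (seqs xs (suc ℓ)) (ind ∘ any b)
    ≡⟨ cong (n *_) (∑-seqs-suc xs ℓ _) ⟩
  n * (∑[ x ← xs ] ∑[ w ← seqs xs ℓ ] ind (any b (x ∷ w)))
    ≤⟨ *-monoʳ-≤ n (∑-mono xs λ x → ∑-mono (seqs xs ℓ) λ w → either x w) ⟩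
  n * (∑[ x ← xs ] ∑[ w ← seqs xs ℓ ] (ind (b x) + ind (any b w)))
    ≡⟨ cong (n *_) (trans (∑-cong xs λ x → trans (∑-+ (seqs xs ℓ) _ _) (cong (_+ H)
         (trans (∑-const (seqs xs ℓ) _) (trans (cong (_* ind (b x)) (length-seqs xs ℓ)) (*-comm (n ^ ℓ) _)))))
         (trans (∑-+ xs _ _) (cong₂ _+_ (∑-*ʳ xs (n ^ ℓ) _) (∑-const xs H)))) ⟩
  n * (t * n ^ ℓ + n * H)
    ≤⟨ *-monoʳ-≤ n (+-monoʳ-≤ (t * n ^ ℓ) (hit-bound xs b ℓ)) ⟩
  n * (t * n ^ ℓ + ℓ * t * n ^ ℓ)
    ≡⟨ e n t (n ^ ℓ) ℓ ⟩
  suc ℓ * t * n ^ suc ℓ ∎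
  where
  open ≤-Reasoning
  n = length xs
  t = ∑ xs (ind ∘ b)
  H = ∑ (seqs xs ℓ) (ind ∘ any b)
  either : ∀ x w → ind (any b (x ∷ w)) ≤ ind (b x) + ind (any b w)
  either x w with b x
  ... | true = s≤s z≤n
  ... | false = ≤-refl
  e : ∀ n t p l → n * (t * p + l * t * p) ≡ (1 + l) * t * (n * p)
  e = solve-∀

any-false : ∀ {X : Set} (b : X → Bool) w {x} → any b w ≡ false → x List.∈ w → b x ≡ false
any-false b (y ∷ w) h (Any.here refl) with b y
... | false = refl
any-false b (y ∷ w) h (Any.there p) with b y
... | false = any-false b w h p

C-positive : ∀ {n k} → k ≤ n → 0 < n C k
C-positive {n} {k} k≤n = subst (λ z → 0 < z C k) (m+[n∸m]≡n k≤n)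
  (≤-trans (≤-reflexive (sym (nCn≡1 k))) (C-monoˡ (n ∸ k) k k))

double-between : ∀ m → ∃ λ e → m ≤ dbl e × dbl e ≤ 2 * m + 1
double-between zero = 0 , z≤n , ≤-refl
double-between (suc m) with double-between m
... | e , lo , hi with m≤n⇒m<n∨m≡n lo
...   | inj₁ m<d = e , m<d , ≤-trans hi (+-monoˡ-≤ 1 (*-monoʳ-≤ 2 (n≤1+n m)))
...   | inj₂ refl = suc e , +-monoˡ-≤ (dbl e) (dbl>0 e) , ≤-from 3 (lem (dbl e))
  where
  lem : ∀ d → d + d + 3 ≡ 2 * (1 + d) + 1
  lem = solve-∀

-- The sampling length ℓ, a power of two of order k, and the boosted length `Λ` vary with k, while
-- κ, q and K are common to all families. The factor 40 q in K cancels the loss of `words-dense`, so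
-- `Dichotomy` runs with slope κ r; `room` keeps s Λ a small fraction of n.
module Scale (m n q κ s k k₁ K e Bm : ℕ) (n≡ : n ≡ suc m) (k≡ : k ≡ suc k₁) (K≡ : K ≡ κ * (40 * q))
  (Bm≡ : Bm ≡ 3 * (K * K * K) * dbl e) (2k≤ℓ : 2 * k ≤ dbl e) (ℓ≤4k+1 : dbl e ≤ 2 * (2 * k) + 1)
  (k₁>0 : 0 < k₁) (q>0 : 0 < q) (s>0 : 0 < s) (κ-large : 2048 ≤ κ)
  (room : 60 * κ * (K * K * K) * (s * k) ≤ n) where

  ℓ = dbl e
  N₁ = m C k₁

  Λ : ℕ
  Λ = Bm + Bm

  open Words (allFin n) n (length-allFin n) public
    using (cnt; cnt-mono; cnt-pad; cnt-amplify)

  private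
    κ>0 : 0 < κ
    κ>0 = ≤-trans (s≤s z≤n) κ-large

    instance
      n≢0 : NonZero n
      n≢0 = subst NonZero (sym n≡) _

    K≥κ : κ ≤ K
    K≥κ = ≤-trans (m≤m*n κ (40 * q) {{m*n≢0 40 q {{_}} {{>-nonZero q>0}}}}) (≤-reflexive (sym K≡))

    K>0 : 0 < K
    K>0 = ≤-trans κ>0 K≥κ

    K³>0 : 0 < K * K * K
    K³>0 = *-mono-≤ (*-mono-≤ K>0 K>0) K>0

    k>0 : 0 < k
    k>0 = ≤-trans (s≤s z≤n) (≤-reflexive (sym k≡))

    ℓ≤5k : ℓ ≤ 5 * k
    ℓ≤5k = begin
      ℓ                ≤⟨ ℓ≤4k+1 ⟩
      2 * (2 * k) + 1  ≤⟨ +-monoʳ-≤ (2 * (2 * k)) k>0 ⟩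
      2 * (2 * k) + k  ≡⟨ lem k ⟩
      5 * k            ∎
      where
      open ≤-Reasoning
      lem : ∀ k → 2 * (2 * k) + k ≡ 5 * k
      lem = solve-∀

  12sΛ≤n : 12 * s * Λ ≤ n
  12sΛ≤n = begin
    12 * s * Λ                         ≡⟨ cong (λ z → 12 * s * (z + z)) Bm≡ ⟩
    12 * s * (3 * (K * K * K) * ℓ + 3 * (K * K * K) * ℓ) ≡⟨ e₁ s (K * K * K) ℓ ⟩
    72 * (K * K * K) * s * ℓ           ≤⟨ *-monoʳ-≤ (72 * (K * K * K) * s) ℓ≤5k ⟩
    72 * (K * K * K) * s * (5 * k)     ≡⟨ e₂ (K * K * K) s k ⟩
    6 * (60 * (K * K * K) * (s * k))   ≤⟨ *-monoˡ-≤ (60 * (K * K * K) * (s * k)) (≤-trans (≤-from {6} 2042 refl) κ-large) ⟩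
    κ * (60 * (K * K * K) * (s * k))   ≡⟨ e₃ κ (K * K * K) (s * k) ⟩
    60 * κ * (K * K * K) * (s * k)     ≤⟨ room ⟩
    n                                  ∎
    where
    open ≤-Reasoning
    e₁ : ∀ s c l → 12 * s * (3 * c * l + 3 * c * l) ≡ 72 * c * s * l
    e₁ = solve-∀
    e₂ : ∀ c s k → 72 * c * s * (5 * k) ≡ 6 * (60 * c * (s * k))
    e₂ = solve-∀
    e₃ : ∀ κ c t → κ * (60 * c * t) ≡ 60 * κ * c * t
    e₃ = solve-∀

  private
    Λ≤n : Λ ≤ n
    Λ≤n = ≤-trans (m≤n*m Λ (12 * s) {{m*n≢0 12 s {{_}} {{>-nonZero s>0}}}}) 12sΛ≤n

    ℓ≤Bm : ℓ ≤ Bm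
    ℓ≤Bm = subst (ℓ ≤_) (sym Bm≡) (m≤n*m ℓ (3 * (K * K * K)) {{m*n≢0 3 (K * K * K) {{_}} {{>-nonZero K³>0}}}})

    ℓ≤Λ : ℓ ≤ Λ
    ℓ≤Λ = ≤-trans ℓ≤Bm (m≤m+n Bm Bm)

    8k≤n : 8 * k ≤ n
    8k≤n = begin
      8 * k           ≡⟨ *-assoc 4 2 k ⟩
      4 * (2 * k)     ≤⟨ *-mono-≤ (≤-trans (≤-from {4} 8 refl) (m≤m*n 12 s {{>-nonZero s>0}})) (≤-trans 2k≤ℓ ℓ≤Λ) ⟩
      12 * s * Λ      ≤⟨ 12sΛ≤n ⟩
      n               ∎
      where open ≤-Reasoning

    k≤n : k ≤ n
    k≤n = ≤-trans (m≤n*m k 8) 8k≤n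

    Λ>0 : 0 < Λ
    Λ>0 = ≤-trans (dbl>0 e) ℓ≤Λ

    instance
      n^Λ≢0 : NonZero (n ^ Λ)
      n^Λ≢0 = m^n≢0 n Λ

    N₁>0 : 0 < N₁
    N₁>0 = C-positive (s≤s⁻¹ (≤-trans (≤-reflexive (sym k≡)) (≤-trans k≤n (≤-reflexive n≡))))

    extract′ : ∀ j → suc j * (n C suc j) ≡ n * (m C j)
    extract′ j = subst (λ z → suc j * (z C suc j) ≡ z * (m C j)) (sym n≡) (extract m j)

    k*C : k * (n C k) ≡ n * N₁
    k*C = subst (λ z → z * (n C z) ≡ n * N₁) (sym k≡) (extract′ k₁)

    size≤U : (G : Family n) → Uniform k G → size G ≤ U k (ind ∘ up G)
    size≤U G u = ∑-mono (allSubsets n) pointwise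
      where
      pointwise : ∀ A → ind (G A) ≤ ind (∣ A ∣ ≡ᵇ k) * ind (up G A)
      pointwise A with G A in GA
      ... | false = z≤n
      ... | true rewrite u A GA | ≡ᵇ-refl k | up⁺ G GA (λ p → p) = ≤-refl

    -- Since r `N₁` sets have density r k / n, the factor 40 is 4 · 2 · 5: the hypothesis, the
    -- passage to words of length 2k, and padding to ℓ ≤ 5k letters.
    words-dense : ∀ r (G : Family n) → Uniform k G → r * N₁ ≤ 4 * q * size G →
      r * ℓ * n ^ ℓ ≤ 40 * q * n * cnt ℓ (spells G)
    words-dense r G u h = begin
      r * ℓ * n ^ ℓ                           ≤⟨ *-monoˡ-≤ (n ^ ℓ) (*-monoʳ-≤ r ℓ≤5k) ⟩
      r * (5 * k) * n ^ ℓ                     ≡⟨ cong (r * (5 * k) *_) (trans (cong (n ^_) (sym 2k+p)) (^-distribˡ-+-* n (k + k) p)) ⟩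
      r * (5 * k) * (t * n ^ p)               ≡⟨ e₁ r k t (n ^ p) ⟩
      5 * (r * k * t) * n ^ p                 ≤⟨ *-monoˡ-≤ (n ^ p) (*-monoʳ-≤ 5 at-2k) ⟩
      5 * (8 * q * n * c) * n ^ p             ≡⟨ e₂ q n c (n ^ p) ⟩
      40 * q * n * (c * n ^ p)                ≤⟨ *-monoʳ-≤ (40 * q * n) (cnt-pad (spells-mono G) (k + k) p) ⟩
      40 * q * n * cnt (k + k + p) (spells G) ≡⟨ cong (λ z → 40 * q * n * cnt z (spells G)) 2k+p ⟩
      40 * q * n * cnt ℓ (spells G)           ∎
      where
      open ≤-Reasoning
      open Levels (ind ∘ up G) (λ A⊆B → ind-mono (up-mono G A⊆B))
      p = ℓ ∸ (k + k)
      2k+p : k + k + p ≡ ℓ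
      2k+p = m+[n∸m]≡n (≤-trans (≤-reflexive (cong (k +_) (sym (+-identityʳ k)))) 2k≤ℓ)
      t = n ^ (k + k)
      c = cnt (k + k) (spells G)
      at-2k : r * k * t ≤ 8 * q * n * c
      at-2k = *-cancelʳ-≤ _ _ (n C k) {{>-nonZero (C-positive k≤n)}} (begin
        r * k * t * (n C k)                   ≡⟨ f₁ r k t (n C k) ⟩
        r * t * (k * (n C k))                 ≡⟨ cong (r * t *_) k*C ⟩
        r * t * (n * N₁)                      ≡⟨ f₂ r t n N₁ ⟩
        n * t * (r * N₁)                      ≤⟨ *-monoʳ-≤ (n * t) (≤-trans h (*-monoʳ-≤ (4 * q) (size≤U G u))) ⟩
        n * t * (4 * q * U k (ind ∘ up G))    ≡⟨ f₃ n t q (U k (ind ∘ up G)) ⟩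
        4 * q * n * (U k (ind ∘ up G) * t)    ≤⟨ *-monoʳ-≤ (4 * q * n) (level≤words k k>0 8k≤n) ⟩
        4 * q * n * (2 * (n C k) * c)         ≡⟨ f₄ q n (n C k) c ⟩
        8 * q * n * c * (n C k)               ∎)
        where
        f₁ : ∀ r k t c → r * k * t * c ≡ r * t * (k * c)
        f₁ = solve-∀
        f₂ : ∀ r t n a → r * t * (n * a) ≡ n * t * (r * a)
        f₂ = solve-∀
        f₃ : ∀ n t q u → n * t * (4 * q * u) ≡ 4 * q * n * (u * t)
        f₃ = solve-∀
        f₄ : ∀ q n b c → 4 * q * n * (2 * b * c) ≡ 8 * q * n * c * b
        f₄ = solve-∀
      e₁ : ∀ r k t p → r * (5 * k) * (t * p) ≡ 5 * (r * k * t) * p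
      e₁ = solve-∀
      e₂ : ∀ q n c p → 5 * (8 * q * n * c) * p ≡ 40 * q * n * (c * p)
      e₂ = solve-∀

  -- The threshold is 1/2, below the 3/4 of the dichotomy, because `heavy-from-link` guarantees 1/2.
  Heavy : Family n → Fin n → Set
  Heavy G j = n ^ Λ ≤ 2 * cnt Λ (spells G ∘ (j ∷_))

  heavy-mono : ∀ {G G′ : Family n} {j} → (∀ A → G A ≡ true → G′ A ≡ true) → Heavy G j → Heavy G′ j
  heavy-mono {G} {G′} {j} G≤G′ h = ≤-trans h (*-monoʳ-≤ 2 (cnt-mono Λ {spells G ∘ (j ∷_)} λ w sw →
    let _ , GA , A⊆ = up⁻ G sw in up⁺ G′ (G≤G′ _ GA) A⊆))

  dichotomy-family : ∀ r (G : Family n) → Uniform k G → 0 < r → r ≤ s → r * N₁ ≤ 4 * q * size G →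
    (∃ λ j → 3 * n ^ Λ ≤ 4 * cnt Λ (spells G ∘ (j ∷_))) ⊎ 6 * r * Λ * n ^ Λ ≤ n * cnt Λ (spells G)
  dichotomy-family r G u r>0 r≤s h = map₂ rescale
    (D.dichotomy e K (≤-trans (≤-from {42} 2006 refl) (≤-trans κ-large K≥κ)) (≤-reflexive (sym Bm≡)) mass)
    where
    open ≤-Reasoning
    small : κ * r * Bm ≤ 64 * n
    small = begin
      κ * r * Bm                                ≤⟨ *-monoˡ-≤ Bm (*-monoʳ-≤ κ r≤s) ⟩
      κ * s * Bm                                ≡⟨ cong (κ * s *_) Bm≡ ⟩
      κ * s * (3 * (K * K * K) * ℓ)             ≤⟨ *-monoʳ-≤ (κ * s) (*-monoʳ-≤ (3 * (K * K * K)) ℓ≤5k) ⟩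
      κ * s * (3 * (K * K * K) * (5 * k))       ≤⟨ ≤-from _ (e₁ κ s (K * K * K) k) ⟩
      60 * κ * (K * K * K) * (s * k)            ≤⟨ room ⟩
      n                                         ≤⟨ m≤n*m n 64 ⟩
      64 * n                                    ∎
      where
      e₁ : ∀ κ s c k → κ * s * (3 * c * (5 * k)) + 45 * κ * s * c * k ≡ 60 * κ * c * (s * k)
      e₁ = solve-∀
    mass : κ * r * ℓ * n ^ ℓ ≤ K * n * cnt ℓ (spells G)
    mass = begin
      κ * r * ℓ * n ^ ℓ                         ≡⟨ e₁ κ r ℓ (n ^ ℓ) ⟩
      κ * (r * ℓ * n ^ ℓ)                       ≤⟨ *-monoʳ-≤ κ (words-dense r G u h) ⟩
      κ * (40 * q * n * cnt ℓ (spells G))       ≡⟨ e₂ κ q n (cnt ℓ (spells G)) ⟩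
      κ * (40 * q) * n * cnt ℓ (spells G)       ≡⟨ cong (λ z → z * n * cnt ℓ (spells G)) K≡ ⟨
      K * n * cnt ℓ (spells G)                  ∎
      where
      e₁ : ∀ κ r l t → κ * r * l * t ≡ κ * (r * l * t)
      e₁ = solve-∀
      e₂ : ∀ κ q n c → κ * (40 * q * n * c) ≡ κ * (40 * q) * n * c
      e₂ = solve-∀
    module D = Dichotomy (allFin n) n (length-allFin n) (spells G) (spells-mono G) (κ * r) Bm (*-mono-≤ κ>0 r>0) small
    -- Origin of 2048: with κ of this size, 3 κ r Bm / 512 is at least 12 r Bm, which is 6 r Λ.
    rescale : 3 * (κ * r * Bm) * n ^ Λ ≤ 512 * n * cnt Λ (spells G) → 6 * r * Λ * n ^ Λ ≤ n * cnt Λ (spells G)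
    rescale dense = *-cancelˡ-≤ 512 (begin
      512 * (6 * r * Λ * n ^ Λ)         ≡⟨ e₁ r Bm (n ^ Λ) ⟩
      2048 * (3 * r * Bm * n ^ Λ)       ≤⟨ *-monoˡ-≤ (3 * r * Bm * n ^ Λ) κ-large ⟩
      κ * (3 * r * Bm * n ^ Λ)          ≡⟨ e₂ κ r Bm (n ^ Λ) ⟩
      3 * (κ * r * Bm) * n ^ Λ          ≤⟨ dense ⟩
      512 * n * cnt Λ (spells G)        ≡⟨ *-assoc 512 n (cnt Λ (spells G)) ⟩
      512 * (n * cnt Λ (spells G))      ∎)
      where
      e₁ : ∀ r b t → 512 * (6 * r * (b + b) * t) ≡ 2048 * (3 * r * b * t)
      e₁ = solve-∀
      e₂ : ∀ κ r b t → κ * (3 * r * b * t) ≡ 3 * (κ * r * b) * t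
      e₂ = solve-∀

  -- If the dichotomy yields a letter, it lies in J. The members avoid J, so this letter does not
  -- help and the other Λ letters alone are good with probability 3/4, more than 6 r Λ / n ≤ 1/2.
  residual-dense : ∀ r (G : Family n) (J : Subset n) → Uniform k G → 0 < r → r ≤ s → r * N₁ ≤ 4 * q * size G →
    (∀ A → G A ≡ true → Disjoint A J) → (∀ j → j ∉ J → ¬ Heavy G j) →
    6 * r * Λ * n ^ Λ ≤ n * cnt Λ (spells G)
  residual-dense r G J u r>0 r≤s h avoids light = [ heavy-case , (λ dense → dense) ]′ (dichotomy-family r G u r>0 r≤s h)
    where
    open ≤-Reasoning
    e₁ : ∀ r l t → 4 * (6 * r * l * t) ≡ 2 * (12 * r * l) * t
    e₁ = solve-∀
    e₂ : ∀ n t → 2 * n * t + n * t ≡ n * (3 * t)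
    e₂ = solve-∀
    e₃ : ∀ n c → n * (4 * c) ≡ 4 * (n * c)
    e₃ = solve-∀
    e₄ : ∀ c → 4 * c ≡ 2 * (2 * c)
    e₄ = solve-∀
    useless : ∀ {j} → j ∈ J → ∀ w → spells G (j ∷ w) ≡ true → spells G w ≡ true
    useless {j} j∈J w sw with up⁻ G sw
    ... | A , GA , A⊆ = up⁺ G GA λ z∈A → keep z∈A (∈-add⁻ j (addAll-add-⊆ w j (A⊆ z∈A)))
      where
      keep : ∀ {z} → z ∈ A → z ≡ j ⊎ z ∈ addAll w ⊥ → z ∈ addAll w ⊥
      keep z∈A (inj₁ refl) = contradiction j∈J (avoids A GA z∈A)
      keep z∈A (inj₂ p) = p
    heavy-case : (∃ λ j → 3 * n ^ Λ ≤ 4 * cnt Λ (spells G ∘ (j ∷_))) → 6 * r * Λ * n ^ Λ ≤ n * cnt Λ (spells G)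
    heavy-case (j , hj) = dec-case (j ∈? J)
      where
      dec-case : Dec (j ∈ J) → 6 * r * Λ * n ^ Λ ≤ n * cnt Λ (spells G)
      dec-case (no j∉J) = contradiction (*-cancelˡ-≤ 2 (begin
        2 * n ^ Λ                               ≤⟨ *-monoˡ-≤ (n ^ Λ) (n≤1+n 2) ⟩
        3 * n ^ Λ                               ≤⟨ hj ⟩
        4 * cnt Λ (spells G ∘ (j ∷_))           ≡⟨ e₄ (cnt Λ (spells G ∘ (j ∷_))) ⟩
        2 * (2 * cnt Λ (spells G ∘ (j ∷_)))     ∎)) (light j j∉J)
      dec-case (yes j∈J) = *-cancelˡ-≤ 4 (begin
        4 * (6 * r * Λ * n ^ Λ)                 ≡⟨ e₁ r Λ (n ^ Λ) ⟩
        2 * (12 * r * Λ) * n ^ Λ                ≤⟨ *-monoˡ-≤ (n ^ Λ) (*-monoʳ-≤ 2 (≤-trans (*-monoˡ-≤ Λ (*-monoʳ-≤ 12 r≤s)) 12sΛ≤n)) ⟩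
        2 * n * n ^ Λ                           ≤⟨ ≤-from (n * n ^ Λ) (e₂ n (n ^ Λ)) ⟩
        n * (3 * n ^ Λ)                         ≤⟨ *-monoʳ-≤ n hj ⟩
        n * (4 * cnt Λ (spells G ∘ (j ∷_)))     ≤⟨ *-monoʳ-≤ n (*-monoʳ-≤ 4 (cnt-mono Λ {spells G ∘ (j ∷_)} (useless j∈J))) ⟩
        n * (4 * cnt Λ (spells G))              ≡⟨ e₃ n (cnt Λ (spells G)) ⟩
        4 * (n * cnt Λ (spells G))              ∎)

  link-size : Family n → Fin n → ℕ
  link-size F j = ∑[ A ← allSubsets n ] (ind (lookup A j) * ind (F A))

  -- The link has density at least 1 / (8 q) among all (k - 1)-sets, so words of length 2 (k - 1)
  -- complete j with probability at least 1 / (16 q), and 16 q independent blocks do so with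
  -- probability at least 1/2.
  heavy-from-link : ∀ (F : Family n) j → Uniform k F → N₁ ≤ 4 * q * link-size F j → Heavy F j
  heavy-from-link F j u h = begin
    n ^ Λ                                      ≡⟨ trans (cong (n ^_) (sym Nl+p)) (^-distribˡ-+-* n (N * l) p) ⟩
    n ^ (N * l) * n ^ p                        ≤⟨ *-monoˡ-≤ (n ^ p) amplified ⟩
    2 * cnt (N * l) P * n ^ p                  ≡⟨ *-assoc 2 (cnt (N * l) P) (n ^ p) ⟩
    2 * (cnt (N * l) P * n ^ p)                ≤⟨ *-monoʳ-≤ 2 (cnt-pad mP (N * l) p) ⟩
    2 * cnt (N * l + p) P                      ≡⟨ cong (λ z → 2 * cnt z P) Nl+p ⟩
    2 * cnt Λ P                                ∎
    where
    open ≤-Reasoning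
    P = spells F ∘ (j ∷_)
    mP : Mono P
    mP = Mono-++ (j ∷ []) (spells-mono F)
    g : Subset n → ℕ
    g B = ind (up F (add j B))
    open Levels g (λ A⊆B → ind-mono (up-mono F (add-⊆ j A⊆B)))
    l = k₁ + k₁
    N = 16 * q
    k₁≤k : k₁ ≤ k
    k₁≤k = ≤-trans (n≤1+n k₁) (≤-reflexive (sym k≡))
    Nl≤Λ : N * l ≤ Λ
    Nl≤Λ = begin
      16 * q * (k₁ + k₁)              ≤⟨ *-mono-≤ N≤K³ (≤-trans (+-mono-≤ k₁≤k k₁≤k) (≤-trans (≤-reflexive (cong (k +_) (sym (+-identityʳ k)))) 2k≤ℓ)) ⟩
      3 * (K * K * K) * ℓ             ≡⟨ Bm≡ ⟨
      Bm                              ≤⟨ m≤m+n Bm Bm ⟩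
      Λ                               ∎
      where
      N≤K³ : 16 * q ≤ 3 * (K * K * K)
      N≤K³ = begin
        16 * q          ≤⟨ *-monoˡ-≤ q (≤-from {16} 24 refl) ⟩
        40 * q          ≤⟨ m≤n*m (40 * q) κ {{>-nonZero κ>0}} ⟩
        κ * (40 * q)    ≡⟨ K≡ ⟨
        K               ≤⟨ m≤n*m K (K * K) {{m*n≢0 K K {{>-nonZero K>0}} {{>-nonZero K>0}}}} ⟩
        K * K * K       ≤⟨ m≤n*m (K * K * K) 3 ⟩
        3 * (K * K * K) ∎
    p = Λ ∸ N * l
    Nl+p : N * l + p ≡ Λ
    Nl+p = m+[n∸m]≡n Nl≤Λ
    link≤U : link-size F j ≤ U k₁ g
    link≤U = ≤-trans (≤-reflexive (sym (∑-add j (ind ∘ F)))) (∑-mono (allSubsets n) pointwise)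
      where
      pointwise : ∀ B → ind (not (lookup B j)) * ind (F (add j B)) ≤ ind (∣ B ∣ ≡ᵇ k₁) * g B
      pointwise B with lookup B j in lk | F (add j B) in FB
      ... | true | _ = z≤n
      ... | false | false = z≤n
      ... | false | true rewrite suc-injective (trans (sym (∣add∣ j B lk)) (trans (u (add j B) FB) k≡)) | ≡ᵇ-refl k₁
                               | up⁺ F FB (λ p → p) = ≤-refl
    C≤2N₁ : n C k₁ ≤ 2 * N₁
    C≤2N₁ = *-cancelˡ-≤ (n ∸ k₁) {{>-nonZero (m<n⇒0<n∸m (≤-trans (≤-reflexive (sym k≡)) k≤n))}} (begin
      (n ∸ k₁) * (n C k₁)                ≡⟨ absorb n k₁ ⟩
      suc k₁ * (n C suc k₁)              ≡⟨ extract′ k₁ ⟩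
      n * N₁                             ≤⟨ *-monoˡ-≤ N₁ n≤ ⟩
      ((n ∸ k₁) + (n ∸ k₁)) * N₁         ≡⟨ e₁ (n ∸ k₁) N₁ ⟩
      (n ∸ k₁) * (2 * N₁)                ∎)
      where
      e₁ : ∀ a b → (a + a) * b ≡ a * (2 * b)
      e₁ = solve-∀
      k₁≤n : k₁ ≤ n
      k₁≤n = ≤-trans k₁≤k k≤n
      n≤ : n ≤ (n ∸ k₁) + (n ∸ k₁)
      n≤ = begin
        n                       ≡⟨ m∸n+n≡m k₁≤n ⟨
        (n ∸ k₁) + k₁           ≤⟨ +-monoʳ-≤ (n ∸ k₁) (+-cancelʳ-≤ k₁ k₁ (n ∸ k₁) (begin
          k₁ + k₁                 ≤⟨ +-mono-≤ k₁≤k k₁≤k ⟩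
          k + k                   ≤⟨ ≤-from (6 * k) (e₂ k) ⟩
          8 * k                   ≤⟨ 8k≤n ⟩
          n                       ≡⟨ m∸n+n≡m k₁≤n ⟨
          (n ∸ k₁) + k₁           ∎)) ⟩
        (n ∸ k₁) + (n ∸ k₁)     ∎
        where
        e₂ : ∀ k → k + k + 6 * k ≡ 8 * k
        e₂ = solve-∀
    a = cnt l P
    dense₀ : n ^ l ≤ N * a
    dense₀ = *-cancelˡ-≤ N₁ {{>-nonZero N₁>0}} (begin
      N₁ * n ^ l                         ≤⟨ *-monoˡ-≤ (n ^ l) (≤-trans h (*-monoʳ-≤ (4 * q) link≤U)) ⟩
      4 * q * U k₁ g * n ^ l             ≡⟨ *-assoc (4 * q) (U k₁ g) (n ^ l) ⟩
      4 * q * (U k₁ g * n ^ l)           ≤⟨ *-monoʳ-≤ (4 * q) (level≤words k₁ k₁>0 (≤-trans (*-monoʳ-≤ 8 k₁≤k) 8k≤n)) ⟩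
      4 * q * (2 * (n C k₁) * E l ⊥)     ≤⟨ *-monoʳ-≤ (4 * q) (*-mono-≤ (*-monoʳ-≤ 2 C≤2N₁)
                                              (∑-mono (seqs (allFin n) l) λ w → ind-mono (up-mono F (add-addAll-⊆ w j)))) ⟩
      4 * q * (2 * (2 * N₁) * a)         ≡⟨ e₁ q N₁ a ⟩
      N₁ * (N * a)                       ∎)
      where
      e₁ : ∀ q b a → 4 * q * (2 * (2 * b) * a) ≡ b * (16 * q * a)
      e₁ = solve-∀
    amplified : n ^ (N * l) ≤ 2 * cnt (N * l) P
    amplified = *-cancelˡ-≤ (N * a) {{>-nonZero (≤-trans (m^n>0 n l) dense₀)}} (begin
      N * a * n ^ (N * l)                ≤⟨ cnt-amplify mP N l ⟩
      Z * (n ^ l + N * a)                ≤⟨ *-monoʳ-≤ Z (+-monoˡ-≤ (N * a) dense₀) ⟩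
      Z * (N * a + N * a)                ≡⟨ e₁ Z (N * a) ⟩
      N * a * (2 * Z)                    ∎)
      where
      Z = cnt (N * l) P
      e₁ : ∀ z b → z * (b + b) ≡ b * (2 * z)
      e₁ = solve-∀

  -- A random word meets J with probability at most s Λ / n ≤ 1/12, so discarding such words leaves
  -- at least 1/4 of the 1/2.
  restricted-dense : ∀ (F G : Family n) (J : Subset n) j → ∣ J ∣ ≤ s →
    (∀ A → F A ≡ true → (∀ {z} → z ∈ A → z ∈ J → z ≡ j) → G A ≡ true) →
    Heavy F j → n ^ Λ ≤ 4 * cnt Λ (spells G ∘ (j ∷_))
  restricted-dense F G J j J≤s F⇒G heavy = +-cancelʳ-≤ (n ^ Λ) _ _ (begin
    n ^ Λ + n ^ Λ
      ≡⟨ cong (n ^ Λ +_) (sym (+-identityʳ (n ^ Λ))) ⟩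
    2 * n ^ Λ
      ≤⟨ *-monoʳ-≤ 2 heavy ⟩
    2 * (2 * cnt Λ (spells F ∘ (j ∷_)))
      ≤⟨ *-monoʳ-≤ 2 (*-monoʳ-≤ 2 (≤-trans (∑-mono (seqs (allFin n) Λ) split-word) (≤-reflexive (∑-+ (seqs (allFin n) Λ) _ _)))) ⟩
    2 * (2 * (cnt Λ (spells G ∘ (j ∷_)) + H))
      ≡⟨ e₁ (cnt Λ (spells G ∘ (j ∷_))) H ⟩
    4 * cnt Λ (spells G ∘ (j ∷_)) + 4 * H
      ≤⟨ +-monoʳ-≤ (4 * cnt Λ (spells G ∘ (j ∷_))) few ⟩
    4 * cnt Λ (spells G ∘ (j ∷_)) + n ^ Λ ∎)
    where
    open ≤-Reasoning
    H = cnt Λ (any (lookup J))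
    e₁ : ∀ a b → 2 * (2 * (a + b)) ≡ 4 * a + 4 * b
    e₁ = solve-∀
    few : 4 * H ≤ n ^ Λ
    few = *-cancelˡ-≤ n (begin
      n * (4 * H)                 ≡⟨ e₂ n H ⟩
      4 * (n * H)                 ≤⟨ *-monoʳ-≤ 4 (subst (λ z → z * H ≤ Λ * t * z ^ Λ) (length-allFin n) (hit-bound (allFin n) (lookup J) Λ)) ⟩
      4 * (Λ * t * n ^ Λ)         ≡⟨ cong (λ z → 4 * (Λ * z * n ^ Λ)) (sym (∣∣≡∑ J)) ⟩
      4 * (Λ * ∣ J ∣ * n ^ Λ)     ≤⟨ *-monoʳ-≤ 4 (*-monoˡ-≤ (n ^ Λ) (*-monoʳ-≤ Λ J≤s)) ⟩
      4 * (Λ * s * n ^ Λ)         ≤⟨ ≤-from (8 * Λ * s * n ^ Λ) (e₃ Λ s (n ^ Λ)) ⟩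
      12 * s * Λ * n ^ Λ          ≤⟨ *-monoˡ-≤ (n ^ Λ) 12sΛ≤n ⟩
      n * n ^ Λ                   ∎)
      where
      t = ∑ (allFin n) (ind ∘ lookup J)
      e₂ : ∀ n h → n * (4 * h) ≡ 4 * (n * h)
      e₂ = solve-∀
      e₃ : ∀ l s t → 4 * (l * s * t) + 8 * l * s * t ≡ 12 * s * l * t
      e₃ = solve-∀
    split-word : ∀ w → ind (spells F (j ∷ w)) ≤ ind (spells G (j ∷ w)) + ind (any (lookup J) w)
    split-word w with any (lookup J) w in hw
    ... | true = ≤-trans (ind≤1 (spells F (j ∷ w))) (m≤n+m 1 _)
    ... | false = ≤-trans (ind-mono restrict) (m≤m+n _ 0)
      where
      restrict : spells F (j ∷ w) ≡ true → spells G (j ∷ w) ≡ true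
      restrict sw with up⁻ F sw
      ... | A , FA , A⊆ = up⁺ G (F⇒G A FA λ z∈A z∈J → only z∈J (∈-add⁻ j (addAll-add-⊆ w j (A⊆ z∈A)))) A⊆
        where
        only : ∀ {z} → z ∈ J → z ≡ j ⊎ z ∈ addAll w ⊥ → z ≡ j
        only z∈J (inj₁ eq) = eq
        only z∈J (inj₂ p) with ∈-addAll⁻ w p
        ... | inj₂ p∈⊥ = contradiction p∈⊥ ∉⊥
        ... | inj₁ z∈w with () ← trans (sym (∈⇒lookup z∈J)) (any-false (lookup J) w hw z∈w)

  slice : (Subset n → Bool) → Family n
  slice P B = (∣ B ∣ ≡ᵇ Λ) ∧ P B

  slice-uniform : ∀ P → Uniform Λ (slice P)
  slice-uniform P B h = ≡ᵇ-true⁻ ∣ B ∣ Λ (proj₁ (∧-true h))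

  -- `words≤level` carries density from words to Λ-sets. As n C Λ is n / Λ times (n - 1) C (Λ - 1),
  -- density a Λ / (b n) becomes the ratio a / b in which `cross-matching` measures families.
  slice-large : ∀ (P : Subset n → Bool) → (∀ {A B} → A ⊆ B → P A ≡ true → P B ≡ true) → ∀ a b →
    a * Λ * n ^ Λ ≤ b * n * cnt Λ (λ w → P (addAll w ⊥)) → a * (m C⁻ Λ) ≤ b * size (slice P)
  slice-large P mP a b h = *-cancelˡ-≤ n (*-cancelˡ-≤ (n ^ Λ) (begin
    n ^ Λ * (n * (a * (m C⁻ Λ)))        ≡⟨ e₁ (n ^ Λ) n a (m C⁻ Λ) ⟩
    n ^ Λ * a * (n * (m C⁻ Λ))          ≡⟨ cong (n ^ Λ * a *_) (sym Λ*C) ⟩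
    n ^ Λ * a * (Λ * (n C Λ))           ≡⟨ e₂ (n ^ Λ) a Λ (n C Λ) ⟩
    (n C Λ) * (a * Λ * n ^ Λ)           ≤⟨ *-monoʳ-≤ (n C Λ) h ⟩
    (n C Λ) * (b * n * E Λ ⊥)           ≡⟨ e₃ (n C Λ) b n (E Λ ⊥) ⟩
    b * n * ((n C Λ) * E Λ ⊥)           ≤⟨ *-monoʳ-≤ (b * n) (words≤level Λ Λ≤n) ⟩
    b * n * (n ^ Λ * U Λ (ind ∘ P))     ≡⟨ cong (λ z → b * n * (n ^ Λ * z)) (∑-cong (allSubsets n) λ B → sym (ind-∧ (∣ B ∣ ≡ᵇ Λ))) ⟩
    b * n * (n ^ Λ * size (slice P))    ≡⟨ e₄ b n (n ^ Λ) (size (slice P)) ⟩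
    n ^ Λ * (n * (b * size (slice P)))  ∎))
    where
    open ≤-Reasoning
    open Levels (ind ∘ P) (λ A⊆B → ind-mono (mP A⊆B))
    Λ*C : Λ * (n C Λ) ≡ n * (m C⁻ Λ)
    Λ*C = go Λ Λ>0
      where
      go : ∀ l → 0 < l → l * (n C l) ≡ n * (m C⁻ l)
      go (suc l) _ = extract′ l
    ind-∧ : ∀ a {b} → ind (a ∧ b) ≡ ind a * ind b
    ind-∧ true {b} = sym (+-identityʳ (ind b))
    ind-∧ false = refl
    e₁ : ∀ t n a c → t * (n * (a * c)) ≡ t * a * (n * c)
    e₁ = solve-∀
    e₂ : ∀ t a l c → t * a * (l * c) ≡ c * (a * l * t)
    e₂ = solve-∀
    e₃ : ∀ c b n y → c * (b * n * y) ≡ b * n * (c * y)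
    e₃ = solve-∀
    e₄ : ∀ b n t u → b * n * (t * u) ≡ t * (n * (b * u))
    e₄ = solve-∀

  C⁻-positive : 0 < m C⁻ Λ
  C⁻-positive = go Λ Λ>0 Λ≤n
    where
    go : ∀ l → 0 < l → l ≤ n → 0 < m C⁻ l
    go (suc l) _ h = C-positive (s≤s⁻¹ (≤-trans h (≤-reflexive n≡)))

-- Matching families with heavy letters

∑-update : ∀ n (i : Fin n) f g → (∀ j → j ≢ i → g j ≡ f j) → ∑ (allFin n) g + f i ≡ ∑ (allFin n) f + g i
∑-update (suc n) zero f g h rewrite ∑-allFin-suc n f | ∑-allFin-suc n g
  | ∑-cong (allFin n) (λ j → h (suc j) λ ()) = e (g zero) (∑ (allFin n) (f ∘ suc)) (f zero)
  where
  e : ∀ a b c → a + b + c ≡ c + b + a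
  e = solve-∀
∑-update (suc n) (suc i) f g h rewrite ∑-allFin-suc n f | ∑-allFin-suc n g | h zero (λ ()) =
  trans (+-assoc (f zero) _ _) (trans (cong (f zero +_) (∑-update n i (f ∘ suc) (g ∘ suc) λ j j≢i → h (suc j) (j≢i ∘ suc-inj)))
    (sym (+-assoc (f zero) _ _)))
  where
  suc-inj : ∀ {j} → Fin.suc j ≡ suc i → j ≡ i
  suc-inj refl = refl

isEmpty⁺ : ∀ {n} (B : Subset n) → (∀ {z} → z ∉ B) → isEmpty B ≡ true
isEmpty⁺ [] h = refl
isEmpty⁺ (true ∷ B) h = contradiction here h
isEmpty⁺ (false ∷ B) h = isEmpty⁺ B λ p → h (there p)

isEmpty⁻ : ∀ {n} (B : Subset n) → isEmpty B ≡ true → ∀ {z} → z ∉ B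
isEmpty⁻ (false ∷ B) h (there p) = isEmpty⁻ B h p

∈-∖S⁻ : ∀ {n k} (F : Family n) J → Uniform k F → ∀ A → (F ∖ S n k J) A ≡ true → F A ≡ true × Disjoint A J
∈-∖S⁻ {k = k} F J u A h with ∧-true {F A} h
... | FA , notS rewrite u A FA | ≡ᵇ-refl k = FA , λ z∈A z∈J → isEmpty⁻ (A ∩ J) (unnot _ notS) (x∈p∩q⁺ (z∈A , z∈J))
  where
  unnot : ∀ b → not (not b) ≡ true → b ≡ true
  unnot true _ = refl

∈-∖S⁺ : ∀ {n k} (F : Family n) J → ∀ A → F A ≡ true → Disjoint A J → (F ∖ S n k J) A ≡ true
∈-∖S⁺ {k = k} F J A FA d rewrite FA | isEmpty⁺ (A ∩ J) (λ z∈ → let z∈A , z∈J = x∈p∩q⁻ A J z∈ in d z∈A z∈J) = none (∣ A ∣ ≡ᵇ k)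
  where
  none : ∀ b → not (b ∧ false) ≡ true
  none true = refl
  none false = refl

∈-del⁺ : ∀ {n} {z : Fin n} {A} x → z ≢ x → z ∈ A → z ∈ del x A
∈-del⁺ zero z≢x here = contradiction refl z≢x
∈-del⁺ zero z≢x (there p) = there p
∈-del⁺ (suc x) z≢x here = here
∈-del⁺ (suc x) z≢x (there p) = there (∈-del⁺ x (z≢x ∘ cong suc) p)

-- A member that avoids J without j either contains j or avoids J.
card-∖-del : ∀ {n k} (F : Family n) J j → Uniform k F →
  card (F ∖ S n k (del j J)) ≤ (∑[ A ← allSubsets n ] (ind (lookup A j) * ind (F A))) + card (F ∖ S n k J)
card-∖-del {n} {k} F J j u rewrite card≡∑ (F ∖ S n k (del j J)) | card≡∑ (F ∖ S n k J) =
  ≤-trans (∑-mono (allSubsets n) pointwise) (≤-reflexive (∑-+ (allSubsets n) _ _))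
  where
  pointwise : ∀ A → ind ((F ∖ S n k (del j J)) A) ≤ ind (lookup A j) * ind (F A) + ind ((F ∖ S n k J) A)
  pointwise A with lookup A j in Aj
  ... | true = ≤-trans (ind-mono λ h → proj₁ (∈-∖S⁻ F (del j J) u A h)) (≤-trans (≤-reflexive (sym (+-identityʳ (ind (F A))))) (m≤m+n _ _))
  ... | false = ind-mono λ h → let FA , d = ∈-∖S⁻ F (del j J) u A h in
    ∈-∖S⁺ F J A FA λ {z} z∈A z∈J → d z∈A (∈-del⁺ j (λ { refl → lookup-false⇒∉ Aj z∈A }) z∈J)

cross-matching′ : ∀ {m n s} → n ≡ suc m → ∀ Q (w k : Fin s → ℕ) (F : Fin s → Family n) → (∀ i → Uniform (k i) (F i)) →
  ∑ (allFin s) w ≤ Q → (∀ i → Q * (m C⁻ k i) < w i * size (F i)) → CrossMatching F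
cross-matching′ refl = cross-matching _

module Main (m n q κ s K : ℕ) (n≡ : n ≡ suc m) (k k₁ e Bm : Fin s → ℕ) (k≡ : ∀ i → k i ≡ suc (k₁ i)) (K≡ : K ≡ κ * (40 * q))
  (Bm≡ : ∀ i → Bm i ≡ 3 * (K * K * K) * dbl (e i)) (2k≤ℓ : ∀ i → 2 * k i ≤ dbl (e i)) (ℓ≤4k+1 : ∀ i → dbl (e i) ≤ 2 * (2 * k i) + 1)
  (k₁>0 : ∀ i → 0 < k₁ i) (q>0 : 0 < q) (s>0 : 0 < s) (κ-large : 2048 ≤ κ)
  (room : ∀ i → 60 * κ * (K * K * K) * (s * k i) ≤ n)
  (F : Fin s → Family n) (uniform : ∀ i → Uniform (k i) (F i)) (no-matching : ¬ CrossMatching F)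
  (residual : ∀ i r J → ∣ J ∣ + r ≡ s → 2 ≤ r → r * (m C k₁ i) ≤ 4 * q * card (F i ∖ S n (k i) J)) where

  module At (i : Fin s) = Scale m n q κ s (k i) (k₁ i) K (e i) (Bm i) n≡ (k≡ i) K≡ (Bm≡ i) (2k≤ℓ i) (ℓ≤4k+1 i)
    (k₁>0 i) q>0 s>0 κ-large (room i)

  N₁ : Fin s → ℕ
  N₁ i = m C k₁ i

  Heavy : Fin s → Fin n → Set
  Heavy i j = At.Heavy i (F i) j

  heavy? : ∀ i j → Dec (Heavy i j)
  heavy? i j = _ ≤? _

  rest : Subset n → Fin s → ℕ
  rest J i = card (F i ∖ S n (k i) J)

  free : (Fin s → Maybe (Fin n)) → Fin s → ℕ
  free μ i = ind (is-nothing (μ i))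

  -- `J` is a field rather than the image of μ, so that `swap` can reassign letters and keep `J` by
  -- `refl`.
  record Matching (r : ℕ) : Set where
    field
      J : Subset n
      μ : Fin s → Maybe (Fin n)
      ∣J∣+r : ∣ J ∣ + r ≡ s
      ∑free : ∑ (allFin s) (free μ) ≡ r
      μ∈J : ∀ {i j} → μ i ≡ just j → j ∈ J
      μ-heavy : ∀ {i j} → μ i ≡ just j → Heavy i j
      μ-injective : ∀ {i i′ j} → μ i ≡ just j → μ i′ ≡ just j → i ≡ i′

    r≤s : r ≤ s
    r≤s = m+n≤o⇒n≤o ∣ J ∣ (≤-reflexive ∣J∣+r)

    free>0 : ∀ {i} → μ i ≡ nothing → 0 < r
    free>0 {i} eq = ≤-trans (≤-reflexive (cong (ind ∘ is-nothing) (sym eq)))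
      (≤-trans (∑-member (free μ) (∈-allFin i)) (≤-reflexive ∑free))

  seat : Maybe (Fin n) → Subset n → Subset n
  seat nothing B = B
  seat (just j) B = add j B

  seat-⊆ : ∀ x {A B} → A ⊆ B → seat x A ⊆ seat x B
  seat-⊆ nothing A⊆B = A⊆B
  seat-⊆ (just j) A⊆B = add-⊆ j A⊆B

  seat⁻ : ∀ x {B z} → z ∈ seat x B → x ≡ just z ⊎ z ∈ B
  seat⁻ nothing p = inj₂ p
  seat⁻ (just j) p = [ (λ { refl → inj₁ refl }) , inj₂ ]′ (∈-add⁻ j p)

  -- Used three times: for r = 0 against a perfect matching, for r = 1 to bound the unmatched family
  -- outside `J`, and for r ≥ 2 to exclude matchings that cannot be extended.
  module Completion {r} (M : Matching r)
    (large : ∀ i → Matching.μ M i ≡ nothing → r * N₁ i ≤ 4 * q * rest (Matching.J M) i)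
    (light : ∀ i → Matching.μ M i ≡ nothing → ∀ j → j ∉ Matching.J M → ¬ Heavy i j) where

    open Matching M

    -- Members meeting `J` at most in their own letter. As letters are distinct, only disjointness
    -- outside `J` remains to be arranged.
    G : Fin s → Maybe (Fin n) → Family n
    G i x A = F i A ∧ does ((A ∩ J) ⊆? seat x ⊥)

    G⊆F : ∀ i x A → G i x A ≡ true → F i A ≡ true
    G⊆F i x A h = proj₁ (∧-true h)

    G-trace : ∀ i x A → G i x A ≡ true → ∀ {z} → z ∈ A → z ∈ J → x ≡ just z
    G-trace i x A h z∈A z∈J with seat⁻ x (does⁻ ((A ∩ J) ⊆? seat x ⊥) (proj₂ (∧-true {F i A} h)) (x∈p∩q⁺ (z∈A , z∈J)))
    ... | inj₁ eq = eq
    ... | inj₂ p = contradiction p ∉⊥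

    G⁺ : ∀ i x A → F i A ≡ true → (A ∩ J) ⊆ seat x ⊥ → G i x A ≡ true
    G⁺ i x A FA tr rewrite FA = dec-true ((A ∩ J) ⊆? seat x ⊥) tr

    P : Fin s → Maybe (Fin n) → Subset n → Bool
    P i x B = up (G i x) (seat x B)

    P-mono : ∀ i x {A B} → A ⊆ B → P i x A ≡ true → P i x B ≡ true
    P-mono i x A⊆B = up-mono (G i x) (seat-⊆ x A⊆B)

    -- In terms of u = Q / weight, unmatched families have u = 2 (r + 1) and matched ones u = 2s, so
    -- each kind contributes at most 1/2 to the sum of 1 / u. The available ratios are larger: 6 r >
    -- 2 (r + 1) for r ≥ 1, and density 1/4 is at least 3 s Λ / n.
    weight : Maybe (Fin n) → ℕ
    weight nothing = s
    weight (just _) = suc r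

    Q : ℕ
    Q = 2 * (suc r * s)

    weights≤Q : ∑[ i ← allFin s ] weight (μ i) ≤ Q
    weights≤Q = begin
      ∑[ i ← allFin s ] weight (μ i)
        ≤⟨ ∑-mono (allFin s) (λ i → bound (μ i)) ⟩
      ∑[ i ← allFin s ] (s * free μ i + suc r)
        ≡⟨ trans (∑-+ (allFin s) _ _) (cong₂ _+_ (trans (∑-*ˡ (allFin s) s (free μ)) (cong (s *_) ∑free)) (∑-allFin-const s (suc r))) ⟩
      s * r + s * suc r
        ≤⟨ ≤-from s (lem s r) ⟩
      Q ∎
      where
      open ≤-Reasoning
      bound : ∀ x → weight x ≤ s * ind (is-nothing x) + suc r
      bound nothing = ≤-trans (≤-reflexive (sym (*-identityʳ s))) (m≤m+n _ _)
      bound (just _) = m≤n+m _ (s * 0)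
      lem : ∀ s r → s * r + s * (1 + r) + s ≡ 2 * ((1 + r) * s)
      lem = solve-∀

    Large : Fin s → Maybe (Fin n) → Set
    Large i x = Q * (m C⁻ At.Λ i) < weight x * size (At.slice i (P i x))

    large-free : ∀ i → μ i ≡ nothing → Large i nothing
    large-free i eq = begin-strict
      2 * (suc r * s) * c       ≤⟨ *-monoˡ-≤ c (*-monoʳ-≤ 2 (*-monoˡ-≤ s (+-monoˡ-≤ r r>0))) ⟩
      2 * ((r + r) * s) * c     <⟨ gap ⟩
      s * (6 * r * c)           ≤⟨ *-monoʳ-≤ s (At.slice-large i (P i nothing) (P-mono i nothing) (6 * r) 1
                                     (≤-trans dense (≤-reflexive (cong (_* At.cnt i (At.Λ i) (spells (G i nothing))) (sym (*-identityˡ n)))))) ⟩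
      s * (1 * size (At.slice i (P i nothing))) ≡⟨ cong (s *_) (*-identityˡ _) ⟩
      s * size (At.slice i (P i nothing)) ∎
      where
      open ≤-Reasoning
      c = m C⁻ At.Λ i
      r>0 : 0 < r
      r>0 = free>0 eq
      gap : 2 * ((r + r) * s) * c < s * (6 * r * c)
      gap = ≤-trans (+-monoˡ-≤ (2 * ((r + r) * s) * c) {1} {2 * (r * s * c)} (*-mono-≤ {1} {2} (s≤s z≤n) (*-mono-≤ (*-mono-≤ r>0 s>0) (At.C⁻-positive i))))
        (≤-reflexive (lem r s c))
        where
        lem : ∀ r s c → 2 * (r * s * c) + 2 * ((r + r) * s) * c ≡ s * (6 * r * c)
        lem = solve-∀
      dense : 6 * r * At.Λ i * n ^ At.Λ i ≤ n * At.cnt i (At.Λ i) (spells (G i nothing))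
      dense = At.residual-dense i r (G i nothing) J (λ A h → uniform i A (G⊆F i nothing A h)) r>0 r≤s
        (≤-trans (large i eq) (*-monoʳ-≤ (4 * q) rest≤))
        (λ A h z∈A z∈J → contradiction (G-trace i nothing A h z∈A z∈J) (λ ()))
        (λ j j∉J hv → light i eq j j∉J (At.heavy-mono i {G i nothing} {F i} (G⊆F i nothing) hv))
        where
        rest≤ : rest J i ≤ size (G i nothing)
        rest≤ = ≤-trans (≤-reflexive (card≡∑ (F i ∖ S n (k i) J))) (∑-mono (allSubsets n) λ A → ind-mono λ h →
          let FA , d = ∈-∖S⁻ (F i) J (uniform i) A h in
          G⁺ i nothing A FA λ z∈ → let z∈A , z∈J = x∈p∩q⁻ A J z∈ in contradiction z∈J (d z∈A))

    large-matched : ∀ i j → μ i ≡ just j → Large i (just j)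
    large-matched i j eq = begin-strict
      2 * (suc r * s) * c       <⟨ gap ⟩
      suc r * (3 * s * c)       ≤⟨ *-monoʳ-≤ (suc r) (*-cancelˡ-≤ 4 (≤-trans (≤-reflexive (e₁ s c))
                                     (At.slice-large i (P i (just j)) (P-mono i (just j)) (12 * s) 4 dense))) ⟩
      suc r * size (At.slice i (P i (just j))) ∎
      where
      open ≤-Reasoning
      c = m C⁻ At.Λ i
      e₁ : ∀ s c → 4 * (3 * s * c) ≡ 12 * s * c
      e₁ = solve-∀
      gap : 2 * (suc r * s) * c < suc r * (3 * s * c)
      gap = ≤-trans (+-monoˡ-≤ (2 * (suc r * s) * c) {1} {suc r * s * c} (*-mono-≤ (*-mono-≤ {1} {suc r} (s≤s z≤n) s>0) (At.C⁻-positive i)))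
        (≤-reflexive (lem (suc r) s c))
        where
        lem : ∀ r s c → r * s * c + 2 * (r * s) * c ≡ r * (3 * s * c)
        lem = solve-∀
      dense : 12 * s * At.Λ i * n ^ At.Λ i ≤ 4 * n * At.cnt i (At.Λ i) (λ w → P i (just j) (addAll w ⊥))
      dense = begin
        12 * s * At.Λ i * n ^ At.Λ i     ≤⟨ *-monoˡ-≤ (n ^ At.Λ i) (At.12sΛ≤n i) ⟩
        n * n ^ At.Λ i                   ≤⟨ *-monoʳ-≤ n (At.restricted-dense i (F i) (G i (just j)) J j
                                              (m+n≤o⇒m≤o ∣ J ∣ (≤-reflexive ∣J∣+r)) keep (μ-heavy eq)) ⟩
        n * (4 * At.cnt i (At.Λ i) (spells (G i (just j)) ∘ (j ∷_)))
          ≤⟨ *-monoʳ-≤ n (*-monoʳ-≤ 4 (At.cnt-mono i (At.Λ i) {spells (G i (just j)) ∘ (j ∷_)} λ w → up-mono (G i (just j)) (addAll-add-⊆ w j))) ⟩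
        n * (4 * At.cnt i (At.Λ i) (λ w → P i (just j) (addAll w ⊥)))
          ≡⟨ e₂ n (At.cnt i (At.Λ i) (λ w → P i (just j) (addAll w ⊥))) ⟩
        4 * n * At.cnt i (At.Λ i) (λ w → P i (just j) (addAll w ⊥)) ∎
        where
        e₂ : ∀ n c → n * (4 * c) ≡ 4 * n * c
        e₂ = solve-∀
        keep : ∀ A → F i A ≡ true → (∀ {z} → z ∈ A → z ∈ J → z ≡ j) → G i (just j) A ≡ true
        keep A FA only = G⁺ i (just j) A FA λ z∈ → let z∈A , z∈J = x∈p∩q⁻ A J z∈ in
          subst (_∈ add j ⊥) (sym (only z∈A z∈J)) (∈-add-self j ⊥)

    large-all : ∀ i x → μ i ≡ x → Large i x
    large-all i nothing = large-free i
    large-all i (just j) = large-matched i j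

    -- A member found below `B i` and its letter lies outside `J` within `B i`, where the matching
    -- of slices separates it from the others; inside `J` the injectivity of μ does.
    restrict : CrossMatching (λ i → At.slice i (P i (μ i))) → CrossMatching F
    restrict (B , B∈ , dis) = proj₁ ∘ A , (λ i → G⊆F i (μ i) _ (proj₁ (proj₂ (A i)))) ,
      λ i i′ i≢i′ → Disjoint⇒∩≡⊥ (separate i i′ i≢i′)
      where
      A : ∀ i → ∃ λ A → G i (μ i) A ≡ true × A ⊆ seat (μ i) (B i)
      A i = up⁻ (G i (μ i)) (proj₂ (∧-true (B∈ i)))
      inside : ∀ i {z} → z ∉ J → z ∈ proj₁ (A i) → z ∈ B i
      inside i z∉J q = [ (λ eq → contradiction (μ∈J eq) z∉J) , (λ r → r) ]′ (seat⁻ (μ i) (proj₂ (proj₂ (A i)) q))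
      separate : ∀ i i′ → i ≢ i′ → Disjoint (proj₁ (A i)) (proj₁ (A i′))
      separate i i′ i≢i′ {z} p p′ with z ∈? J
      ... | yes z∈J = i≢i′ (μ-injective (G-trace i (μ i) _ (proj₁ (proj₂ (A i))) p z∈J)
                                        (G-trace i′ (μ i′) _ (proj₁ (proj₂ (A i′))) p′ z∈J))
      ... | no z∉J = ∩≡⊥⇒Disjoint (dis i i′ i≢i′) (inside i z∉J p) (inside i′ z∉J p′)

    result : CrossMatching F
    result = restrict (cross-matching′ n≡ Q (weight ∘ μ) At.Λ (λ i → At.slice i (P i (μ i)))
      (λ i → At.slice-uniform i (P i (μ i))) weights≤Q (λ i → large-all i (μ i) refl))

  empty-matching : Matching s
  empty-matching = record
    { J = ⊥
    ; μ = const nothing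
    ; ∣J∣+r = cong (_+ s) (∣⊥∣≡0 n)
    ; ∑free = trans (∑-allFin-const s 1) (*-identityʳ s)
    ; μ∈J = λ ()
    ; μ-heavy = λ ()
    ; μ-injective = λ ()
    }

  extend : ∀ {r} (M : Matching (suc r)) i j → Matching.μ M i ≡ nothing → j ∉ Matching.J M → Heavy i j → Matching r
  extend {r} M i j μi j∉J hij = record
    { J = add j J
    ; μ = μ′
    ; ∣J∣+r = trans (cong (_+ r) (∣add∣ j J (∉⇒lookup j∉J))) (trans (sym (+-suc ∣ J ∣ r)) ∣J∣+r)
    ; ∑free = suc-injective (trans (sym (+-comm _ 1)) (begin
        ∑ (allFin s) (free μ′) + 1          ≡⟨ cong (λ z → ∑ (allFin s) (free μ′) + ind (is-nothing z)) μi ⟨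
        ∑ (allFin s) (free μ′) + free μ i   ≡⟨ ∑-update s i (free μ) (free μ′) (λ l l≢i → cong (ind ∘ is-nothing) (updateAt-minimal l i μ l≢i)) ⟩
        ∑ (allFin s) (free μ) + free μ′ i   ≡⟨ cong₂ _+_ ∑free (cong (ind ∘ is-nothing) (updateAt-updates i μ)) ⟩
        suc r + 0                           ≡⟨ +-identityʳ (suc r) ⟩
        suc r                               ∎))
    ; μ∈J = λ {l} eq → [ (λ { (_ , refl) → ∈-add-self j J }) , (λ eq′ → ∈-add⁺ j (μ∈J eq′)) ]′ (cases l eq)
    ; μ-heavy = λ {l} eq → [ (λ { (refl , refl) → hij }) , μ-heavy ]′ (cases l eq)
    ; μ-injective = λ {l} {l′} eq eq′ → injective (cases l eq) (cases l′ eq′)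
    }
    where
    open ≡-Reasoning
    open Matching M
    μ′ = updateAt μ i (const (just j))
    cases : ∀ l {x} → μ′ l ≡ just x → (l ≡ i × x ≡ j) ⊎ μ l ≡ just x
    cases l eq with l Fin.≟ i
    ... | yes refl = inj₁ (refl , just-injective (trans (sym eq) (updateAt-updates i μ)))
    ... | no l≢i = inj₂ (trans (sym (updateAt-minimal l i μ l≢i)) eq)
    injective : ∀ {l l′ x} → (l ≡ i × x ≡ j) ⊎ μ l ≡ just x → (l′ ≡ i × x ≡ j) ⊎ μ l′ ≡ just x → l ≡ l′
    injective (inj₁ (refl , _)) (inj₁ (refl , _)) = refl
    injective (inj₁ (_ , refl)) (inj₂ eq) = contradiction (μ∈J eq) j∉J
    injective (inj₂ eq) (inj₁ (_ , refl)) = contradiction (μ∈J eq) j∉J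
    injective (inj₂ eq) (inj₂ eq′) = μ-injective eq eq′

  swap : (M : Matching 1) → ∀ i₀ i j → Matching.μ M i₀ ≡ nothing → Matching.μ M i ≡ just j → Heavy i₀ j →
    ∃ λ M′ → Matching.J M′ ≡ Matching.J M × Matching.μ M′ i ≡ nothing
  swap M i₀ i j μi₀ μi h = record
    { J = J
    ; μ = μ₂
    ; ∣J∣+r = ∣J∣+r
    ; ∑free = +-cancelʳ-≡ 1 _ 1 (begin
        ∑ (allFin s) (free μ₂) + 1           ≡⟨ cong (∑ (allFin s) (free μ₂) +_) (cong (ind ∘ is-nothing) (trans (updateAt-minimal i₀ i μ i₀≢i) μi₀)) ⟨
        ∑ (allFin s) (free μ₂) + free μ₁ i₀  ≡⟨ ∑-update s i₀ (free μ₁) (free μ₂) (λ l l≢ → cong (ind ∘ is-nothing) (updateAt-minimal l i₀ μ₁ l≢)) ⟩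
        ∑ (allFin s) (free μ₁) + free μ₂ i₀  ≡⟨ cong (∑ (allFin s) (free μ₁) +_) (cong (ind ∘ is-nothing) (updateAt-updates i₀ μ₁)) ⟩
        ∑ (allFin s) (free μ₁) + 0           ≡⟨ cong (∑ (allFin s) (free μ₁) +_) (cong (ind ∘ is-nothing) μi) ⟨
        ∑ (allFin s) (free μ₁) + free μ i    ≡⟨ ∑-update s i (free μ) (free μ₁) (λ l l≢ → cong (ind ∘ is-nothing) (updateAt-minimal l i μ l≢)) ⟩
        ∑ (allFin s) (free μ) + free μ₁ i    ≡⟨ cong₂ _+_ ∑free (cong (ind ∘ is-nothing) (updateAt-updates i μ)) ⟩
        2                                    ∎)
    ; μ∈J = λ {l} eq → [ (λ { (_ , refl) → μ∈J μi }) , (λ (_ , eq′) → μ∈J eq′) ]′ (cases l eq)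
    ; μ-heavy = λ {l} eq → [ (λ { (refl , refl) → h }) , (λ (_ , eq′) → μ-heavy eq′) ]′ (cases l eq)
    ; μ-injective = λ {l} {l′} eq eq′ → injective (cases l eq) (cases l′ eq′)
    } , refl , trans (updateAt-minimal i i₀ μ₁ (i₀≢i ∘ sym)) (updateAt-updates i μ)
    where
    open ≡-Reasoning
    open Matching M
    μ₁ = updateAt μ i (const nothing)
    μ₂ = updateAt μ₁ i₀ (const (just j))
    i₀≢i : i₀ ≢ i
    i₀≢i refl with () ← trans (sym μi₀) μi
    cases : ∀ l {x} → μ₂ l ≡ just x → (l ≡ i₀ × x ≡ j) ⊎ (l ≢ i × μ l ≡ just x)
    cases l eq with l Fin.≟ i₀
    ... | yes refl = inj₁ (refl , just-injective (trans (sym eq) (updateAt-updates i₀ μ₁)))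
    ... | no l≢i₀ with l Fin.≟ i
    ...   | no l≢i = inj₂ (l≢i , trans (sym (trans (updateAt-minimal l i₀ μ₁ l≢i₀) (updateAt-minimal l i μ l≢i))) eq)
    ...   | yes refl with () ← trans (sym eq) (trans (updateAt-minimal i i₀ μ₁ l≢i₀) (updateAt-updates i μ))
    injective : ∀ {l l′ x} → (l ≡ i₀ × x ≡ j) ⊎ (l ≢ i × μ l ≡ just x) → (l′ ≡ i₀ × x ≡ j) ⊎ (l′ ≢ i × μ l′ ≡ just x) → l ≡ l′
    injective (inj₁ (refl , _)) (inj₁ (refl , _)) = refl
    injective (inj₁ (_ , refl)) (inj₂ (l′≢i , eq)) = contradiction (μ-injective eq μi) l′≢i
    injective (inj₂ (l≢i , eq)) (inj₁ (_ , refl)) = contradiction (μ-injective eq μi) l≢i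
    injective (inj₂ (_ , eq)) (inj₂ (_ , eq′)) = μ-injective eq eq′

  no-perfect : ¬ Matching 0
  no-perfect M = no-matching (Completion.result M (λ i eq → contradiction (free>0 eq) λ ()) (λ i eq → contradiction (free>0 eq) λ ()))
    where open Matching M

  module Last (M : Matching 1) (i : Fin s) (μi : Matching.μ M i ≡ nothing) where

    open Matching M

    -- Assigning an arbitrary letter to i lowers the number of free families from 1 to 0, whereas
    -- another free l would still count.
    only-free : ∀ l → μ l ≡ nothing → l ≡ i
    only-free l μl with l Fin.≟ i
    ... | yes eq = eq
    ... | no l≢i = contradiction (begin
      2                               ≡⟨ cong₂ _+_ (cong (ind ∘ is-nothing) μi) (cong (ind ∘ is-nothing) μl) ⟨
      free μ i + free μ l             ≡⟨ cong (free μ i +_) (cong (ind ∘ is-nothing) (updateAt-minimal l i {const (just (someLetter μ))} μ l≢i)) ⟨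
      free μ i + free μ′ l            ≤⟨ +-monoʳ-≤ (free μ i) (∑-member (free μ′) (∈-allFin l)) ⟩
      free μ i + ∑ (allFin s) (free μ′) ≡⟨ +-comm (free μ i) _ ⟩
      ∑ (allFin s) (free μ′) + free μ i ≡⟨ ∑-update s i (free μ) (free μ′) (λ a a≢i → cong (ind ∘ is-nothing) (updateAt-minimal a i μ a≢i)) ⟩
      ∑ (allFin s) (free μ) + free μ′ i ≡⟨ cong₂ _+_ ∑free (cong (ind ∘ is-nothing) (updateAt-updates i μ)) ⟩
      1                               ∎) λ { (s≤s ()) }
      where
      open ≤-Reasoning
      someLetter : (Fin s → Maybe (Fin n)) → Fin n
      someLetter _ = subst Fin (sym n≡) zero
      μ′ = updateAt μ i (const (just (someLetter μ)))

    -- It follows from `no-perfect` for every matching with one free family, and so applies to those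
    -- produced by `swap`.
    light : ∀ l → μ l ≡ nothing → ∀ j → j ∉ J → ¬ Heavy l j
    light l μl j j∉J hv = no-perfect (extend M l j μl j∉J hv)

    rest-small : 4 * q * rest J i < N₁ i
    rest-small = ≰⇒> λ le → no-matching (Completion.result M
      (λ l μl → subst (λ z → 1 * N₁ z ≤ 4 * q * rest J z) (sym (only-free l μl)) (≤-trans (≤-reflexive (*-identityˡ (N₁ i))) le)) light)

    -- By `residual` with r = 2, at least 2 `N₁` / (4 q) members avoid J without j. Fewer than `N₁`
    -- / (4 q) avoid all of J, so the difference must come from the link of j.
    J-heavy : ∀ j → j ∈ J → Heavy i j
    J-heavy j j∈J = At.heavy-from-link i (F i) j (uniform i) (<⇒≤ (+-cancelʳ-< (4 * q * rest J i) _ _ (begin-strict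
      N₁ i + 4 * q * rest J i             <⟨ +-monoʳ-< (N₁ i) rest-small ⟩
      N₁ i + N₁ i                         ≡⟨ cong (N₁ i +_) (+-identityʳ (N₁ i)) ⟨
      2 * N₁ i                            ≤⟨ residual i 2 (del j J) size-del ≤-refl ⟩
      4 * q * rest (del j J) i            ≤⟨ *-monoʳ-≤ (4 * q) (card-∖-del (F i) J j (uniform i)) ⟩
      4 * q * (At.link-size i (F i) j + rest J i) ≡⟨ *-distribˡ-+ (4 * q) (At.link-size i (F i) j) (rest J i) ⟩
      4 * q * At.link-size i (F i) j + 4 * q * rest J i ∎)))
      where
      open ≤-Reasoning
      size-del : ∣ del j J ∣ + 2 ≡ s
      size-del = trans (+-suc ∣ del j J ∣ 1) (trans (cong (_+ 1) (sym (∣del∣ j J (∈⇒lookup j∈J)))) ∣J∣+r)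

  Conclusion : Set
  Conclusion = ∃ λ J → ∣ J ∣ ≡ s ∸ 1 × (∀ i → 4 * q * rest J i < N₁ i)

  conclude : Matching 1 → Conclusion
  conclude M = J , cong (_∸ 1) (trans (+-comm 1 ∣ J ∣) ∣J∣+r) , λ i → all i (μ i) refl
    where
    open Matching M
    unmatched : ∃ λ i → 0 < free μ i
    unmatched = ∑-positive (allFin s) (free μ) (≤-reflexive (sym ∑free))
    i₀ = proj₁ unmatched
    nothing⁻ : ∀ x → 0 < ind (is-nothing x) → x ≡ nothing
    nothing⁻ nothing _ = refl
    μi₀ : μ i₀ ≡ nothing
    μi₀ = nothing⁻ (μ i₀) (proj₂ unmatched)
    all : ∀ i x → μ i ≡ x → 4 * q * rest J i < N₁ i
    all i nothing μi = Last.rest-small M i μi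
    all i (just j) μi = after (swap M i₀ i j μi₀ μi (Last.J-heavy M i₀ μi₀ j (μ∈J μi)))
      where
      after : (∃ λ M′ → Matching.J M′ ≡ J × Matching.μ M′ i ≡ nothing) → 4 * q * rest J i < N₁ i
      after (M′ , J≡ , μ′i) = subst (λ z → 4 * q * rest z i < N₁ i) J≡ (Last.rest-small M′ i μ′i)

  Extendable : ∀ {r} → Matching r → Set
  Extendable M = ∃ λ i → ∃ λ j → Matching.μ M i ≡ nothing × j ∉ Matching.J M × Heavy i j

  extendable? : ∀ {r} (M : Matching r) → Dec (Extendable M)
  extendable? M = any? λ i → any? λ j → nothing? (Matching.μ M i) ×-dec ¬? (j ∈? Matching.J M) ×-dec heavy? i j
    where
    nothing? : ∀ (x : Maybe (Fin n)) → Dec (x ≡ nothing)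
    nothing? nothing = yes refl
    nothing? (just _) = no λ ()

  maximal : ∀ r (M : Matching r) → ¬ Extendable M → Conclusion
  maximal zero M _ = contradiction M no-perfect
  maximal (suc zero) M _ = conclude M
  maximal r@(suc (suc _)) M stuck = contradiction (Completion.result M
    (λ i _ → residual i r (Matching.J M) (Matching.∣J∣+r M) (s≤s (s≤s z≤n)))
    (λ i μi j j∉J hv → stuck (i , j , μi , j∉J , hv))) no-matching

  search : ∀ r → Matching r → Conclusion
  search r M = step r M (extendable? M)
    where
    step : ∀ r (M : Matching r) → Dec (Extendable M) → Conclusion
    step r M (no stuck) = maximal r M stuck
    step zero M (yes _) = contradiction M no-perfect
    step (suc r) M (yes (i , j , μi , j∉J , hv)) = search r (extend M i j μi j∉J hv)

  theorem : Conclusion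
  theorem = search s empty-matching

-- Choice of constants and conclusion

stability : ∀ κ p q K → 2048 ≤ κ → K ≡ κ * (40 * q) → 0 < p → p < q →
  ∀ c → 60 * κ * (K * K * K) ≤ c → ∀ n s (k : Fin s → ℕ) (F : Fin s → Family n) →
  (∀ i → Uniform (k i) (F i)) → (∀ i → c ≤ k i × c * s * k i ≤ n) → ¬ CrossMatching F →
  (∀ i → q * card (S n (k i) (initSeg n (s ∸ 1))) ≤ q * card (F i) + (q ∸ p) * ((n ∸ 1) C (k i ∸ 1))) →
  ∃ λ (J : Subset n) → ∣ J ∣ ≡ s ∸ 1 × (∀ i → q * card (F i ∖ S n (k i) J) ≤ p * ((n ∸ 1) C (k i ∸ 1)))
-- For s = 0 the empty choice is a cross matching.
stability κ p q K κ-large K≡ p>0 p<q c c-large n zero k F u hk no-matching hyp =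
  contradiction ((λ ()) , (λ ()) , (λ ())) no-matching
stability κ p q K κ-large K≡ p>0 p<q c c-large n s@(suc _) k F u hk no-matching hyp =
  weaken (Main.theorem (n ∸ 1) n q κ s K n≡ k (λ i → k i ∸ 1) (λ i → proj₁ (double-between (2 * k i)))
    (λ i → 3 * (K * K * K) * dbl (proj₁ (double-between (2 * k i)))) k≡ K≡ (λ _ → refl)
    (λ i → proj₁ (proj₂ (double-between (2 * k i)))) (λ i → proj₂ (proj₂ (double-between (2 * k i))))
    (λ i → ∸-monoˡ-≤ 1 (k≥2 i)) q>0 z<s κ-large room F u no-matching
    (λ i r J eq r≥2 → residual-large p q c s r (k i) (F i) J p>0 p<q 8q≤c (k≥2 i) (proj₂ (hk i)) eq r≥2 (hyp i)))
  where
  open ≤-Reasoning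
  q>0 : 0 < q
  q>0 = ≤-trans (s≤s z≤n) p<q
  κ>0 : 0 < κ
  κ>0 = ≤-trans (s≤s z≤n) κ-large
  K>0 : 0 < K
  K>0 = subst (0 <_) (sym K≡) (*-mono-≤ κ>0 (*-mono-≤ {1} {40} (s≤s z≤n) q>0))
  8q≤c : 8 * q ≤ c
  8q≤c = begin
    8 * q                    ≤⟨ *-monoˡ-≤ q (≤-from {8} 32 refl) ⟩
    40 * q                   ≤⟨ m≤n*m (40 * q) κ {{>-nonZero κ>0}} ⟩
    κ * (40 * q)             ≡⟨ K≡ ⟨
    K                        ≤⟨ m≤n*m K (K * K) {{>-nonZero (*-mono-≤ K>0 K>0)}} ⟩
    K * K * K                ≤⟨ m≤n*m (K * K * K) (60 * κ) {{m*n≢0 60 κ {{_}} {{>-nonZero κ>0}}}} ⟩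
    60 * κ * (K * K * K)     ≤⟨ c-large ⟩
    c                        ∎
  k≥2 : ∀ i → 2 ≤ k i
  k≥2 i = ≤-trans (≤-trans (*-mono-≤ {2} {8} (s≤s (s≤s z≤n)) q>0) 8q≤c) (proj₁ (hk i))
  c>0 : 0 < c
  c>0 = ≤-trans (*-mono-≤ {1} {8} (s≤s z≤n) q>0) 8q≤c
  k≡ : ∀ i → k i ≡ suc (k i ∸ 1)
  k≡ i = sym (m+[n∸m]≡n {1} (≤-trans (s≤s z≤n) (k≥2 i)))
  n≡ : n ≡ suc (n ∸ 1)
  n≡ = sym (m+[n∸m]≡n {1} (≤-trans (*-mono-≤ (*-mono-≤ c>0 (s≤s {n = s ∸ 1} z≤n)) (≤-trans (s≤s z≤n) (k≥2 zero))) (proj₂ (hk zero))))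
  room : ∀ i → 60 * κ * (K * K * K) * (s * k i) ≤ n
  room i = begin
    60 * κ * (K * K * K) * (s * k i)   ≤⟨ *-monoˡ-≤ (s * k i) c-large ⟩
    c * (s * k i)                      ≡⟨ *-assoc c s (k i) ⟨
    c * s * k i                        ≤⟨ proj₂ (hk i) ⟩
    n                                  ∎
  -- The bound 1 / (4 q) is below ε = p / q because p ≥ 1.
  weaken : (∃ λ J → ∣ J ∣ ≡ s ∸ 1 × (∀ i → 4 * q * card (F i ∖ S n (k i) J) < (n ∸ 1) C (k i ∸ 1))) →
    ∃ λ J → ∣ J ∣ ≡ s ∸ 1 × (∀ i → q * card (F i ∖ S n (k i) J) ≤ p * ((n ∸ 1) C (k i ∸ 1)))
  weaken (J , ∣J∣≡ , small) = J , ∣J∣≡ , λ i → begin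
    q * card (F i ∖ S n (k i) J)       ≤⟨ m≤n*m _ 4 ⟩
    4 * (q * card (F i ∖ S n (k i) J)) ≡⟨ *-assoc 4 q (card (F i ∖ S n (k i) J)) ⟨
    4 * q * card (F i ∖ S n (k i) J)   ≤⟨ <⇒≤ (small i) ⟩
    (n ∸ 1) C (k i ∸ 1)                ≤⟨ m≤n*m _ p {{>-nonZero p>0}} ⟩
    p * ((n ∸ 1) C (k i ∸ 1))          ∎

theorem15p1 : (p q : ℕ) → 0 < p → p < q →
    ∃ λ (C₀ : ℕ) → ∀ (c : ℕ) → c ≥ C₀ →
    ∀ (n s : ℕ) (k : Fin s → ℕ) (F : Fin s → Family n) →
    (∀ i → Uniform (k i) (F i)) →
    (∀ i → c ≤ k i × c * s * k i ≤ n) →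
    ¬ CrossMatching F →
    (∀ i → q * card (S n (k i) (initSeg n (s ∸ 1)))
    ≤ q * card (F i) + (q ∸ p) * ((n ∸ 1) C (k i ∸ 1))) →
    ∃ λ (J : Subset n) → ∣ J ∣ ≡ s ∸ 1 ×
    (∀ i → q * card (F i ∖ S n (k i) J) ≤ p * ((n ∸ 1) C (k i ∸ 1)))
-- Unification finds the threshold 60 κ K³ with κ = 2048 and K = 40 q κ, a constant times q³.
theorem15p1 p q p>0 p<q = _ , stability 2048 p q (2048 * (40 * q)) ≤-refl refl p>0 p<q
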